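{- Let $q\ge8$ be even. The $\mathrm{U}\Gamma$-lines (non-tangent unisecants of the twisted cubic $\mathcal{C}$ lying in an osculating plane) form two orbits under $G_q$, of sizes $q+1$ and $q^2-1$, namely $\{\ell_1\varphi:\varphi\in G_q\}$ and $\{\ell_2\varphi:\varphi\in G_q\}$, where $P_0=P(0,0,0,1)$, $\ell_1$ is the line through $P_0$ and $P(0,1,0,0)$, and $\ell_2$ is the line through $P_0$ and $P(0,1,1,0)$. The orbit of size $q+1$ consists of the lines of the regulus complementary to that of the tangents. The subgroup $G_q^{\ell_1}$ of $G_q$ fixing $\ell_1$ has size $q(q-1)$, and each of its elements has a matrix of the form $\begin{pmatrix}1&c&c^2&c^3\\0&d&0&c^2d\\0&0&d^2&cd^2\\0&0&0&d^3\end{pmatrix}$, $c\in\mathbb{F}_q$, $d\in\mathbb{F}_q^*$. The subgroup $G_q^{\ell_2}$ fixing $\ell_2$ has size $q$, and each of its elements has a matrix of the form $\begin{pmatrix}1&c&c^2&c^3\\0&1&0&c^2\\0&0&1&c\\0&0&0&1\end{pmatrix}$, $c\in\mathbb{F}_q$.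
   Context: $\mathrm{PG}(3,q)$ has points $P(x_0,x_1,x_2,x_3)$; $\boldsymbol{\pi}(c_0,c_1,c_2,c_3)$ is the plane $c_0x_0+c_1x_1+c_2x_2+c_3x_3=0$. For $t\in\mathbb{F}_q$ let $P_t=P(t^3,t^2,t,1)$, $P_\infty=P(1,0,0,0)$; the twisted cubic is $\mathcal{C}=\{P_t\}$. The osculating planes are $\pi_{\mathrm{osc}}(t)=\boldsymbol{\pi}(1,-3t,3t^2,-t^3)$ ($t\in\mathbb{F}_q$), $\pi_{\mathrm{osc}}(\infty)=\boldsymbol{\pi}(0,0,0,1)$. The tangent at $P_t$ ($t\in\mathbb{F}_q$) is the line through $P_t$ and $P(3t^2,2t,1,0)$; the tangent at $P_\infty$ is $x_2=x_3=0$. A $\mathrm{U}\Gamma$-line is a line meeting $\mathcal{C}$ in exactly one point, not a tangent, contained in an osculating plane. For $q$ even the $q+1$ tangents form a regulus; the complementary regulus is the opposite family of $q+1$ lines of the same hyperbolic quadric. $G_q$ is the group of projectivities mapping $\mathcal{C}$ to itself; for $q\ge5$ its elements are $x\mapsto xM$ on row vectors, $M=\begin{pmatrix} a^3&a^2c&ac^2&c^3\\ 3a^2b&a^2d+2abc&bc^2+2acd&3c^2d\\ 3ab^2&b^2c+2abd&ad^2+2bcd&3cd^2\\ b^3&b^2d&bd^2&d^3\end{pmatrix}$, $ad-bc\ne0$, up to scalar. -}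

module Defs where

open import Algebra.Apartness.Bundles using (HeytingField; HeytingCommutativeRing)
import Algebra.Apartness.Properties.HeytingCommutativeRing as HeytingProperties
open import Algebra.Bundles using (CommutativeRing)
import Algebra.Properties.Semiring.Exp as Exp
import Algebra.Properties.Semiring.Mult as Mult
import Algebra.Properties.Semiring.Sum as Sum
open import Data.Bool.Base using (if_then_else_)
open import Data.Fin.Base using (Fin; zero; suc)
open import Data.Fin.Patterns using (0F; 1F; 2F; 3F)
open import Data.Fin.Properties using (_≟_)
open import Data.Nat.Base using (ℕ)
open import Data.Product.Base using (∃; _×_; _,_; proj₁; proj₂)
open import Data.Sum.Base using (_⊎_; inj₁; inj₂)
open import Data.Vec.Functional using (Vector; _∷_; []; tail)
import Data.Vec.Functional.Relation.Binary.Equality.Setoid as VecEquality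
open import Function.Base using (_∘_)
open import Function.Bundles using (Inverse; _⇔_)
open import Function.Properties.Equivalence using (⇔-isEquivalence)
open import Level using (Level; _⊔_)
open import Relation.Binary.Bundles using (Setoid)
import Relation.Binary.Construct.On as On
open import Relation.Binary.PropositionalEquality.Properties as ≡ using ()
import Relation.Binary.Reasoning.Setoid as ≈-Reasoning
open import Relation.Binary.Structures using (IsEquivalence)
open import Relation.Nullary.Construct.Add.Point using (Pointed; [_]) renaming (∙ to ∞)
open import Relation.Nullary.Decidable.Core using (does)
open import Relation.Nullary.Negation.Core using (¬_)
open import Relation.Unary using (Pred)

SubsetSetoid : ∀ {a ℓ p} (S : Setoid a ℓ) → Pred (Setoid.Carrier S) p → Setoid (a ⊔ p) ℓ
SubsetSetoid S A = On.setoid S (proj₁ {B = A})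

HasSize : ∀ {a ℓ} → Setoid a ℓ → ℕ → Set (a ⊔ ℓ)
HasSize S n = Inverse (≡.setoid (Fin n)) S

-- "Nonzero" is rendered as _# 0#.  In a Heyting field with finitely many
-- elements equality is decidable, and x # y is equivalent to ¬ (x ≈ y).
module ProjectiveSpace {c ℓ₁ ℓ₂ : Level} (F : HeytingField c ℓ₁ ℓ₂) where

  open HeytingField F hiding (_#_; 0#; zero)
  open HeytingField F public using (_#_; 0#)
  open HeytingProperties heytingCommutativeRing
    using (1#0; x-0≈x; x#0y#0→xy#0; #-congʳ; invertibleˡ⇒#)
  open HeytingCommutativeRing heytingCommutativeRing using (commutativeRing)
  open CommutativeRing commutativeRing using (semiring)
  open Exp semiring using (_^_)
  open Mult semiring using () renaming (_×_ to _×′_)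
  open Sum semiring
    using (sum; sum-syntax; sum-cong-≋; *-distribˡ-sum; *-distribʳ-sum; ∑-comm)
  open VecEquality setoid using (_≋_; ≋-refl; ≋-sym; ≋-trans)

  V₄ : Set c
  V₄ = Vector Carrier 4

  Matrix : Set c
  Matrix = Vector V₄ 4

  infixl 7 _*ᵥ_ _*ᴹ_

  -- Vectors are row vectors.
  _*ᵥ_ : V₄ → Matrix → V₄
  (x *ᵥ M) j = ∑[ i < 4 ] (x i * M i j)

  _*ᴹ_ : Matrix → Matrix → Matrix
  (M *ᴹ N) i = M i *ᵥ N

  1ᴹ : Matrix
  1ᴹ i j = if does (i ≟ j) then 1# else 0#

  private

    a*b≈0ʳ : ∀ {a b} → b ≈ 0# → a * b ≈ 0#
    a*b≈0ʳ {a} b≈0 = trans (*-congˡ b≈0) (zeroʳ a)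

    *-#0ˡ : ∀ a b → a * b # 0# → a # 0#
    *-#0ˡ a b ab#0 with #⇒invertible ab#0
    ... | u , u[ab-0]≈1 , _ = invertibleˡ⇒# (b * u , (begin
      b * u * (a - 0#)        ≈⟨ *-congˡ (x-0≈x a) ⟩
      b * u * a               ≈⟨ *-congʳ (*-comm b u) ⟩
      u * b * a               ≈⟨ *-assoc u b a ⟩
      u * (b * a)             ≈⟨ *-congˡ (*-comm b a) ⟩
      u * (a * b)             ≈⟨ *-congˡ (x-0≈x (a * b)) ⟨
      u * (a * b - 0#)        ≈⟨ u[ab-0]≈1 ⟩
      1#                      ∎))
      where open ≈-Reasoning setoid

    +-#0 : ∀ a b → a + b # 0# → a # 0# ⊎ b # 0#
    +-#0 a b a+b#0 with #-cotrans a+b#0 b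
    ... | inj₂ b#0 = inj₂ b#0
    ... | inj₁ a+b#b with #⇒invertible a+b#b
    ... | u , u[a+b-b]≈1 , _ = inj₁ (invertibleˡ⇒# (u , (begin
      u * (a - 0#)        ≈⟨ *-congˡ (x-0≈x a) ⟩
      u * a               ≈⟨ *-congˡ (+-identityʳ a) ⟨
      u * (a + 0#)        ≈⟨ *-congˡ (+-congˡ (-‿inverseʳ b)) ⟨
      u * (a + (b - b))   ≈⟨ *-congˡ (+-assoc a b (- b)) ⟨
      u * (a + b - b)     ≈⟨ u[a+b-b]≈1 ⟩
      1#                  ∎)))
      where open ≈-Reasoning setoid

    sum-#0 : ∀ {n} (x : Vector Carrier n) → sum x # 0# → ∃ λ i → x i # 0#
    sum-#0 {ℕ.zero}  x 0#0 with () ← #-irrefl refl 0#0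
    sum-#0 {ℕ.suc n} x s#0 with +-#0 (x zero) (sum (tail x)) s#0
    ... | inj₁ x₀#0 = zero , x₀#0
    ... | inj₂ t#0 with sum-#0 (tail x) t#0
    ... | i , xᵢ#0 = suc i , xᵢ#0

    sum-≈0 : ∀ {n} (x : Vector Carrier n) → (∀ i → x i ≈ 0#) → sum x ≈ 0#
    sum-≈0 {ℕ.zero}  x x≈0 = refl
    sum-≈0 {ℕ.suc n} x x≈0 =
      trans (+-cong (x≈0 zero) (sum-≈0 (tail x) (x≈0 ∘ suc))) (+-identityʳ 0#)

    sum-δ : ∀ {n} (x : Vector Carrier n) k →
            sum (λ i → x i * (if does (i ≟ k) then 1# else 0#)) ≈ x k
    sum-δ x zero    = trans
      (+-cong (*-identityʳ (x zero)) (sum-≈0 _ (λ i → zeroʳ (x (suc i)))))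
      (+-identityʳ (x zero))
    sum-δ x (suc k) = trans
      (+-cong (zeroʳ (x zero)) (sum-δ (tail x) k))
      (+-identityˡ (x (suc k)))

    *ᵥ-*ᴹ : ∀ x M N → x *ᵥ M *ᵥ N ≋ x *ᵥ (M *ᴹ N)
    *ᵥ-*ᴹ x M N k = begin
      ∑[ j < 4 ] (∑[ i < 4 ] (x i * M i j) * N j k)
        ≈⟨ sum-cong-≋ {4} (λ j → *-distribʳ-sum (N j k) (λ i → x i * M i j)) ⟩
      ∑[ j < 4 ] (∑[ i < 4 ] (x i * M i j * N j k))
        ≈⟨ ∑-comm {4} {4} (λ j i → x i * M i j * N j k) ⟩
      ∑[ i < 4 ] (∑[ j < 4 ] (x i * M i j * N j k))
        ≈⟨ sum-cong-≋ {4} (λ i → sum-cong-≋ {4} (λ j → *-assoc (x i) (M i j) (N j k))) ⟩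
      ∑[ i < 4 ] (∑[ j < 4 ] (x i * (M i j * N j k)))
        ≈⟨ sum-cong-≋ {4} (λ i → *-distribˡ-sum (x i) (λ j → M i j * N j k)) ⟨
      ∑[ i < 4 ] (x i * ∑[ j < 4 ] (M i j * N j k)) ∎
      where open ≈-Reasoning setoid

    *ᵥ-cancel : ∀ x M N → (∀ i → (M *ᴹ N) i ≋ 1ᴹ i) → x *ᵥ M *ᵥ N ≋ x
    *ᵥ-cancel x M N MN≈1 k = trans (*ᵥ-*ᴹ x M N k)
      (trans (sum-cong-≋ {4} (λ i → *-congˡ {x i} (MN≈1 i k))) (sum-δ x k))

    *ᵥ-congʳ : ∀ {x y} M → x ≋ y → x *ᵥ M ≋ y *ᵥ M
    *ᵥ-congʳ M x≋y k = sum-cong-≋ {4} (λ i → *-congʳ {M i k} (x≋y i))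

    *ᵥ-scale : ∀ a x M → (λ i → a * x i) *ᵥ M ≋ (λ k → a * (x *ᵥ M) k)
    *ᵥ-scale a x M k = trans
      (sum-cong-≋ {4} (λ i → *-assoc a (x i) (M i k)))
      (sym (*-distribˡ-sum a (λ i → x i * M i k)))

  infix 4 _∼_ _∼ᴹ_

  _∼_ : V₄ → V₄ → Set (c ⊔ ℓ₁ ⊔ ℓ₂)
  x ∼ y = ∃ λ k → k # 0# × x ≋ (λ i → k * y i)

  _∼ᴹ_ : Matrix → Matrix → Set (c ⊔ ℓ₁ ⊔ ℓ₂)
  M ∼ᴹ N = ∃ λ k → k # 0# × (∀ i → M i ≋ (λ j → k * N i j))

  private

    inverse : ∀ {k} → k # 0# → ∃ λ k⁻¹ → k⁻¹ # 0# × k⁻¹ * k ≈ 1#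
    inverse {k} k#0 with #⇒invertible k#0
    ... | u , u[k-0]≈1 , _ = u , *-#0ˡ u k (#-congʳ (sym uk≈1) 1#0) , uk≈1
      where
      uk≈1 : u * k ≈ 1#
      uk≈1 = trans (*-congˡ (sym (x-0≈x k))) u[k-0]≈1

    unscale : ∀ {u k a b} → u * k ≈ 1# → a ≈ k * b → b ≈ u * a
    unscale {u} {k} {a} {b} uk≈1 a≈kb = begin
      b            ≈⟨ *-identityˡ b ⟨
      1# * b       ≈⟨ *-congʳ uk≈1 ⟨
      u * k * b    ≈⟨ *-assoc u k b ⟩
      u * (k * b)  ≈⟨ *-congˡ a≈kb ⟨
      u * a        ∎
      where open ≈-Reasoning setoid

    rescale : ∀ {k l a b d} → a ≈ k * b → b ≈ l * d → a ≈ k * l * d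
    rescale {k} {l} {d = d} a≈kb b≈ld =
      trans a≈kb (trans (*-congˡ b≈ld) (sym (*-assoc k l d)))

  ∼-isEquivalence : IsEquivalence _∼_
  ∼-isEquivalence = record
    { refl  = λ {x} → 1# , 1#0 , λ i → sym (*-identityˡ (x i))
    ; sym   = λ { (k , k#0 , e) → let (u , u#0 , uk≈1) = inverse k#0 in
                  u , u#0 , λ i → unscale uk≈1 (e i) }
    ; trans = λ { (k , k#0 , e) (l , l#0 , f) →
                  k * l , x#0y#0→xy#0 k#0 l#0 , λ i → rescale (e i) (f i) }
    }

  ∼ᴹ-isEquivalence : IsEquivalence _∼ᴹ_
  ∼ᴹ-isEquivalence = record
    { refl  = λ {M} → 1# , 1#0 , λ i j → sym (*-identityˡ (M i j))
    ; sym   = λ { (k , k#0 , e) → let (u , u#0 , uk≈1) = inverse k#0 in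
                  u , u#0 , λ i j → unscale uk≈1 (e i j) }
    ; trans = λ { (k , k#0 , e) (l , l#0 , f) →
                  k * l , x#0y#0→xy#0 k#0 l#0 , λ i j → rescale (e i j) (f i j) }
    }

  record Homogeneous : Set (c ⊔ ℓ₂) where
    constructor ⟨_∣_⟩
    field
      coords  : V₄
      nonzero : ∃ λ i → coords i # 0#

  open Homogeneous public

  Point : Set (c ⊔ ℓ₂)
  Point = Homogeneous

  -- A plane c₀x₀ + c₁x₁ + c₂x₂ + c₃x₃ = 0 is given by (c₀,c₁,c₂,c₃).
  Plane : Set (c ⊔ ℓ₂)
  Plane = Homogeneous

  pointSetoid : Setoid (c ⊔ ℓ₂) (c ⊔ ℓ₁ ⊔ ℓ₂)
  pointSetoid = record
    { Carrier       = Point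
    ; _≈_           = λ P Q → coords P ∼ coords Q
    ; isEquivalence = On.isEquivalence coords ∼-isEquivalence
    }

  open Setoid pointSetoid public using () renaming (_≈_ to _≈ₚ_)

  infix 4 _∈ₗ_ _∈ₕ_ _≈ₗ_ _⊆ₕ_

  _∈ₕ_ : Point → Plane → Set ℓ₁
  P ∈ₕ π = ∑[ i < 4 ] (coords π i * coords P i) ≈ 0#

  -- Lines are compared by their points (_≈ₗ_), so the choice of the two
  -- spanning points does not matter.
  record Line : Set (c ⊔ ℓ₁ ⊔ ℓ₂) where
    constructor line
    field
      fst snd  : Point
      distinct : ¬ (fst ≈ₚ snd)

  open Line public

  _∈ₗ_ : Point → Line → Set (c ⊔ ℓ₁)
  P ∈ₗ L = ∃ λ a → ∃ λ b → coords P ≋ (λ i → a * coords (fst L) i + b * coords (snd L) i)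

  _≈ₗ_ : Line → Line → Set (c ⊔ ℓ₁ ⊔ ℓ₂)
  L ≈ₗ L′ = ∀ P → P ∈ₗ L ⇔ P ∈ₗ L′

  lineSetoid : Setoid (c ⊔ ℓ₁ ⊔ ℓ₂) (c ⊔ ℓ₁ ⊔ ℓ₂)
  lineSetoid = record
    { Carrier       = Line
    ; _≈_           = _≈ₗ_
    ; isEquivalence = record
      { refl  = λ P → ⇔.refl
      ; sym   = λ e P → ⇔.sym (e P)
      ; trans = λ e f P → ⇔.trans (e P) (f P)
      }
    }
    where module ⇔ {ℓ} = IsEquivalence (⇔-isEquivalence {ℓ})

  _⊆ₕ_ : Line → Plane → Set (c ⊔ ℓ₁ ⊔ ℓ₂)
  L ⊆ₕ π = ∀ P → P ∈ₗ L → P ∈ₕ π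

  Meet : Line → Line → Set (c ⊔ ℓ₁ ⊔ ℓ₂)
  Meet L L′ = ∃ λ P → P ∈ₗ L × P ∈ₗ L′

  record Projectivity : Set (c ⊔ ℓ₁) where
    field
      matrix   : Matrix
      matrix⁻¹ : Matrix
      inverseʳ : ∀ i → (matrix *ᴹ matrix⁻¹) i ≋ 1ᴹ i
      inverseˡ : ∀ i → (matrix⁻¹ *ᴹ matrix) i ≋ 1ᴹ i

  open Projectivity public

  projectivitySetoid : Setoid (c ⊔ ℓ₁) (c ⊔ ℓ₁ ⊔ ℓ₂)
  projectivitySetoid = record
    { Carrier       = Projectivity
    ; _≈_           = λ φ ψ → matrix φ ∼ᴹ matrix ψ
    ; isEquivalence = On.isEquivalence matrix ∼ᴹ-isEquivalence
    }

  infixl 7 _·_ _·ₗ_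

  _·_ : Point → Projectivity → Point
  coords  (P · φ) = coords P *ᵥ matrix φ
  nonzero (P · φ) with nonzero P
  ... | i , xᵢ#0 = proj₁ s , *-#0ˡ _ (matrix⁻¹ φ (proj₁ s) i) (proj₂ s)
    where
    s : ∃ λ j → (coords P *ᵥ matrix φ) j * matrix⁻¹ φ j i # 0#
    s = sum-#0 _ (#-congʳ
          (sym (*ᵥ-cancel (coords P) (matrix φ) (matrix⁻¹ φ) (inverseʳ φ) i)) xᵢ#0)

  ·-injective : ∀ φ {P Q} → P · φ ≈ₚ Q · φ → P ≈ₚ Q
  ·-injective φ {P} {Q} (k , k#0 , e) = k , k#0 ,
    ≋-trans (≋-sym (*ᵥ-cancel (coords P) (matrix φ) (matrix⁻¹ φ) (inverseʳ φ)))
    (≋-trans (*ᵥ-congʳ (matrix⁻¹ φ) e)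
    (≋-trans (*ᵥ-scale k (coords Q *ᵥ matrix φ) (matrix⁻¹ φ))
    (λ i → *-congˡ (*ᵥ-cancel (coords Q) (matrix φ) (matrix⁻¹ φ) (inverseʳ φ) i))))

  _·ₗ_ : Line → Projectivity → Line
  L ·ₗ φ = line (fst L · φ) (snd L · φ) (distinct L ∘ ·-injective φ {fst L} {snd L})

  -- Hyperbolic quadrics are the images under projectivities of the one with
  -- canonical equation x₀x₁ + x₂x₃ = 0.
  HyperbolicQuadric : Projectivity → Pred Point ℓ₁
  HyperbolicQuadric ψ P = x 0F * x 1F + x 2F * x 3F ≈ 0#
    where
    x : V₄
    x = coords (P · ψ)

  PairwiseSkew : ∀ {p} → Pred Line p → Set (c ⊔ ℓ₁ ⊔ ℓ₂ ⊔ p)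
  PairwiseSkew R = ∀ {L L′} → R L → R L′ → ¬ (L ≈ₗ L′) → ¬ Meet L L′

  -- R and R′ are the two families of generators of one hyperbolic quadric.
  record ComplementaryReguli {p r} (R : Pred Line p) (R′ : Pred Line r) :
      Set (c ⊔ ℓ₁ ⊔ ℓ₂ ⊔ p ⊔ r) where
    field
      quadric    : Projectivity
      generators : ∀ L → (∀ P → P ∈ₗ L → HyperbolicQuadric quadric P) ⇔ (R L ⊎ R′ L)
      skew       : PairwiseSkew R
      skew′      : PairwiseSkew R′
      opposite   : ∀ {L L′} → R L → R′ L′ → Meet L L′

  F⁺ : Set c
  F⁺ = Pointed Carrier

  cubic : F⁺ → Point
  cubic [ t ] = ⟨ t ^ 3 ∷ t ^ 2 ∷ t ∷ 1# ∷ [] ∣ 3F , 1#0 ⟩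
  cubic ∞     = ⟨ 1# ∷ 0# ∷ 0# ∷ 0# ∷ [] ∣ 0F , 1#0 ⟩

  OnCubic : Pred Point (c ⊔ ℓ₁ ⊔ ℓ₂)
  OnCubic P = ∃ λ t → P ≈ₚ cubic t

  osculatingPlane : F⁺ → Plane
  osculatingPlane [ t ] =
    ⟨ 1# ∷ - (3 ×′ t) ∷ 3 ×′ (t ^ 2) ∷ - (t ^ 3) ∷ [] ∣ 0F , 1#0 ⟩
  osculatingPlane ∞ = ⟨ 0# ∷ 0# ∷ 0# ∷ 1# ∷ [] ∣ 3F , 1#0 ⟩

  private

    -- Two vectors with coordinates 1 and 0 at position j are not proportional.
    separated : ∀ {x y} j → x j ≈ 1# → y j ≈ 0# → ¬ (x ∼ y)
    separated j x≈1 y≈0 (k , _ , e) =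
      #-irrefl refl (#-congʳ (trans (sym x≈1) (trans (e j) (a*b≈0ʳ y≈0))) 1#0)

  -- At ∞, the line x₂ = x₃ = 0 through P(1,0,0,0) and P(0,1,0,0).
  tangent : F⁺ → Line
  tangent [ t ] = line (cubic [ t ])
    ⟨ 3 ×′ (t ^ 2) ∷ 2 ×′ t ∷ 1# ∷ 0# ∷ [] ∣ 2F , 1#0 ⟩
    (separated 3F refl refl)
  tangent ∞ = line (cubic ∞) ⟨ 0# ∷ 1# ∷ 0# ∷ 0# ∷ [] ∣ 1F , 1#0 ⟩
    (separated 0F refl refl)

  Tangent : Pred Line (c ⊔ ℓ₁ ⊔ ℓ₂)
  Tangent L = ∃ λ t → L ≈ₗ tangent t

  Unisecant : Pred Line (c ⊔ ℓ₁ ⊔ ℓ₂)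
  Unisecant L = ∃ λ P → (OnCubic P × P ∈ₗ L) ×
    (∀ Q → OnCubic Q → Q ∈ₗ L → Q ≈ₚ P)

  UΓ-line : Pred Line (c ⊔ ℓ₁ ⊔ ℓ₂)
  UΓ-line L = Unisecant L × ¬ Tangent L × ∃ λ t → L ⊆ₕ osculatingPlane t

  G : Pred Projectivity (c ⊔ ℓ₁ ⊔ ℓ₂)
  G φ = ∀ P → OnCubic P ⇔ OnCubic (P · φ)

  Orbit : Line → Pred Line (c ⊔ ℓ₁ ⊔ ℓ₂)
  Orbit L L′ = ∃ λ φ → G φ × L ·ₗ φ ≈ₗ L′

  Stabilizer : Line → Pred Projectivity (c ⊔ ℓ₁ ⊔ ℓ₂)
  Stabilizer L φ = G φ × L ·ₗ φ ≈ₗ L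

  P₀ : Point
  P₀ = ⟨ 0# ∷ 0# ∷ 0# ∷ 1# ∷ [] ∣ 3F , 1#0 ⟩

  line₁ : Line
  line₁ = line P₀ ⟨ 0# ∷ 1# ∷ 0# ∷ 0# ∷ [] ∣ 1F , 1#0 ⟩ (separated 3F refl refl)

  line₂ : Line
  line₂ = line P₀ ⟨ 0# ∷ 1# ∷ 1# ∷ 0# ∷ [] ∣ 1F , 1#0 ⟩ (separated 3F refl refl)

  matrix₁ : Carrier → Carrier → Matrix
  matrix₁ c d =
    (1# ∷ c  ∷ c ^ 2 ∷ c ^ 3       ∷ []) ∷
    (0# ∷ d  ∷ 0#    ∷ (c ^ 2) * d ∷ []) ∷
    (0# ∷ 0# ∷ d ^ 2 ∷ c * (d ^ 2) ∷ []) ∷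
    (0# ∷ 0# ∷ 0#    ∷ d ^ 3       ∷ []) ∷ []

  matrix₂ : Carrier → Matrix
  matrix₂ c =
    (1# ∷ c  ∷ c ^ 2 ∷ c ^ 3 ∷ []) ∷
    (0# ∷ 1# ∷ 0#    ∷ c ^ 2 ∷ []) ∷
    (0# ∷ 0# ∷ 1#    ∷ c     ∷ []) ∷
    (0# ∷ 0# ∷ 0#    ∷ 1#    ∷ []) ∷ []

{-# OPTIONS --safe #-}

-- In characteristic 2 the tangent at P_t is x₁ = t²x₃, x₀ = t²x₂, and the UΓ-lines
-- through P_t are the images U t v of the lines ⟨P₀, (0,1,v,0)⟩ under an involution
-- of the cubic exchanging P₀ and P_t.  An element of G fixing P₀ and P_∞ maps
-- (t³,t²,t,1) to a point on the quadrics x₀x₂ = x₁², x₁x₃ = x₂² for every t; these are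
-- polynomial identities of degree < q, and comparing coefficients makes the matrix
-- diagonal, of the form diag(1,d,d²,d³).  Hence the stabilizer of P₀ consists of the
-- matrices matrix₁ c d, which map U 0 v to U 0 (vd).  This gives the two orbits v = 0
-- and v ≠ 0 and the stabilizers.  The lines U t 0 are x₀ = t x₁, x₂ = t x₃, so they and
-- the tangents are the two rulings of x₀x₃ + x₁x₂ = 0.

module Submission where

open import Defs
open import Algebra.Apartness.Bundles using (HeytingField; HeytingCommutativeRing)
import Algebra.Apartness.Properties.HeytingCommutativeRing as HeytingProperties
open import Algebra.Bundles using (CommutativeRing; RawRing)
import Algebra.Properties.CommutativeMonoid.Sum as CommutativeMonoidSum
import Algebra.Properties.Group as GroupProperties
import Algebra.Properties.Monoid.Mult as Mult
import Algebra.Properties.Ring as RingProperties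
import Algebra.Properties.Semiring.Exp as Exp
import Algebra.Properties.Semiring.Sum as Sum
import Algebra.Solver.Ring as RingSolver
open import Algebra.Solver.Ring.AlmostCommutativeRing
  using (fromCommutativeRing; _-Raw-AlmostCommutative⟶_)
import Algebra.Solver.Ring.NaturalCoefficients.Default as SemiringSolver
open import Data.Bool.Base using (Bool; true; false; _xor_; _∧_; if_then_else_)
open import Data.Fin.Base as Fin using (Fin; zero; suc)
open import Data.Fin.Patterns using (0F; 1F; 2F; 3F; 4F; 5F)
open import Data.Fin.Permutation using (Permutation′; permutation)
import Data.Fin.Properties as Fin
open import Data.Maybe.Base using (Maybe; just; nothing)
open import Data.Nat.Base as ℕ using (ℕ; _∸_)
open import Data.Nat.Divisibility using (_∣_; divides)
import Data.Nat.Divisibility as ℕ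
import Data.Nat.Properties as ℕ
open import Data.Nat.Solver using (module +-*-Solver)
open import Data.Product.Base using (∃; ∃₂; _×_; _,_; proj₁; proj₂)
open import Data.Product.Relation.Binary.Pointwise.NonDependent using (_×ₛ_)
open import Data.Sum.Base using (_⊎_; inj₁; inj₂)
open import Data.Vec.Base using (Vec; lookup; []; _∷_)
open import Data.Vec.Functional using (Vector; removeAt; replicate)
  renaming (_∷_ to _∷′_; [] to []′)
import Data.Vec.Functional.Relation.Binary.Equality.Setoid as VecEquality
open import Function.Base using (id; _∘_)
open import Function.Bundles using (Inverse; Injection; _⇔_; mk⇔; Equivalence)
open import Function.Construct.Symmetry using () renaming (inverse to Inverse-sym)
open import Function.Definitions using (Injective)
open import Function.Properties.Inverse using (Inverse⇒Injection)
open import Level using (0ℓ)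
open import Relation.Binary.Bundles using (Setoid)
import Relation.Binary.Construct.Add.Point.Equality as PointedEquality
open import Relation.Binary.Definitions using (Decidable; tri<; tri≈; tri>)
open import Relation.Binary.PropositionalEquality as ≡ using (_≡_)
import Relation.Binary.Reasoning.Setoid as ≈-Reasoning
open import Relation.Binary.Structures using (IsEquivalence)
open import Relation.Nullary.Construct.Add.Point using (Pointed; [_]) renaming (∙ to ∞)
open import Relation.Nullary.Decidable using (via-injection; dec-true; dec-false)
open import Relation.Nullary.Decidable.Core using (Dec; yes; no; does)
open import Relation.Nullary.Negation.Core using (¬_; contradiction)

-- `G` is the group of all projectivities preserving a point set, so the shape of its matrices has
-- to be derived. Equations that hold at every point of the cubic become polynomial identities only
-- when the field has more elements than the degree; along the image of the cubic the two quadrics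
-- have degree at most 5, which is the origin of the bound `6 ≤ q`. The parameter v ranges over an
-- affine line because the pencil of lines through P₀ in the plane x₀ = 0 has q + 1 members, and the
-- one that the points (0,1,v,0) miss is the tangent. Thus (t, v) are unique coordinates on the
-- UΓ-lines, and the orbit sizes reduce to counting pairs. Evenness of `q` yields 1 + 1 = 0 by
-- counting the fixed points of negation. It makes t ↦ t + s an involution, and it makes squaring a
-- bijection, which matters because the ruling of tangents is parametrized by t² instead of t.

-- Counting: involutions and sizes of finite setoids.

-- An ascent is an index `i` with `i < σ i`, a descent one with `σ i < i`. Away from `k` every index
-- is exactly one of the two, and `σ` exchanges the two kinds, so the `n` moved indices number twice
-- the ascents.
involution-even : ∀ {n} (σ : Fin (ℕ.suc n) → Fin (ℕ.suc n)) k →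
                  (∀ i → σ (σ i) ≡ i) → σ k ≡ k → (∀ i → σ i ≡ i → i ≡ k) → 2 ∣ n
involution-even {n} σ k σσ≡id σk≡k fixed⇒k = divides (sum ascents) (begin
  n                                                 ≡⟨ ℕ.*-identityʳ n ⟨
  n ℕ.* 1                                           ≡⟨ ×≡* n ⟨
  n ×′ 1                                            ≡⟨ sum-replicate n ⟨
  sum (replicate n 1)                               ≡⟨ sum-cong-≗ {n} (moved ∘ Fin.punchInᵢ≢i k) ⟨
  sum (removeAt (λ i → ascents i ℕ.+ descents i) k)
    ≡⟨ ≡.cong (ℕ._+ sum (removeAt (λ i → ascents i ℕ.+ descents i) k)) unmoved ⟨
  ascents k ℕ.+ descents k ℕ.+ sum (removeAt (λ i → ascents i ℕ.+ descents i) k)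
    ≡⟨ sum-remove {i = k} (λ i → ascents i ℕ.+ descents i) ⟨
  sum (λ i → ascents i ℕ.+ descents i)              ≡⟨ ∑-distrib-+ ascents descents ⟩
  sum ascents ℕ.+ sum descents                      ≡⟨ ≡.cong (sum ascents ℕ.+_) (sum-cong-≗ swap) ⟨
  sum ascents ℕ.+ sum (ascents ∘ σ)                 ≡⟨ ≡.cong (sum ascents ℕ.+_) (sum-permute ascents π) ⟨
  sum ascents ℕ.+ sum ascents                       ≡⟨ ≡.cong (sum ascents ℕ.+_) (ℕ.+-identityʳ _) ⟨
  2 ℕ.* sum ascents                                 ≡⟨ ℕ.*-comm 2 (sum ascents) ⟩
  sum ascents ℕ.* 2                                 ∎)
  where
  open ≡.≡-Reasoning
  open CommutativeMonoidSum ℕ.+-0-commutativeMonoid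
  open Mult ℕ.+-0-monoid using () renaming (_×_ to _×′_)

  ascents descents : Vector ℕ (ℕ.suc n)
  ascents  i = if does (i Fin.<? σ i) then 1 else 0
  descents i = if does (σ i Fin.<? i) then 1 else 0

  π : Permutation′ (ℕ.suc n)
  π = permutation σ σ σσ≡id σσ≡id

  swap : ∀ i → ascents (σ i) ≡ descents i
  swap i = ≡.cong (λ j → if does (σ i Fin.<? j) then 1 else 0) (σσ≡id i)

  count : Bool → Bool → ℕ
  count b b′ = (if b then 1 else 0) ℕ.+ (if b′ then 1 else 0)

  unmoved : ascents k ℕ.+ descents k ≡ 0
  unmoved = ≡.cong₂ count (dec-false (k Fin.<? σ k) (Fin.<-irrefl (≡.sym σk≡k)))
                          (dec-false (σ k Fin.<? k) (Fin.<-irrefl σk≡k))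

  moved : ∀ {i} → ¬ i ≡ k → ascents i ℕ.+ descents i ≡ 1
  moved {i} i≢k with Fin.<-cmp i (σ i)
  ... | tri< i< _ ≮i = ≡.cong₂ count (dec-true (i Fin.<? σ i) i<) (dec-false (σ i Fin.<? i) ≮i)
  ... | tri> i≮ _ <i = ≡.cong₂ count (dec-false (i Fin.<? σ i) i≮) (dec-true (σ i Fin.<? i) <i)
  ... | tri≈ _ i≡ _  = contradiction (fixed⇒k i (≡.sym i≡)) i≢k

  ×≡* : ∀ m → m ×′ 1 ≡ m ℕ.* 1
  ×≡* ℕ.zero    = ≡.refl
  ×≡* (ℕ.suc m) = ≡.cong ℕ.suc (×≡* m)

-- Pigeonhole: a missed value could be punched out of the codomain, leaving an injection from
-- `suc n` elements to `n`.
injective⇒surjective : ∀ {n} {f : Fin n → Fin n} → Injective _≡_ _≡_ f → ∀ y → ∃ λ x → f x ≡ y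
injective⇒surjective {ℕ.suc n} {f} f-injective y with Fin.any? (λ x → f x Fin.≟ y)
... | yes x,fx≡y = x,fx≡y
... | no  y∉f    = contradiction
  (Fin.injective⇒≤ {f = λ x → Fin.punchOut (y≢f x)}
    (λ {i} {j} → f-injective ∘ Fin.punchOut-injective (y≢f i) (y≢f j)))
  ℕ.1+n≰n
  where
  y≢f : ∀ x → ¬ y ≡ f x
  y≢f x y≡fx = y∉f (x , ≡.sym y≡fx)

-- The chosen preimages respect equality because `f` is injective, so surjectivity may be given by
-- an arbitrary choice.
enumeration⇒HasSize : ∀ {a ℓ n} (S : Setoid a ℓ) (f : Fin n → Setoid.Carrier S) →
  (∀ {i j} → Setoid._≈_ S (f i) (f j) → i ≡ j) → (∀ x → ∃ λ i → Setoid._≈_ S (f i) x) → HasSize S n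
enumeration⇒HasSize S f f-injective f-surjective = record
  { to        = f
  ; from      = proj₁ ∘ f-surjective
  ; to-cong   = S.reflexive ∘ ≡.cong f
  ; from-cong = λ {x} {y} x≈y → f-injective
      (S.trans (proj₂ (f-surjective x)) (S.trans x≈y (S.sym (proj₂ (f-surjective y)))))
  ; inverse   = (λ {x} y≡ → S.trans (S.reflexive (≡.cong f y≡)) (proj₂ (f-surjective x)))
              , (λ {i} {x} x≈fi → f-injective (S.trans (proj₂ (f-surjective x)) x≈fi))
  }
  where module S = Setoid S

HasSize-transfer : ∀ {a ℓ a′ ℓ′ n} (S : Setoid a ℓ) (T : Setoid a′ ℓ′) (g : Setoid.Carrier S → Setoid.Carrier T) →
  (∀ {x y} → Setoid._≈_ S x y → Setoid._≈_ T (g x) (g y)) →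
  (∀ {x y} → Setoid._≈_ T (g x) (g y) → Setoid._≈_ S x y) →
  (∀ y → ∃ λ x → Setoid._≈_ T (g x) y) → HasSize S n → HasSize T n
HasSize-transfer S T g g-cong g-injective g-surjective sizeS = enumeration⇒HasSize T (g ∘ to)
  (λ e → Injection.injective (Inverse⇒Injection sizeS) (g-injective e))
  (λ y → from (proj₁ (g-surjective y)) , Setoid.trans T (g-cong (strictlyInverseˡ _)) (proj₂ (g-surjective y)))
  where open Inverse sizeS

HasSize-× : ∀ {a ℓ a′ ℓ′ m n} (S : Setoid a ℓ) (T : Setoid a′ ℓ′) →
  HasSize S m → HasSize T n → HasSize (S ×ₛ T) (m ℕ.* n)
HasSize-× {m = m} {n} S T sizeS sizeT = enumeration⇒HasSize (S ×ₛ T) f f-injective f-surjective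
  where
  module S = Inverse sizeS
  module T = Inverse sizeT

  f : Fin (m ℕ.* n) → Setoid.Carrier (S ×ₛ T)
  f i = S.to (proj₁ (Fin.remQuot {m} n i)) , T.to (proj₂ (Fin.remQuot {m} n i))

  f-injective : ∀ {i j} → Setoid._≈_ (S ×ₛ T) (f i) (f j) → i ≡ j
  f-injective {i} {j} (e , e′) = ≡.trans (≡.sym (Fin.combine-remQuot {m} n i)) (≡.trans
    (≡.cong₂ Fin.combine (Injection.injective (Inverse⇒Injection sizeS) e) (Injection.injective (Inverse⇒Injection sizeT) e′))
    (Fin.combine-remQuot {m} n j))

  f-surjective : ∀ x → ∃ λ i → Setoid._≈_ (S ×ₛ T) (f i) x
  f-surjective (x , y) = Fin.combine (S.from x) (T.from y) ,
    Setoid.trans S (Setoid.reflexive S (≡.cong (S.to ∘ proj₁) (Fin.remQuot-combine (S.from x) (T.from y)))) (S.strictlyInverseˡ x) ,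
    Setoid.trans T (Setoid.reflexive T (≡.cong (T.to ∘ proj₂) (Fin.remQuot-combine (S.from x) (T.from y)))) (T.strictlyInverseˡ y)

HasSize-remove : ∀ {a ℓ n} (S : Setoid a ℓ) x → HasSize S n →
  HasSize (SubsetSetoid S (λ y → ¬ Setoid._≈_ S y x)) (n ∸ 1)
HasSize-remove {n = ℕ.zero} S x sizeS with () ← Inverse.from sizeS x
HasSize-remove {n = ℕ.suc n} S x sizeS = enumeration⇒HasSize _
  (λ i → to (Fin.punchIn k i) , λ e → Fin.punchInᵢ≢i k i (≡.trans (≡.sym (strictlyInverseʳ _)) (from-cong e)))
  (λ {i} {j} e → Fin.punchIn-injective k i j (Injection.injective (Inverse⇒Injection sizeS) e))
  (λ { (y , y≉x) → Fin.punchOut (k≢ y≉x) , Setoid.trans S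
    (Setoid.reflexive S (≡.cong to (Fin.punchIn-punchOut (k≢ y≉x)))) (strictlyInverseˡ y) })
  where
  open Inverse sizeS
  k : Fin (ℕ.suc n)
  k = from x
  k≢ : ∀ {y} → ¬ Setoid._≈_ S y x → ¬ k ≡ from y
  k≢ y≉x k≡ = y≉x (Injection.injective (Inverse⇒Injection (Inverse-sym sizeS)) (≡.sym k≡))

pointedSetoid : ∀ {a ℓ} → Setoid a ℓ → Setoid a _
pointedSetoid S = record
  { Carrier       = Pointed (Setoid.Carrier S)
  ; isEquivalence = PointedEquality.≈∙-isEquivalence (Setoid._≈_ S) (Setoid.isEquivalence S)
  }

HasSize-pointed : ∀ {a ℓ n} (S : Setoid a ℓ) → HasSize S n → HasSize (pointedSetoid S) (n ℕ.+ 1)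
HasSize-pointed {n = n} S sizeS = ≡.subst (HasSize (pointedSetoid S)) (ℕ.+-comm 1 n)
  (enumeration⇒HasSize (pointedSetoid S) f f-injective f-surjective)
  where
  open Inverse sizeS
  open PointedEquality (Setoid._≈_ S)

  f : Fin (ℕ.suc n) → Pointed (Setoid.Carrier S)
  f zero    = ∞
  f (suc i) = [ to i ]

  f-injective : ∀ {i j} → f i ≈∙ f j → i ≡ j
  f-injective {zero}  {zero}  _     = ≡.refl
  f-injective {suc i} {suc j} [ e ] = ≡.cong suc (Injection.injective (Inverse⇒Injection sizeS) e)

  f-surjective : ∀ x → ∃ λ i → f i ≈∙ x
  f-surjective ∞     = zero , ∙≈∙
  f-surjective [ x ] = suc (from x) , [ strictlyInverseˡ x ]

[n+1]*[n∸1]≡n²∸1 : ∀ n → (n ℕ.+ 1) ℕ.* (n ∸ 1) ≡ n ℕ.^ 2 ∸ 1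
[n+1]*[n∸1]≡n²∸1 ℕ.zero    = ≡.refl
[n+1]*[n∸1]≡n²∸1 (ℕ.suc n) = solve 1 (λ n →
  (con 1 :+ n :+ con 1) :* n := n :* con 1 :+ n :* (con 1 :+ n :* con 1)) ≡.refl n
  where open +-*-Solver

-- Finite fields: decidable equality, inverses, characteristic.

module FiniteField {c ℓ₁ ℓ₂} (F : HeytingField c ℓ₁ ℓ₂) {q : ℕ}
                   (size : HasSize (HeytingField.setoid F) q) where

  open HeytingField F
  open HeytingCommutativeRing heytingCommutativeRing using (commutativeRing)
  open CommutativeRing commutativeRing
    using (ring; +-group)
  open HeytingProperties heytingCommutativeRing using (x-0≈x; invertibleˡ⇒#)

  element : Fin q → Carrier
  element = Inverse.to size

  index : Carrier → Fin q
  index = Inverse.from size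

  element-index : ∀ x → element (index x) ≈ x
  element-index = Inverse.strictlyInverseˡ size

  element-injective : ∀ {i j} → element i ≈ element j → i ≡ j
  element-injective = Injection.injective (Inverse⇒Injection size)

  index-cong : ∀ {x y} → x ≈ y → index x ≡ index y
  index-cong = Inverse.from-cong size

  index-injective : ∀ {x y} → index x ≡ index y → x ≈ y
  index-injective = Injection.injective (Inverse⇒Injection (Inverse-sym size))

  infix 4 _≈?_

  _≈?_ : Decidable _≈_
  _≈?_ = via-injection (Inverse⇒Injection (Inverse-sym size)) Fin._≟_

  -- A Heyting field inverts elements that are apart from 0. Here all candidates are searched; if
  -- none works, `x` cannot be apart from 0, and tightness makes it equal to 0.
  leftInverse : ∀ {x} → ¬ x ≈ 0# → ∃ λ y → y * x ≈ 1#
  leftInverse {x} x≉0 with Fin.any? (λ i → element i * x ≈? 1#)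
  ... | yes (i , yx≈1) = element i , yx≈1
  ... | no ∄y          = contradiction (proj₁ (tight x 0#) ¬x#0) x≉0
    where
    ¬x#0 : ¬ x # 0#
    ¬x#0 x#0 with y , y[x-0]≈1 , _ ← #⇒invertible x#0 =
      ∄y (index y , trans (*-cong (element-index y) (sym (x-0≈x x))) y[x-0]≈1)

  ≉⇒# : ∀ {x y} → ¬ x ≈ y → x # y
  ≉⇒# {x} {y} x≉y = invertibleˡ⇒# (leftInverse (λ x-y≈0 → x≉y (x∙y⁻¹≈ε⇒x≈y x y x-y≈0)))
    where open GroupProperties +-group

  #⇒≉ : ∀ {x y} → x # y → ¬ x ≈ y
  #⇒≉ x#y x≈y = #-irrefl x≈y x#y

  integral : ∀ {x y} → ¬ x ≈ 0# → x * y ≈ 0# → y ≈ 0#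
  integral {x} {y} x≉0 xy≈0 with u , ux≈1 ← leftInverse x≉0 = begin
    y            ≈⟨ *-identityˡ y ⟨
    1# * y       ≈⟨ *-congʳ ux≈1 ⟨
    u * x * y    ≈⟨ *-assoc u x y ⟩
    u * (x * y)  ≈⟨ *-congˡ xy≈0 ⟩
    u * 0#       ≈⟨ zeroʳ u ⟩
    0#           ∎
    where open ≈-Reasoning setoid

  -- If 1 + 1 were nonzero, 0 would be the only fixed point of negation, which would pair off the
  -- other elements and make `q` odd.
  characteristic-2 : 2 ∣ q → 1# + 1# ≈ 0#
  characteristic-2 2∣q with 1# + 1# ≈? 0#
  ... | yes 2≈0 = 2≈0
  ... | no  2≉0 = contradiction (odd q (index 0#) σ σσ≡id σ0≡0 fixed⇒0) ¬odd
    where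
    open RingProperties ring using (-‿involutive; -0#≈0#)

    σ : Fin q → Fin q
    σ i = index (- element i)

    σσ≡id : ∀ i → σ (σ i) ≡ i
    σσ≡id i = element-injective (trans (element-index _)
      (trans (-‿cong (element-index _)) (-‿involutive _)))

    σ0≡0 : σ (index 0#) ≡ index 0#
    σ0≡0 = index-cong (trans (-‿cong (element-index 0#)) -0#≈0#)

    fixed⇒0 : ∀ i → σ i ≡ i → i ≡ index 0#
    fixed⇒0 i σi≡i = element-injective (trans (integral 2≉0 (begin
      (1# + 1#) * x      ≈⟨ distribʳ x 1# 1# ⟩
      1# * x + 1# * x    ≈⟨ +-cong (*-identityˡ x) (*-identityˡ x) ⟩
      x + x              ≈⟨ +-congˡ -x≈x ⟨
      x - x              ≈⟨ -‿inverseʳ x ⟩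
      0#                 ∎)) (sym (element-index 0#)))
      where
      open ≈-Reasoning setoid
      x : Carrier
      x = element i
      -x≈x : - x ≈ x
      -x≈x = trans (sym (element-index (- x))) (reflexive (≡.cong element σi≡i))

    -- Stated for a variable `n`, so that the index `k` can force it to be a successor.
    odd : ∀ n (k : Fin n) (σ : Fin n → Fin n) → (∀ i → σ (σ i) ≡ i) → σ k ≡ k →
          (∀ i → σ i ≡ i → i ≡ k) → ∃ λ m → n ≡ ℕ.suc m × 2 ∣ m
    odd (ℕ.suc m) k σ σσ≡id σk≡k fixed⇒k = m , ≡.refl , involution-even σ k σσ≡id σk≡k fixed⇒k

    ¬odd : ¬ (∃ λ m → q ≡ ℕ.suc m × 2 ∣ m)
    ¬odd (m , ≡.refl , 2∣m) with () ← ℕ.∣1⇒≡1 (ℕ.∣m+n∣m⇒∣n (≡.subst (2 ∣_) (ℕ.+-comm 1 m) 2∣q) 2∣m)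

  selfInjective⇒surjective : ∀ {f : Carrier → Carrier} → (∀ {x y} → x ≈ y → f x ≈ f y) →
                          (∀ {x y} → f x ≈ f y → x ≈ y) → ∀ y → ∃ λ x → f x ≈ y
  selfInjective⇒surjective {f} f-cong f-injective y
    with x , fx≡y ← injective⇒surjective {f = index ∘ f ∘ element}
           (λ e → element-injective (f-injective (index-injective e))) (index y)
    = element x , index-injective fx≡y

-- Points, lines and projectivities over an arbitrary field.

module ProjectiveGeometry {c ℓ₁ ℓ₂} (F : HeytingField c ℓ₁ ℓ₂) where

  open HeytingField F hiding (zero; 0#; _#_)
  open ProjectiveSpace F
  open HeytingCommutativeRing heytingCommutativeRing using (commutativeRing)
  open CommutativeRing commutativeRing
    using (semiring; commutativeSemiring)
  open HeytingProperties heytingCommutativeRing using (1#0)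
  open Sum semiring using (sum; sum-cong-≋; ∑-comm; *-distribˡ-sum; *-distribʳ-sum)
  open VecEquality setoid using (_≋_; ≋-refl; ≋-sym; ≋-trans)
  open SemiringSolver commutativeSemiring

  ≋-1* : ∀ {x y : V₄} → x ≋ y → x ∼ y
  ≋-1* x≋y = 1# , 1#0 , λ i → trans (x≋y i) (sym (*-identityˡ _))

  *ᵥ-cong : ∀ {x y M N} → x ≋ y → (∀ i → M i ≋ N i) → x *ᵥ M ≋ y *ᵥ N
  *ᵥ-cong x≋y M≋N j = sum-cong-≋ {4} λ i → *-cong (x≋y i) (M≋N i j)

  *ᵥ-congʳ : ∀ {x y} M → x ≋ y → x *ᵥ M ≋ y *ᵥ M
  *ᵥ-congʳ M x≋y j = sum-cong-≋ {4} λ i → *-congʳ {M i j} (x≋y i)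

  *ᵥ-assoc : ∀ x M N → x *ᵥ M *ᵥ N ≋ x *ᵥ (M *ᴹ N)
  *ᵥ-assoc x M N k = begin
    sum {4} (λ j → sum {4} (λ i → x i * M i j) * N j k)
      ≈⟨ sum-cong-≋ {4} (λ j → *-distribʳ-sum {4} (N j k) (λ i → x i * M i j)) ⟩
    sum {4} (λ j → sum {4} (λ i → x i * M i j * N j k))
      ≈⟨ ∑-comm {4} {4} (λ j i → x i * M i j * N j k) ⟩
    sum {4} (λ i → sum {4} (λ j → x i * M i j * N j k))
      ≈⟨ sum-cong-≋ {4} (λ i → trans
           (sum-cong-≋ {4} (λ j → *-assoc (x i) (M i j) (N j k)))
           (sym (*-distribˡ-sum {4} (x i) (λ j → M i j * N j k)))) ⟩
    sum {4} (λ i → x i * sum {4} (λ j → M i j * N j k)) ∎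
    where open ≈-Reasoning setoid

  *ᵥ-identity : ∀ x → x *ᵥ 1ᴹ ≋ x
  *ᵥ-identity x 0F = solve 4 (λ x₀ x₁ x₂ x₃ →
    x₀ :* con 1 :+ (x₁ :* con 0 :+ (x₂ :* con 0 :+ (x₃ :* con 0 :+ con 0))) := x₀) refl (x 0F) (x 1F) (x 2F) (x 3F)
  *ᵥ-identity x 1F = solve 4 (λ x₀ x₁ x₂ x₃ →
    x₀ :* con 0 :+ (x₁ :* con 1 :+ (x₂ :* con 0 :+ (x₃ :* con 0 :+ con 0))) := x₁) refl (x 0F) (x 1F) (x 2F) (x 3F)
  *ᵥ-identity x 2F = solve 4 (λ x₀ x₁ x₂ x₃ →
    x₀ :* con 0 :+ (x₁ :* con 0 :+ (x₂ :* con 1 :+ (x₃ :* con 0 :+ con 0))) := x₂) refl (x 0F) (x 1F) (x 2F) (x 3F)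
  *ᵥ-identity x 3F = solve 4 (λ x₀ x₁ x₂ x₃ →
    x₀ :* con 0 :+ (x₁ :* con 0 :+ (x₂ :* con 0 :+ (x₃ :* con 1 :+ con 0))) := x₃) refl (x 0F) (x 1F) (x 2F) (x 3F)

  *ᵥ-linear : ∀ a b x y M →
    (λ i → a * x i + b * y i) *ᵥ M ≋ (λ j → a * (x *ᵥ M) j + b * (y *ᵥ M) j)
  *ᵥ-linear a b x y M j = solve 14
    (λ a b x₀ x₁ x₂ x₃ y₀ y₁ y₂ y₃ m₀ m₁ m₂ m₃ →
      (a :* x₀ :+ b :* y₀) :* m₀ :+ ((a :* x₁ :+ b :* y₁) :* m₁ :+
      ((a :* x₂ :+ b :* y₂) :* m₂ :+ ((a :* x₃ :+ b :* y₃) :* m₃ :+ con 0)))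
      := a :* (x₀ :* m₀ :+ (x₁ :* m₁ :+ (x₂ :* m₂ :+ (x₃ :* m₃ :+ con 0))))
      :+ b :* (y₀ :* m₀ :+ (y₁ :* m₁ :+ (y₂ :* m₂ :+ (y₃ :* m₃ :+ con 0))))) refl
    a b (x 0F) (x 1F) (x 2F) (x 3F) (y 0F) (y 1F) (y 2F) (y 3F) (M 0F j) (M 1F j) (M 2F j) (M 3F j)

  *ᵥ-scale : ∀ a x M → (λ i → a * x i) *ᵥ M ≋ (λ j → a * (x *ᵥ M) j)
  *ᵥ-scale a x M j = solve 9
    (λ a x₀ x₁ x₂ x₃ m₀ m₁ m₂ m₃ →
      a :* x₀ :* m₀ :+ (a :* x₁ :* m₁ :+ (a :* x₂ :* m₂ :+ (a :* x₃ :* m₃ :+ con 0)))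
      := a :* (x₀ :* m₀ :+ (x₁ :* m₁ :+ (x₂ :* m₂ :+ (x₃ :* m₃ :+ con 0))))) refl
    a (x 0F) (x 1F) (x 2F) (x 3F) (M 0F j) (M 1F j) (M 2F j) (M 3F j)

  *ᵥ-cancel : ∀ x M N → (∀ i → (M *ᴹ N) i ≋ 1ᴹ i) → x *ᵥ M *ᵥ N ≋ x
  *ᵥ-cancel x M N MN≈1 = ≋-trans (*ᵥ-assoc x M N)
    (≋-trans (*ᵥ-cong {x} ≋-refl MN≈1) (*ᵥ-identity x))

  ∼-refl : ∀ {x} → x ∼ x
  ∼-refl {x} = IsEquivalence.refl ∼-isEquivalence {x}

  ∼-sym : ∀ {x y} → x ∼ y → y ∼ x
  ∼-sym {x} {y} = IsEquivalence.sym ∼-isEquivalence {x} {y}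

  ∼-trans : ∀ {x y z} → x ∼ y → y ∼ z → x ∼ z
  ∼-trans {x} {y} {z} = IsEquivalence.trans ∼-isEquivalence {x} {y} {z}

  ∈ₗ-combination : ∀ {P Q R} L a b → P ∈ₗ L → Q ∈ₗ L →
    coords R ≋ (λ i → a * coords P i + b * coords Q i) → R ∈ₗ L
  ∈ₗ-combination L a b (a₁ , b₁ , e₁) (a₂ , b₂ , e₂) e =
    a * a₁ + b * a₂ , a * b₁ + b * b₂ , λ i →
    trans (e i) (trans (+-cong (*-congˡ (e₁ i)) (*-congˡ (e₂ i)))
      (solve 8 (λ a b a₁ b₁ a₂ b₂ x y →
        a :* (a₁ :* x :+ b₁ :* y) :+ b :* (a₂ :* x :+ b₂ :* y)
        := (a :* a₁ :+ b :* a₂) :* x :+ (a :* b₁ :+ b :* b₂) :* y) refl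
        a b a₁ b₁ a₂ b₂ (coords (fst L) i) (coords (snd L) i)))

  ∈ₗ-resp-≈ₚ : ∀ {P Q} L → P ≈ₚ Q → P ∈ₗ L → Q ∈ₗ L
  ∈ₗ-resp-≈ₚ {P} {Q} L P≈Q P∈L with k , _ , e ← ∼-sym P≈Q =
    ∈ₗ-combination {P} {P} {Q} L k 0# P∈L P∈L λ i →
      trans (e i) (solve 2 (λ k x → k :* x := k :* x :+ con 0 :* x) refl k (coords P i))

  fst∈ₗ : ∀ L → fst L ∈ₗ L
  fst∈ₗ L = 1# , 0# , λ i →
    solve 2 (λ x y → x := con 1 :* x :+ con 0 :* y) refl (coords (fst L) i) (coords (snd L) i)

  snd∈ₗ : ∀ L → snd L ∈ₗ L
  snd∈ₗ L = 0# , 1# , λ i →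
    solve 2 (λ x y → y := con 0 :* x :+ con 1 :* y) refl (coords (fst L) i) (coords (snd L) i)

  ≈ₗ-refl : ∀ {L} → L ≈ₗ L
  ≈ₗ-refl {L} = Setoid.refl lineSetoid {L}

  ≈ₗ-sym : ∀ {L L′} → L ≈ₗ L′ → L′ ≈ₗ L
  ≈ₗ-sym {L} {L′} = Setoid.sym lineSetoid {L} {L′}

  ≈ₗ-trans : ∀ {L L′ L″} → L ≈ₗ L′ → L′ ≈ₗ L″ → L ≈ₗ L″
  ≈ₗ-trans {L} {L′} {L″} = Setoid.trans lineSetoid {L} {L′} {L″}

  ≈ₗ⇒⊆ : ∀ {L L′ P} → L ≈ₗ L′ → P ∈ₗ L → P ∈ₗ L′
  ≈ₗ⇒⊆ {P = P} L≈L′ = Equivalence.to (L≈L′ P)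

  ≋⇒≈ₗ : ∀ {L L′} → coords (fst L) ≋ coords (fst L′) → coords (snd L) ≋ coords (snd L′) → L ≈ₗ L′
  ≋⇒≈ₗ e f P = mk⇔
    (λ (a , b , g) → a , b , λ i → trans (g i) (+-cong (*-congˡ (e i)) (*-congˡ (f i))))
    (λ (a , b , g) → a , b , λ i → trans (g i) (+-cong (*-congˡ (sym (e i))) (*-congˡ (sym (f i)))))

  inverse : Projectivity → Projectivity
  inverse φ = record
    { matrix   = matrix⁻¹ φ
    ; matrix⁻¹ = matrix φ
    ; inverseʳ = inverseˡ φ
    ; inverseˡ = inverseʳ φ
    }

  ·-congʳ : ∀ {P Q} φ → P ≈ₚ Q → P · φ ≈ₚ Q · φ
  ·-congʳ {P} {Q} φ (k , k#0 , e) = k , k#0 ,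
    ≋-trans (*ᵥ-congʳ (matrix φ) e) (*ᵥ-scale k (coords Q) (matrix φ))

  ·-inverseʳ : ∀ P φ → P · φ · inverse φ ≈ₚ P
  ·-inverseʳ P φ = ≋-1* (*ᵥ-cancel (coords P) (matrix φ) (matrix⁻¹ φ) (inverseʳ φ))

  ∈ₗ-· : ∀ {P} L φ → P ∈ₗ L → P · φ ∈ₗ L ·ₗ φ
  ∈ₗ-· L φ (a , b , e) = a , b , ≋-trans (*ᵥ-congʳ (matrix φ) e)
    (*ᵥ-linear a b (coords (fst L)) (coords (snd L)) (matrix φ))

  ·ₗ-inverseʳ : ∀ L φ → L ·ₗ φ ·ₗ inverse φ ≈ₗ L
  ·ₗ-inverseʳ L φ = ≋⇒≈ₗ {L ·ₗ φ ·ₗ inverse φ} {L} (cancel (coords (fst L))) (cancel (coords (snd L)))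
    where
    cancel : ∀ x → x *ᵥ matrix φ *ᵥ matrix⁻¹ φ ≋ x
    cancel x = *ᵥ-cancel x (matrix φ) (matrix⁻¹ φ) (inverseʳ φ)

  ∈ₗ-·⁻¹ : ∀ {P} L φ → P ∈ₗ L ·ₗ φ → P · inverse φ ∈ₗ L
  ∈ₗ-·⁻¹ {P} L φ P∈Lφ = ≈ₗ⇒⊆ {L ·ₗ φ ·ₗ inverse φ} {L} {P · inverse φ} (·ₗ-inverseʳ L φ) (∈ₗ-· {P} (L ·ₗ φ) (inverse φ) P∈Lφ)

  -- Lines are compared by their points, so a point of one image is pulled back by the inverse, read
  -- on the other line, and pushed forward again.
  ·ₗ-cong : ∀ {L L′} φ → L ≈ₗ L′ → L ·ₗ φ ≈ₗ L′ ·ₗ φ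
  ·ₗ-cong {L} {L′} φ L≈L′ P = mk⇔ (transport {L} {L′} L≈L′) (transport {L′} {L} (≈ₗ-sym {L} {L′} L≈L′))
    where
    transport : ∀ {L L′} → L ≈ₗ L′ → P ∈ₗ L ·ₗ φ → P ∈ₗ L′ ·ₗ φ
    transport {L} {L′} L≈L′ P∈Lφ = ∈ₗ-resp-≈ₚ {P · inverse φ · φ} {P} (L′ ·ₗ φ) (·-inverseʳ P (inverse φ))
      (∈ₗ-· {P · inverse φ} L′ φ (≈ₗ⇒⊆ {L} {L′} {P · inverse φ} L≈L′ (∈ₗ-·⁻¹ {P} L φ P∈Lφ)))

  infixl 7 _⊙_

  _⊙_ : Projectivity → Projectivity → Projectivity
  φ ⊙ ψ = record
    { matrix   = matrix φ *ᴹ matrix ψ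
    ; matrix⁻¹ = matrix⁻¹ ψ *ᴹ matrix⁻¹ φ
    ; inverseʳ = cancel (matrix φ) (matrix ψ) (matrix⁻¹ ψ) (matrix⁻¹ φ) (inverseʳ ψ) (inverseʳ φ)
    ; inverseˡ = cancel (matrix⁻¹ ψ) (matrix⁻¹ φ) (matrix φ) (matrix ψ) (inverseˡ φ) (inverseˡ ψ)
    }
    where
    cancel : ∀ M N N⁻¹ M⁻¹ → (∀ i → (N *ᴹ N⁻¹) i ≋ 1ᴹ i) → (∀ i → (M *ᴹ M⁻¹) i ≋ 1ᴹ i) →
             ∀ i → (M *ᴹ N *ᴹ (N⁻¹ *ᴹ M⁻¹)) i ≋ 1ᴹ i
    cancel M N N⁻¹ M⁻¹ NN⁻¹≈1 MM⁻¹≈1 i =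
      ≋-trans (≋-sym (*ᵥ-assoc (M i *ᵥ N) N⁻¹ M⁻¹))
      (≋-trans (*ᵥ-congʳ M⁻¹ (*ᵥ-cancel (M i) N N⁻¹ NN⁻¹≈1))
      (MM⁻¹≈1 i))

  ·-⊙ : ∀ P φ ψ → P · (φ ⊙ ψ) ≈ₚ P · φ · ψ
  ·-⊙ P φ ψ = ≋-1* (≋-sym (*ᵥ-assoc (coords P) (matrix φ) (matrix ψ)))

  ·ₗ-⊙ : ∀ L φ ψ → L ·ₗ (φ ⊙ ψ) ≈ₗ L ·ₗ φ ·ₗ ψ
  ·ₗ-⊙ L φ ψ = ≋⇒≈ₗ {L ·ₗ (φ ⊙ ψ)} {L ·ₗ φ ·ₗ ψ}
    (≋-sym (*ᵥ-assoc (coords (fst L)) (matrix φ) (matrix ψ)))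
    (≋-sym (*ᵥ-assoc (coords (snd L)) (matrix φ) (matrix ψ)))

  *ᴹ-∼ᴹ : ∀ {M N} O → M ∼ᴹ N → M *ᴹ O ∼ᴹ N *ᴹ O
  *ᴹ-∼ᴹ {M} {N} O (k , k#0 , e) = k , k#0 , λ i → ≋-trans (*ᵥ-congʳ O (e i)) (*ᵥ-scale k (N i) O)

  ≋⇒∼ᴹ : ∀ {M N} → (∀ i → M i ≋ N i) → M ∼ᴹ N
  ≋⇒∼ᴹ e = 1# , 1#0 , λ i j → trans (e i j) (sym (*-identityˡ _))

  ∼ᴹ-trans : ∀ {M N O} → M ∼ᴹ N → N ∼ᴹ O → M ∼ᴹ O
  ∼ᴹ-trans {M} {N} {O} = IsEquivalence.trans ∼ᴹ-isEquivalence {M} {N} {O}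

  ∼ᴹ-sym : ∀ {M N} → M ∼ᴹ N → N ∼ᴹ M
  ∼ᴹ-sym {M} {N} = IsEquivalence.sym ∼ᴹ-isEquivalence {M} {N}

  *ᵥ-∼ᴹ : ∀ x {M N} → M ∼ᴹ N → x *ᵥ M ∼ x *ᵥ N
  *ᵥ-∼ᴹ x {M} {N} (k , k#0 , e) = k , k#0 , λ j → trans (*ᵥ-cong {x} {N = λ i j → k * N i j} ≋-refl e j)
    (solve 9
    (λ k x₀ x₁ x₂ x₃ m₀ m₁ m₂ m₃ →
      x₀ :* (k :* m₀) :+ (x₁ :* (k :* m₁) :+ (x₂ :* (k :* m₂) :+ (x₃ :* (k :* m₃) :+ con 0)))
      := k :* (x₀ :* m₀ :+ (x₁ :* m₁ :+ (x₂ :* m₂ :+ (x₃ :* m₃ :+ con 0))))) refl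
    k (x 0F) (x 1F) (x 2F) (x 3F) (N 0F j) (N 1F j) (N 2F j) (N 3F j))

  -- Proportional matrices send a point to proportional vectors, so both spanning points of one
  -- image lie on the other.
  ·ₗ-∼ᴹ : ∀ L {φ ψ} → matrix φ ∼ᴹ matrix ψ → L ·ₗ φ ≈ₗ L ·ₗ ψ
  ·ₗ-∼ᴹ L {φ} {ψ} φ∼ψ P = mk⇔ (half {φ} {ψ} φ∼ψ) (half {ψ} {φ} (Setoid.sym projectivitySetoid {φ} {ψ} φ∼ψ))
    where
    half : ∀ {φ ψ} → matrix φ ∼ᴹ matrix ψ → P ∈ₗ L ·ₗ φ → P ∈ₗ L ·ₗ ψ
    half {φ} {ψ} φ∼ψ (a , b , e) =
      ∈ₗ-combination {fst L · φ} {snd L · φ} {P} (L ·ₗ ψ) a b (rep (fst L) (fst∈ₗ L)) (rep (snd L) (snd∈ₗ L)) e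
      where
      rep : ∀ Q → Q ∈ₗ L → Q · φ ∈ₗ L ·ₗ ψ
      rep Q Q∈L = ∈ₗ-resp-≈ₚ {Q · ψ} {Q · φ} (L ·ₗ ψ)
        (∼-sym (*ᵥ-∼ᴹ (coords Q) {matrix φ} {matrix ψ} φ∼ψ)) (∈ₗ-· {Q} L ψ Q∈L)

  onCubic-resp : ∀ {P Q} → P ≈ₚ Q → OnCubic P → OnCubic Q
  onCubic-resp P≈Q (t , P≈Pₜ) = t , ∼-trans (∼-sym P≈Q) P≈Pₜ

  G-⊙ : ∀ {φ ψ} → G φ → G ψ → G (φ ⊙ ψ)
  G-⊙ {φ} {ψ} Gφ Gψ P = mk⇔
    (λ P∈C → onCubic-resp {P · φ · ψ} {P · (φ ⊙ ψ)} (∼-sym (·-⊙ P φ ψ))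
      (Equivalence.to (Gψ (P · φ)) (Equivalence.to (Gφ P) P∈C)))
    (λ P∈C → Equivalence.from (Gφ P) (Equivalence.from (Gψ (P · φ))
      (onCubic-resp {P · (φ ⊙ ψ)} {P · φ · ψ} (·-⊙ P φ ψ) P∈C)))

∀Fin4 : ∀ {p} {P : Fin 4 → Set p} → P 0F → P 1F → P 2F → P 3F → ∀ i → P i
∀Fin4 p₀ p₁ p₂ p₃ 0F = p₀
∀Fin4 p₀ p₁ p₂ p₃ 1F = p₁
∀Fin4 p₀ p₁ p₂ p₃ 2F = p₂
∀Fin4 p₀ p₁ p₂ p₃ 3F = p₃

-- Arithmetic in characteristic 2.

module CharacteristicTwo {c ℓ₁ ℓ₂} (F : HeytingField c ℓ₁ ℓ₂)
  (1+1≈0 : HeytingField._≈_ F (HeytingField._+_ F (HeytingField.1# F) (HeytingField.1# F)) (HeytingField.0# F))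
  where

  open HeytingField F hiding (zero)
  open HeytingCommutativeRing heytingCommutativeRing using (commutativeRing)
  open GroupProperties (CommutativeRing.+-group commutativeRing) using (inverseʳ-unique)

  x+x≈0 : ∀ x → x + x ≈ 0#
  x+x≈0 x = trans (sym (+-cong (*-identityˡ x) (*-identityˡ x)))
    (trans (sym (distribʳ x 1# 1#)) (trans (*-congʳ 1+1≈0) (zeroˡ x)))

  -x≈x : ∀ x → - x ≈ x
  -x≈x x = sym (inverseʳ-unique x x (x+x≈0 x))

  x+y≈0⇒x≈y : ∀ {x y} → x + y ≈ 0# → x ≈ y
  x+y≈0⇒x≈y {x} {y} x+y≈0 = sym (trans (inverseʳ-unique x y x+y≈0) (-x≈x x))

  x≈y⇒x+y≈0 : ∀ {x y} → x ≈ y → x + y ≈ 0#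
  x≈y⇒x+y≈0 {x} {y} x≈y = trans (+-congʳ x≈y) (x+x≈0 y)

  -- With coefficients in 𝔽₂ the solver proves identities modulo 2.
  𝔽₂ : RawRing 0ℓ 0ℓ
  𝔽₂ = record
    { Carrier = Bool ; _≈_ = _≡_ ; _+_ = _xor_ ; _*_ = _∧_ ; -_ = id ; 0# = false ; 1# = true }

  private
    ⟦_⟧₂ : Bool → Carrier
    ⟦ b ⟧₂ = if b then 1# else 0#

    morphism : 𝔽₂ -Raw-AlmostCommutative⟶ fromCommutativeRing commutativeRing
    morphism = record
      { ⟦_⟧    = ⟦_⟧₂
      ; +-homo = λ { false b → sym (+-identityˡ ⟦ b ⟧₂)
                   ; true false → sym (+-identityʳ 1#)
                   ; true true → sym 1+1≈0 }
      ; *-homo = λ { false b → sym (zeroˡ ⟦ b ⟧₂) ; true b → sym (*-identityˡ ⟦ b ⟧₂) }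
      ; -‿homo = λ b → sym (-x≈x ⟦ b ⟧₂)
      ; 0-homo = refl
      ; 1-homo = refl
      }

    _coeff≟_ : ∀ a b → Maybe (⟦ a ⟧₂ ≈ ⟦ b ⟧₂)
    false coeff≟ false = just refl
    true  coeff≟ true  = just refl
    _     coeff≟ _     = nothing

  module Solver = RingSolver 𝔽₂ (fromCommutativeRing commutativeRing) morphism _coeff≟_

module EvenOrder {c ℓ₁ ℓ₂} (F : HeytingField c ℓ₁ ℓ₂) {q : ℕ}
  (size : HasSize (HeytingField.setoid F) q)
  (1+1≈0 : HeytingField._≈_ F (HeytingField._+_ F (HeytingField.1# F) (HeytingField.1# F)) (HeytingField.0# F))
  (6≤q : 6 ℕ.≤ q)
  where

  open HeytingField F hiding (zero; 0#; _#_)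
  open ProjectiveSpace F
  open HeytingCommutativeRing heytingCommutativeRing using (commutativeRing)
  open CommutativeRing commutativeRing
    using (semiring)
  open HeytingProperties heytingCommutativeRing using (1#0)
  open VecEquality setoid using (_≋_; ≋-refl; ≋-sym; ≋-trans)
  open Exp semiring using (_^_; ^-congˡ)
  open FiniteField F size
  open ProjectiveGeometry F
  open CharacteristicTwo F 1+1≈0
  open Solver using (Polynomial; solve; prove; _:+_; _:*_; _:^_; _:×_; _:=_; con; var; :-_)
  open PointedEquality _≈_ using (_≈∙_; ∙≈∙; [_])

  1≉0 : ¬ 1# ≈ 0#
  1≉0 = #⇒≉ 1#0

  x*y≉0 : ∀ {x y} → ¬ x ≈ 0# → ¬ y ≈ 0# → ¬ x * y ≈ 0#
  x*y≉0 x≉0 y≉0 xy≈0 = y≉0 (integral x≉0 xy≈0)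

  x^n≈0⇒x≈0 : ∀ n {x} → x ^ n ≈ 0# → x ≈ 0#
  x^n≈0⇒x≈0 ℕ.zero 1≈0 = contradiction 1≈0 1≉0
  x^n≈0⇒x≈0 (ℕ.suc n) {x} xx^n≈0 with x ≈? 0#
  ... | yes x≈0 = x≈0
  ... | no  x≉0 = x^n≈0⇒x≈0 n (integral x≉0 xx^n≈0)

  x^n≉0 : ∀ n {x} → ¬ x ≈ 0# → ¬ x ^ n ≈ 0#
  x^n≉0 n x≉0 = x≉0 ∘ x^n≈0⇒x≈0 n

  -- Polynomials over F and their roots.

  eval : ∀ {n} → Vec Carrier n → Carrier → Carrier
  eval []      x = 0#
  eval (a ∷ p) x = a + x * eval p x

  -- Synthetic division by x + r, constant coefficient first: by Horner's scheme the quotient's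
  -- coefficients are the values at `r` of the successive tails.
  quotient : ∀ {n} → Carrier → Vec Carrier (ℕ.suc n) → Vec Carrier n
  quotient r (a ∷ [])        = []
  quotient r (a ∷ p@(_ ∷ _)) = eval p r ∷ quotient r p

  division : ∀ {n} r (p : Vec Carrier (ℕ.suc n)) x →
             eval p x ≈ eval p r + (x + r) * eval (quotient r p) x
  division r (a ∷ []) x =
    solve 3 (λ r a x → a :+ x :* con false := a :+ r :* con false :+ (x :+ r) :* con false) refl r a x
  division r (a ∷ p@(_ ∷ _)) x = trans (+-congˡ (*-congˡ (division r p x)))
    (solve 5 (λ r a x y z → a :+ x :* (y :+ (x :+ r) :* z) := a :+ r :* y :+ (x :+ r) :* (y :+ x :* z))
      refl r a x (eval p r) (eval (quotient r p) x))

  -- A zero quotient means that every proper tail vanishes at `r`; with `eval p r ≈ 0#` this peels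
  -- off one zero coefficient after another.
  quotient≈0⇒≈0 : ∀ {n} r (p : Vec Carrier (ℕ.suc n)) → eval p r ≈ 0# →
                  (∀ i → lookup (quotient r p) i ≈ 0#) → ∀ i → lookup p i ≈ 0#
  quotient≈0⇒≈0 r (a ∷ []) pr≈0 _ zero =
    trans (solve 2 (λ r a → a := a :+ r :* con false) refl r a) pr≈0
  quotient≈0⇒≈0 r (a ∷ p@(_ ∷ _)) pr≈0 q≈0 zero = trans
    (trans (sym (+-identityʳ a)) (+-congˡ (sym (trans (*-congˡ (q≈0 zero)) (zeroʳ r))))) pr≈0
  quotient≈0⇒≈0 r (a ∷ p@(_ ∷ _)) pr≈0 q≈0 (suc i) = quotient≈0⇒≈0 r p (q≈0 zero) (q≈0 ∘ suc) i

  -- Induction on the number of coefficients: after division by x + r₀ the other points remain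
  -- roots, because rᵢ + r₀ is nonzero when rᵢ and r₀ differ.
  roots⇒≈0 : ∀ {n} (p : Vec Carrier n) (r : Fin n → Carrier) →
             (∀ {i j} → r i ≈ r j → i ≡ j) → (∀ i → eval p (r i) ≈ 0#) → ∀ i → lookup p i ≈ 0#
  roots⇒≈0 {ℕ.suc n} p r r-injective pr≈0 = quotient≈0⇒≈0 (r zero) p (pr≈0 zero)
    (roots⇒≈0 (quotient (r zero) p) (r ∘ suc) (Fin.suc-injective ∘ r-injective) λ i →
      integral (λ e → Fin.0≢1+n (≡.sym (r-injective (x+y≈0⇒x≈y e))))
        (trans (sym (+-identityˡ _)) (trans (+-congʳ (sym (pr≈0 zero)))
          (trans (sym (division (r zero) p (r (suc i)))) (pr≈0 (suc i))))))

  -- The cubic in homogeneous parameters, and symbolic matrices.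

  ν : Carrier → Carrier → V₄
  ν a b = a ^ 3 ∷′ a ^ 2 * b ∷′ a * b ^ 2 ∷′ b ^ 3 ∷′ []′

  -- For nonzero b the parameter is a/b and the scalar b³; for b = 0 the point is P∞ and the scalar
  -- a³, nonzero because the coordinates of `P` do not all vanish. An image point need only be
  -- brought to the form `ν a b`, in whichever chart it falls.
  ν⇒onCubic : ∀ P a b → coords P ≋ ν a b → OnCubic P
  ν⇒onCubic P a b P≋ν with b ≈? 0#
  ... | no b≉0 with u , ub≈1 ← leftInverse b≉0 = [ u * a ] , b ^ 3 , ≉⇒# (x^n≉0 3 b≉0) ,
    ≋-trans P≋ν (∀Fin4
      (trans (sym (trans (*-congʳ (^-congˡ 3 ub≈1)) (solve 1 (λ x → con true :^ 3 :* x := x) refl (a ^ 3))))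
        (solve 3 (λ a b u → (u :* b) :^ 3 :* a :^ 3 := b :^ 3 :* (u :* a) :^ 3) refl a b u))
      (trans (sym (trans (*-congʳ (^-congˡ 2 ub≈1)) (solve 1 (λ x → con true :^ 2 :* x := x) refl (a ^ 2 * b))))
        (solve 3 (λ a b u → (u :* b) :^ 2 :* (a :^ 2 :* b) := b :^ 3 :* (u :* a) :^ 2) refl a b u))
      (trans (sym (trans (*-congʳ ub≈1) (*-identityˡ _)))
        (solve 3 (λ a b u → u :* b :* (a :* b :^ 2) := b :^ 3 :* (u :* a)) refl a b u))
      (sym (*-identityʳ _)))
  ... | yes b≈0 = ∞ , a ^ 3 , ≉⇒# a³≉0 , ≋-trans P≋ν (∀Fin4
      (sym (*-identityʳ _))
      (trans (*-congˡ b≈0) (solve 1 (λ a → a :^ 2 :* con false := a :^ 3 :* con false) refl a))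
      (trans (*-congˡ (^-congˡ 2 b≈0)) (solve 1 (λ a → a :* con false :^ 2 := a :^ 3 :* con false) refl a))
      (trans (^-congˡ 3 b≈0) (solve 1 (λ a → con false :^ 3 := a :^ 3 :* con false) refl a)))
    where
    a³≉0 : ¬ a ^ 3 ≈ 0#
    a³≉0 a³≈0 with i , Pᵢ#0 ← nonzero P = #⇒≉ Pᵢ#0 (trans (P≋ν i) (νᵢ≈0 i))
      where
      a≈0 : a ≈ 0#
      a≈0 = x^n≈0⇒x≈0 3 a³≈0
      νᵢ≈0 : ∀ i → ν a b i ≈ 0#
      νᵢ≈0 = ∀Fin4 a³≈0 (trans (*-congˡ b≈0) (zeroʳ _)) (trans (*-congʳ a≈0) (zeroˡ _))
        (trans (^-congˡ 3 b≈0) (solve 0 (con false :^ 3 := con false) refl))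

  infixl 7 _⊗_

  PolynomialVector : ℕ → Set
  PolynomialVector n = Fin 4 → Polynomial n

  PolynomialMatrix : ℕ → Set
  PolynomialMatrix n = Fin 4 → PolynomialVector n

  -- The shape follows the unfolding of `_*ᵥ_` down to the final zero of the sum, so that the value
  -- of `x ⊗ A` is by computation the product of the evaluated vector and matrix, and `prove` fits
  -- the goals.
  _⊗_ : ∀ {n} → PolynomialVector n → PolynomialMatrix n → PolynomialVector n
  (x ⊗ A) j = x 0F :* A 0F j :+ (x 1F :* A 1F j :+ (x 2F :* A 2F j :+ (x 3F :* A 3F j :+ con false)))

  νᴾ : ∀ {n} → Polynomial n → Polynomial n → PolynomialVector n
  νᴾ a b = a :^ 3 ∷′ a :^ 2 :* b ∷′ a :* b :^ 2 ∷′ b :^ 3 ∷′ []′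

  cubicᴾ : ∀ {n} → Pointed (Polynomial n) → PolynomialVector n
  cubicᴾ [ t ] = t :^ 3 ∷′ t :^ 2 ∷′ t ∷′ con true ∷′ []′
  cubicᴾ ∞     = con true ∷′ con false ∷′ con false ∷′ con false ∷′ []′

  𝟏 : ∀ {n} → PolynomialMatrix n
  𝟏 i j = if does (i Fin.≟ j) then con true else con false

  -- t ↦ t + s for s ∈ F, and t ↦ 1/t for s = ∞; both are involutions.
  moveᴹ : F⁺ → Matrix
  moveᴹ [ s ] =
    (1#    ∷′ 0#    ∷′ 0# ∷′ 0# ∷′ []′) ∷′
    (s     ∷′ 1#    ∷′ 0# ∷′ 0# ∷′ []′) ∷′
    (s ^ 2 ∷′ 0#    ∷′ 1# ∷′ 0# ∷′ []′) ∷′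
    (s ^ 3 ∷′ s ^ 2 ∷′ s  ∷′ 1# ∷′ []′) ∷′ []′
  moveᴹ ∞ =
    (0# ∷′ 0# ∷′ 0# ∷′ 1# ∷′ []′) ∷′
    (0# ∷′ 0# ∷′ 1# ∷′ 0# ∷′ []′) ∷′
    (0# ∷′ 1# ∷′ 0# ∷′ 0# ∷′ []′) ∷′
    (1# ∷′ 0# ∷′ 0# ∷′ 0# ∷′ []′) ∷′ []′

  moveᴾ : ∀ {n} → Pointed (Polynomial n) → PolynomialMatrix n
  moveᴾ [ s ] =
    (con true ∷′ con false ∷′ con false ∷′ con false ∷′ []′) ∷′
    (s        ∷′ con true  ∷′ con false ∷′ con false ∷′ []′) ∷′
    (s :^ 2   ∷′ con false ∷′ con true  ∷′ con false ∷′ []′) ∷′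
    (s :^ 3   ∷′ s :^ 2    ∷′ s         ∷′ con true  ∷′ []′) ∷′ []′
  moveᴾ ∞ =
    (con false ∷′ con false ∷′ con false ∷′ con true  ∷′ []′) ∷′
    (con false ∷′ con false ∷′ con true  ∷′ con false ∷′ []′) ∷′
    (con false ∷′ con true  ∷′ con false ∷′ con false ∷′ []′) ∷′
    (con true  ∷′ con false ∷′ con false ∷′ con false ∷′ []′) ∷′ []′

  moveᴹ-involutive : ∀ s i → (moveᴹ s *ᴹ moveᴹ s) i ≋ 1ᴹ i
  moveᴹ-involutive [ s ] = ∀Fin4
    (∀Fin4 (entry 0F 0F refl) (entry 0F 1F refl) (entry 0F 2F refl) (entry 0F 3F refl))
    (∀Fin4 (entry 1F 0F refl) (entry 1F 1F refl) (entry 1F 2F refl) (entry 1F 3F refl))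
    (∀Fin4 (entry 2F 0F refl) (entry 2F 1F refl) (entry 2F 2F refl) (entry 2F 3F refl))
    (∀Fin4 (entry 3F 0F refl) (entry 3F 1F refl) (entry 3F 2F refl) (entry 3F 3F refl))
    where
    entry : ∀ i j → _
    entry i j = prove (s ∷ []) ((moveᴾ [ var 0F ] i ⊗ moveᴾ [ var 0F ]) j) (𝟏 i j)
  moveᴹ-involutive ∞ = ∀Fin4
    (∀Fin4 (entry 0F 0F refl) (entry 0F 1F refl) (entry 0F 2F refl) (entry 0F 3F refl))
    (∀Fin4 (entry 1F 0F refl) (entry 1F 1F refl) (entry 1F 2F refl) (entry 1F 3F refl))
    (∀Fin4 (entry 2F 0F refl) (entry 2F 1F refl) (entry 2F 2F refl) (entry 2F 3F refl))
    (∀Fin4 (entry 3F 0F refl) (entry 3F 1F refl) (entry 3F 2F refl) (entry 3F 3F refl))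
    where
    entry : ∀ i j → _
    entry i j = prove [] ((moveᴾ ∞ i ⊗ moveᴾ ∞) j) (𝟏 i j)

  move : F⁺ → Projectivity
  move s = record
    { matrix = moveᴹ s ; matrix⁻¹ = moveᴹ s
    ; inverseʳ = moveᴹ-involutive s ; inverseˡ = moveᴹ-involutive s }

  -- Explicit elements of G: triangular matrices and moves.

  matrix₁ᴾ : ∀ {n} → Polynomial n → Polynomial n → PolynomialMatrix n
  matrix₁ᴾ c d =
    (con true  ∷′ c         ∷′ c :^ 2    ∷′ c :^ 3      ∷′ []′) ∷′
    (con false ∷′ d         ∷′ con false ∷′ c :^ 2 :* d ∷′ []′) ∷′
    (con false ∷′ con false ∷′ d :^ 2    ∷′ c :* d :^ 2 ∷′ []′) ∷′
    (con false ∷′ con false ∷′ con false ∷′ d :^ 3      ∷′ []′) ∷′ []′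

  matrix₁-cong : ∀ {c c′ d d′} → c ≈ c′ → d ≈ d′ → ∀ i → matrix₁ c d i ≋ matrix₁ c′ d′ i
  matrix₁-cong c≈c′ d≈d′ = ∀Fin4
    (∀Fin4 refl c≈c′ (^-congˡ 2 c≈c′) (^-congˡ 3 c≈c′))
    (∀Fin4 refl d≈d′ refl (*-cong (^-congˡ 2 c≈c′) d≈d′))
    (∀Fin4 refl refl (^-congˡ 2 d≈d′) (*-cong c≈c′ (^-congˡ 2 d≈d′)))
    (∀Fin4 refl refl refl (^-congˡ 3 d≈d′))

  -- `matrix₁ c d` is induced on the cubic by the 2 by 2 matrix with rows (1, c) and (0, d), so its
  -- products follow those of the triangular matrices.
  matrix₁-* : ∀ c d c′ d′ i → (matrix₁ c d *ᴹ matrix₁ c′ d′) i ≋ matrix₁ (c′ + c * d′) (d * d′) i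
  matrix₁-* c d c′ d′ = ∀Fin4
    (∀Fin4 (entry 0F 0F refl) (entry 0F 1F refl) (entry 0F 2F refl) (entry 0F 3F refl))
    (∀Fin4 (entry 1F 0F refl) (entry 1F 1F refl) (entry 1F 2F refl) (entry 1F 3F refl))
    (∀Fin4 (entry 2F 0F refl) (entry 2F 1F refl) (entry 2F 2F refl) (entry 2F 3F refl))
    (∀Fin4 (entry 3F 0F refl) (entry 3F 1F refl) (entry 3F 2F refl) (entry 3F 3F refl))
    where
    entry : ∀ i j → _
    entry i j = prove (c ∷ d ∷ c′ ∷ d′ ∷ [])
      ((matrix₁ᴾ (var 0F) (var 1F) i ⊗ matrix₁ᴾ (var 2F) (var 3F)) j)
      (matrix₁ᴾ (var 2F :+ var 0F :* var 3F) (var 1F :* var 3F) i j)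

  matrix₁-0-1 : ∀ i → matrix₁ 0# 1# i ≋ 1ᴹ i
  matrix₁-0-1 = ∀Fin4
    (∀Fin4 (entry 0F 0F refl) (entry 0F 1F refl) (entry 0F 2F refl) (entry 0F 3F refl))
    (∀Fin4 (entry 1F 0F refl) (entry 1F 1F refl) (entry 1F 2F refl) (entry 1F 3F refl))
    (∀Fin4 (entry 2F 0F refl) (entry 2F 1F refl) (entry 2F 2F refl) (entry 2F 3F refl))
    (∀Fin4 (entry 3F 0F refl) (entry 3F 1F refl) (entry 3F 2F refl) (entry 3F 3F refl))
    where
    entry : ∀ i j → _
    entry i j = prove [] (matrix₁ᴾ (con false) (con true) i j) (𝟏 i j)

  infix 9 _⁻¹

  _⁻¹ : ∀ {x} → ¬ x ≈ 0# → Carrier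
  x≉0 ⁻¹ = proj₁ (leftInverse x≉0)

  ⁻¹-inverseˡ : ∀ {x} (x≉0 : ¬ x ≈ 0#) → x≉0 ⁻¹ * x ≈ 1#
  ⁻¹-inverseˡ x≉0 = proj₂ (leftInverse x≉0)

  -- It acts on the parameter by t ↦ t / (c t + d). The inverse triangular matrix has rows (1, -c e)
  -- and (0, e) with e = 1/d; the sign disappears in characteristic 2.
  borel : ∀ c {d} → ¬ d ≈ 0# → Projectivity
  borel c {d} d≉0 = record
    { matrix   = matrix₁ c d
    ; matrix⁻¹ = matrix₁ (c * e) e
    ; inverseʳ = λ i → ≋-trans (matrix₁-* c d (c * e) e i) (≋-trans
        (matrix₁-cong (x+x≈0 (c * e)) (trans (*-comm d e) ed≈1) i) (matrix₁-0-1 i))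
    ; inverseˡ = λ i → ≋-trans (matrix₁-* (c * e) e c d i) (≋-trans
        (matrix₁-cong (x≈y⇒x+y≈0 (trans (sym (trans (*-congˡ ed≈1) (*-identityʳ c))) (sym (*-assoc c e d)))) ed≈1 i)
        (matrix₁-0-1 i))
    }
    where
    e : Carrier
    e = d≉0 ⁻¹
    ed≈1 : e * d ≈ 1#
    ed≈1 = ⁻¹-inverseˡ d≉0

  cubic-injective : ∀ {s t} → cubic s ≈ₚ cubic t → s ≈∙ t
  cubic-injective {[ s ]} {[ t ]} (k , _ , e) = [ trans (e 2F) (trans (*-congʳ k≈1) (*-identityˡ t)) ]
    where
    k≈1 : k ≈ 1#
    k≈1 = trans (sym (*-identityʳ k)) (sym (e 3F))
  cubic-injective {[ s ]} {∞} (k , _ , e) = contradiction (trans (e 3F) (zeroʳ k)) 1≉0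
  cubic-injective {∞} {[ t ]} (k , k#0 , e) = contradiction (trans (sym (*-identityʳ k)) (sym (e 3F))) (#⇒≉ k#0)
  cubic-injective {∞} {∞} _ = ∙≈∙

  cubic-cong : ∀ {s t} → s ≈∙ t → cubic s ≈ₚ cubic t
  cubic-cong [ s≈t ] = ≋-1* (∀Fin4 (^-congˡ 3 s≈t) (^-congˡ 2 s≈t) s≈t refl)
  cubic-cong ∙≈∙     = ≋-1* {coords (cubic ∞)} ≋-refl

  -- `G` demands an equivalence; its backward direction is preservation by the inverse.
  preserves⇒G : ∀ φ → (∀ t → OnCubic (cubic t · φ)) → (∀ t → OnCubic (cubic t · inverse φ)) → G φ
  preserves⇒G φ to from P = mk⇔ (preserves {φ} to P)
    (λ Pφ∈C → onCubic-resp {P · φ · inverse φ} {P} (·-inverseʳ P φ) (preserves {inverse φ} from (P · φ) Pφ∈C))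
    where
    preserves : ∀ {φ} → (∀ t → OnCubic (cubic t · φ)) → ∀ P → OnCubic P → OnCubic (P · φ)
    preserves {φ} to P (t , P≈Pₜ) = onCubic-resp {cubic t · φ} {P · φ} (∼-sym (·-congʳ {P} {cubic t} φ P≈Pₜ)) (to t)

  G-move : ∀ s → G (move s)
  -- A move is its own inverse, so one computation serves both directions.
  G-move s = preserves⇒G (move s) (onCubic s) (onCubic s)
    where
    onCubic : ∀ s t → OnCubic (cubic t · move s)
    onCubic [ s ] [ t ] = ν⇒onCubic (cubic [ t ] · move [ s ]) (t + s) 1#
      (∀Fin4 (entry 0F refl) (entry 1F refl) (entry 2F refl) (entry 3F refl))
      where
      entry : ∀ j → _
      entry j = prove (t ∷ s ∷ []) ((cubicᴾ [ var 0F ] ⊗ moveᴾ [ var 1F ]) j)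
        (νᴾ (var 0F :+ var 1F) (con true) j)
    onCubic [ s ] ∞ = ν⇒onCubic (cubic ∞ · move [ s ]) 1# 0#
      (∀Fin4 (entry 0F refl) (entry 1F refl) (entry 2F refl) (entry 3F refl))
      where
      entry : ∀ j → _
      entry j = prove (s ∷ []) ((cubicᴾ ∞ ⊗ moveᴾ [ var 0F ]) j) (νᴾ (con true) (con false) j)
    onCubic ∞ [ t ] = ν⇒onCubic (cubic [ t ] · move ∞) 1# t
      (∀Fin4 (entry 0F refl) (entry 1F refl) (entry 2F refl) (entry 3F refl))
      where
      entry : ∀ j → _
      entry j = prove (t ∷ []) ((cubicᴾ [ var 0F ] ⊗ moveᴾ ∞) j) (νᴾ (con true) (var 0F) j)
    onCubic ∞ ∞ = ν⇒onCubic (cubic ∞ · move ∞) 0# 1#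
      (∀Fin4 (entry 0F refl) (entry 1F refl) (entry 2F refl) (entry 3F refl))
      where
      entry : ∀ j → _
      entry j = prove [] ((cubicᴾ ∞ ⊗ moveᴾ ∞) j) (νᴾ (con false) (con true) j)

  cubic-* : ∀ t c d → coords (cubic [ t ]) *ᵥ matrix₁ c d ≋ ν t (c * t + d)
  cubic-* t c d = ∀Fin4 (entry 0F refl) (entry 1F refl) (entry 2F refl) (entry 3F refl)
    where
    entry : ∀ j → _
    entry j = prove (t ∷ c ∷ d ∷ []) ((cubicᴾ [ var 0F ] ⊗ matrix₁ᴾ (var 1F) (var 2F)) j)
      (νᴾ (var 0F) (var 1F :* var 0F :+ var 2F) j)

  G-borel : ∀ c {d} (d≉0 : ¬ d ≈ 0#) → G (borel c d≉0)
  G-borel c {d} d≉0 = preserves⇒G (borel c d≉0)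
    (onCubic (borel c d≉0) c d (λ _ → ≋-refl))
    (onCubic (inverse (borel c d≉0)) (c * (d≉0 ⁻¹)) (d≉0 ⁻¹) (λ _ → ≋-refl))
    where
    -- Stated for every φ with such a matrix, since the inverse of a triangular matrix is again of
    -- this form.
    onCubic : ∀ φ c d → (∀ i → matrix φ i ≋ matrix₁ c d i) → ∀ t → OnCubic (cubic t · φ)
    onCubic φ c d φ≋ [ t ] = ν⇒onCubic (cubic [ t ] · φ) t (c * t + d)
      (≋-trans (*ᵥ-cong {coords (cubic [ t ])} {M = matrix φ} ≋-refl φ≋) (cubic-* t c d))
    onCubic φ c d φ≋ ∞ = ν⇒onCubic (cubic ∞ · φ) 1# c
      (≋-trans (*ᵥ-cong {coords (cubic ∞)} {M = matrix φ} ≋-refl φ≋)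
        (∀Fin4 (entry 0F refl) (entry 1F refl) (entry 2F refl) (entry 3F refl)))
      where
      entry : ∀ j → _
      entry j = prove (c ∷ d ∷ []) ((cubicᴾ ∞ ⊗ matrix₁ᴾ (var 0F) (var 1F)) j) (νᴾ (con true) (var 0F) j)

  -- The stabilizer of P₀ in G.

  onCubic⇒equations : ∀ P → OnCubic P → let x = coords P in
    x 0F * x 2F + x 1F * x 1F ≈ 0# × x 1F * x 3F + x 2F * x 2F ≈ 0#
  onCubic⇒equations P ([ t ] , k , _ , e) =
    trans (+-cong (*-cong (e 0F) (e 2F)) (*-cong (e 1F) (e 1F)))
      (solve 2 (λ k t → k :* t :^ 3 :* (k :* t) :+ k :* t :^ 2 :* (k :* t :^ 2) := con false) refl k t) ,
    trans (+-cong (*-cong (e 1F) (e 3F)) (*-cong (e 2F) (e 2F)))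
      (solve 2 (λ k t → k :* t :^ 2 :* (k :* con true) :+ k :* t :* (k :* t) := con false) refl k t)
  onCubic⇒equations P (∞ , k , _ , e) =
    trans (+-cong (*-cong (e 0F) (e 2F)) (*-cong (e 1F) (e 1F)))
      (solve 1 (λ k → k :* con true :* (k :* con false) :+ k :* con false :* (k :* con false) := con false) refl k) ,
    trans (+-cong (*-cong (e 1F) (e 3F)) (*-cong (e 2F) (e 2F)))
      (solve 1 (λ k → k :* con false :* (k :* con false) :+ k :* con false :* (k :* con false) := con false) refl k)

  -- A zero column `j` would make the diagonal entry `j` of `matrix⁻¹ φ *ᴹ matrix φ` vanish.
  column≉0 : ∀ φ j → ¬ (∀ i → matrix φ i j ≈ 0#)
  column≉0 φ j φⱼ≈0 = 1≉0 (begin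
    1#                                      ≈⟨ diagonal j ⟨
    1ᴹ j j                                  ≈⟨ inverseˡ φ j j ⟨
    (matrix⁻¹ φ *ᴹ matrix φ) j j            ≈⟨ sum≈0 ⟩
    0#                                      ∎)
    where
    open ≈-Reasoning setoid
    diagonal : ∀ j → 1ᴹ j j ≈ 1#
    diagonal = ∀Fin4 refl refl refl refl
    m : Fin 4 → Carrier
    m = matrix⁻¹ φ j
    sum≈0 : (m *ᵥ matrix φ) j ≈ 0#
    sum≈0 = trans (+-cong (*-congˡ (φⱼ≈0 0F)) (+-cong (*-congˡ (φⱼ≈0 1F))
      (+-cong (*-congˡ (φⱼ≈0 2F)) (+-congʳ (*-congˡ (φⱼ≈0 3F))))))
      (solve 4 (λ a b c d → a :* con false :+ (b :* con false :+ (c :* con false :+ (d :* con false :+ con false)))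
        := con false) refl (m 0F) (m 1F) (m 2F) (m 3F))

  fixes-P∞⇒row : ∀ φ → cubic ∞ · φ ≈ₚ cubic ∞ →
    ∃ λ k → ¬ k ≈ 0# × matrix φ 0F ≋ (k ∷′ 0# ∷′ 0# ∷′ 0# ∷′ []′)
  fixes-P∞⇒row φ (k , k#0 , e) = k , #⇒≉ k#0 , ∀Fin4
    (trans (row 0F) (trans (e 0F) (*-identityʳ k)))
    (trans (row 1F) (trans (e 1F) (zeroʳ k)))
    (trans (row 2F) (trans (e 2F) (zeroʳ k)))
    (trans (row 3F) (trans (e 3F) (zeroʳ k)))
    where
    row : ∀ j → matrix φ 0F j ≈ coords (cubic ∞ · φ) j
    row j = solve 4 (λ a b c d → a := con true :* a :+ (con false :* b :+ (con false :* c :+ (con false :* d :+ con false))))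
      refl (matrix φ 0F j) (matrix φ 1F j) (matrix φ 2F j) (matrix φ 3F j)

  fixes-P₀⇒row : ∀ φ → P₀ · φ ≈ₚ P₀ →
    ∃ λ l → ¬ l ≈ 0# × matrix φ 3F ≋ (0# ∷′ 0# ∷′ 0# ∷′ l ∷′ []′)
  fixes-P₀⇒row φ (l , l#0 , e) = l , #⇒≉ l#0 , ∀Fin4
    (trans (row 0F) (trans (e 0F) (zeroʳ l)))
    (trans (row 1F) (trans (e 1F) (zeroʳ l)))
    (trans (row 2F) (trans (e 2F) (zeroʳ l)))
    (trans (row 3F) (trans (e 3F) (*-identityʳ l)))
    where
    row : ∀ j → matrix φ 3F j ≈ coords (P₀ · φ) j
    row j = solve 4 (λ a b c d → d := con false :* a :+ (con false :* b :+ (con false :* c :+ (con true :* d :+ con false))))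
      refl (matrix φ 0F j) (matrix φ 1F j) (matrix φ 2F j) (matrix φ 3F j)

  -- Rows 0 and 3 come from the images of P∞ and P₀, so rows 1 and 2, called `a` and `b`, remain
  -- unknown. The highest coefficient of the first identity and the lowest of the second give the
  -- first zeros, invertibility gives the first nonzero entry, and these decouple the other
  -- coefficients.
  module Diagonal (φ : Projectivity) (Gφ : G φ)
    {k l} (k≉0 : ¬ k ≈ 0#)
    (row₀ : matrix φ 0F ≋ (k ∷′ 0# ∷′ 0# ∷′ 0# ∷′ []′))
    (row₃ : matrix φ 3F ≋ (0# ∷′ 0# ∷′ 0# ∷′ l ∷′ []′)) (l≉0 : ¬ l ≈ 0#) where

    a b : Fin 4 → Carrier
    a = matrix φ 1F
    b = matrix φ 2F

    image : Carrier → V₄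
    image t =
      t ^ 3 * k + (t ^ 2 * a 0F + t * b 0F) ∷′ t ^ 2 * a 1F + t * b 1F ∷′
      t ^ 2 * a 2F + t * b 2F ∷′ t ^ 2 * a 3F + (t * b 3F + l) ∷′ []′

    image≋ : ∀ t → coords (cubic [ t ] · φ) ≋ image t
    image≋ t = ∀Fin4
      (trans (expand (row₀ 0F) (row₃ 0F)) (solve 4 (λ t k a b →
        t :^ 3 :* k :+ (t :^ 2 :* a :+ (t :* b :+ (con true :* con false :+ con false)))
        := t :^ 3 :* k :+ (t :^ 2 :* a :+ t :* b)) refl t k (a 0F) (b 0F)))
      (trans (expand (row₀ 1F) (row₃ 1F)) (middle (a 1F) (b 1F)))
      (trans (expand (row₀ 2F) (row₃ 2F)) (middle (a 2F) (b 2F)))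
      (trans (expand (row₀ 3F) (row₃ 3F)) (solve 4 (λ t l a b →
        t :^ 3 :* con false :+ (t :^ 2 :* a :+ (t :* b :+ (con true :* l :+ con false)))
        := t :^ 2 :* a :+ (t :* b :+ l)) refl t l (a 3F) (b 3F)))
      where
      expand : ∀ {x x′ y z w w′} → x ≈ x′ → w ≈ w′ →
        t ^ 3 * x + (t ^ 2 * y + (t * z + (1# * w + 0#))) ≈ t ^ 3 * x′ + (t ^ 2 * y + (t * z + (1# * w′ + 0#)))
      expand x≈x′ w≈w′ = +-cong (*-congˡ x≈x′) (+-congˡ (+-congˡ (+-congʳ (*-congˡ w≈w′))))
      middle : ∀ a b → t ^ 3 * 0# + (t ^ 2 * a + (t * b + (1# * 0# + 0#))) ≈ t ^ 2 * a + t * b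
      middle = solve 3 (λ t a b →
        t :^ 3 :* con false :+ (t :^ 2 :* a :+ (t :* b :+ (con true :* con false :+ con false)))
        := t :^ 2 :* a :+ t :* b) refl t

    -- `p₁` has degree 5, so six distinct parameters determine its coefficients.
    roots : Fin 6 → Carrier
    roots i = element (Fin.inject≤ i 6≤q)

    roots-injective : ∀ {i j} → roots i ≈ roots j → i ≡ j
    roots-injective {i} {j} = Fin.inject≤-injective 6≤q 6≤q i j ∘ element-injective

    -- The coefficients of x₀x₂ + x₁² and x₁x₃ + x₂² along the image of the cubic.
    p₁ p₂ : Vec Carrier 6
    p₁ = 0# ∷ 0# ∷ b 0F * b 2F + b 1F * b 1F ∷ a 0F * b 2F + b 0F * a 2F
       ∷ k * b 2F + (a 0F * a 2F + a 1F * a 1F) ∷ k * a 2F ∷ []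
    p₂ = 0# ∷ b 1F * l ∷ a 1F * l + (b 1F * b 3F + b 2F * b 2F) ∷ a 1F * b 3F + b 1F * a 3F
       ∷ a 1F * a 3F + a 2F * a 2F ∷ 0# ∷ []

    equations : ∀ t → image t 0F * image t 2F + image t 1F * image t 1F ≈ 0# ×
                      image t 1F * image t 3F + image t 2F * image t 2F ≈ 0#
    equations t =
      trans (+-cong (*-cong (e 0F) (e 2F)) (*-cong (e 1F) (e 1F))) (proj₁ eqs) ,
      trans (+-cong (*-cong (e 1F) (e 3F)) (*-cong (e 2F) (e 2F))) (proj₂ eqs)
      where
      e : image t ≋ coords (cubic [ t ] · φ)
      e = ≋-sym (image≋ t)
      eqs : let x = coords (cubic [ t ] · φ) in
        x 0F * x 2F + x 1F * x 1F ≈ 0# × x 1F * x 3F + x 2F * x 2F ≈ 0#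
      eqs = onCubic⇒equations (cubic [ t ] · φ) (Equivalence.to (Gφ (cubic [ t ])) ([ t ] , ∼-refl))

    p₁≈0 : ∀ i → lookup p₁ i ≈ 0#
    p₁≈0 = roots⇒≈0 p₁ roots roots-injective λ i → trans
      (solve 8 (λ t k a₀ a₁ a₂ b₀ b₁ b₂ →
        con false :+ t :* (con false :+ t :* (b₀ :* b₂ :+ b₁ :* b₁ :+ t :* (a₀ :* b₂ :+ b₀ :* a₂
        :+ t :* (k :* b₂ :+ (a₀ :* a₂ :+ a₁ :* a₁) :+ t :* (k :* a₂ :+ t :* con false)))))
        := (t :^ 3 :* k :+ (t :^ 2 :* a₀ :+ t :* b₀)) :* (t :^ 2 :* a₂ :+ t :* b₂)
        :+ (t :^ 2 :* a₁ :+ t :* b₁) :* (t :^ 2 :* a₁ :+ t :* b₁))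
        refl (roots i) k (a 0F) (a 1F) (a 2F) (b 0F) (b 1F) (b 2F))
      (proj₁ (equations (roots i)))

    p₂≈0 : ∀ i → lookup p₂ i ≈ 0#
    p₂≈0 = roots⇒≈0 p₂ roots roots-injective λ i → trans
      (solve 8 (λ t l a₁ a₂ a₃ b₁ b₂ b₃ →
        con false :+ t :* (b₁ :* l :+ t :* (a₁ :* l :+ (b₁ :* b₃ :+ b₂ :* b₂) :+ t :* (a₁ :* b₃ :+ b₁ :* a₃
        :+ t :* (a₁ :* a₃ :+ a₂ :* a₂ :+ t :* (con false :+ t :* con false)))))
        := (t :^ 2 :* a₁ :+ t :* b₁) :* (t :^ 2 :* a₃ :+ (t :* b₃ :+ l))
        :+ (t :^ 2 :* a₂ :+ t :* b₂) :* (t :^ 2 :* a₂ :+ t :* b₂))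
        refl (roots i) l (a 1F) (a 2F) (a 3F) (b 1F) (b 2F) (b 3F))
      (proj₂ (equations (roots i)))

    drop : ∀ {x y z} → y ≈ 0# → x + z * y ≈ 0# → x ≈ 0#
    drop {x} {y} {z} y≈0 e = trans (sym (trans (+-congˡ (trans (*-congˡ y≈0) (zeroʳ z))) (+-identityʳ x))) e

    a₂≈0 : a 2F ≈ 0#
    a₂≈0 = integral k≉0 (p₁≈0 5F)

    b₁≈0 : b 1F ≈ 0#
    b₁≈0 = integral l≉0 (trans (*-comm l (b 1F)) (p₂≈0 1F))

    -- Once `a 2F` is zero, `b 2F` is the only entry of column 2 that can be nonzero.
    b₂≉0 : ¬ b 2F ≈ 0#
    b₂≉0 b₂≈0 = column≉0 φ 2F (∀Fin4 (row₀ 2F) a₂≈0 b₂≈0 (row₃ 2F))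

    -- The t⁴ coefficient of the first identity after `a 2F` drops out; it passes nonvanishing from
    -- `b 2F` on to `a 1F`.
    a₁²≈kb₂ : a 1F * a 1F ≈ k * b 2F
    a₁²≈kb₂ = sym (x+y≈0⇒x≈y (drop a₂≈0 (trans
      (solve 5 (λ k b₂ a₀ a₁ a₂ → k :* b₂ :+ a₁ :* a₁ :+ a₀ :* a₂ := k :* b₂ :+ (a₀ :* a₂ :+ a₁ :* a₁))
        refl k (b 2F) (a 0F) (a 1F) (a 2F)) (p₁≈0 4F))))

    a₁≉0 : ¬ a 1F ≈ 0#
    a₁≉0 a₁≈0 = x*y≉0 k≉0 b₂≉0 (trans (sym a₁²≈kb₂) (trans (*-congˡ a₁≈0) (zeroʳ _)))

    a₀≈0 : a 0F ≈ 0#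
    a₀≈0 = integral b₂≉0 (trans (*-comm _ _) (drop a₂≈0 (p₁≈0 3F)))

    b₀≈0 : b 0F ≈ 0#
    b₀≈0 = integral b₂≉0 (trans (*-comm _ _) (drop b₁≈0 (p₁≈0 2F)))

    b₃≈0 : b 3F ≈ 0#
    b₃≈0 = integral a₁≉0 (drop b₁≈0 (trans (+-congˡ (*-comm _ _)) (p₂≈0 3F)))

    a₃≈0 : a 3F ≈ 0#
    a₃≈0 = integral a₁≉0 (drop a₂≈0 (p₂≈0 4F))

    a₁l≈b₂² : a 1F * l ≈ b 2F * b 2F
    a₁l≈b₂² = x+y≈0⇒x≈y (drop b₁≈0 (trans
      (solve 5 (λ l b₁ b₂ b₃ a₁ → a₁ :* l :+ b₂ :* b₂ :+ b₃ :* b₁ := a₁ :* l :+ (b₁ :* b₃ :+ b₂ :* b₂))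
        refl l (b 1F) (b 2F) (b 3F) (a 1F)) (p₂≈0 2F)))

    -- The relations a₁² = k b₂ and a₁ l = b₂² say that the diagonal k, a₁, b₂, l is a geometric
    -- progression; `d` is its ratio.
    d : Carrier
    d = k≉0 ⁻¹ * a 1F

    a₁≈kd : a 1F ≈ k * d
    a₁≈kd = trans (sym (trans (*-congʳ (⁻¹-inverseˡ k≉0)) (*-identityˡ (a 1F))))
      (solve 3 (λ u k a → u :* k :* a := k :* (u :* a)) refl (k≉0 ⁻¹) k (a 1F))

    d≉0 : ¬ d ≈ 0#
    d≉0 d≈0 = a₁≉0 (trans a₁≈kd (trans (*-congˡ d≈0) (zeroʳ k)))

    cancel : ∀ {x y z} → ¬ x ≈ 0# → x * y ≈ x * z → y ≈ z
    cancel {x} {y} {z} x≉0 e = x+y≈0⇒x≈y (integral x≉0 (trans (distribˡ x y z) (x≈y⇒x+y≈0 e)))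

    b₂≈kd² : b 2F ≈ k * d ^ 2
    b₂≈kd² = cancel k≉0 (trans (sym a₁²≈kb₂) (trans (*-cong a₁≈kd a₁≈kd)
      (solve 2 (λ k d → k :* d :* (k :* d) := k :* (k :* d :^ 2)) refl k d)))

    l≈kd³ : l ≈ k * d ^ 3
    l≈kd³ = cancel a₁≉0 (trans a₁l≈b₂² (trans (*-cong b₂≈kd² b₂≈kd²)
      (trans (solve 2 (λ k d → k :* d :^ 2 :* (k :* d :^ 2) := k :* d :* (k :* d :^ 3)) refl k d)
      (*-congʳ (sym a₁≈kd)))))

    diagonal : matrix φ ∼ᴹ matrix₁ 0# d
    diagonal = k , ≉⇒# k≉0 , ∀Fin4
      (≋-trans row₀ (∀Fin4 (sym (*-identityʳ k)) (sym (zeroʳ k)) (sym (solve 1 (λ k → k :* con false :^ 2 := con false) refl k)) (sym (solve 1 (λ k → k :* con false :^ 3 := con false) refl k))))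
      (∀Fin4 (≈k0 a₀≈0) a₁≈kd (≈k0 a₂≈0) (trans a₃≈0 (sym (solve 2 (λ k d → k :* (con false :^ 2 :* d) := con false) refl k d))))
      (∀Fin4 (≈k0 b₀≈0) (≈k0 b₁≈0) b₂≈kd² (trans b₃≈0 (sym (solve 2 (λ k d → k :* (con false :* d :^ 2) := con false) refl k d))))
      (≋-trans row₃ (∀Fin4 (≈k0 refl) (≈k0 refl) (≈k0 refl) l≈kd³))
      where
      ≈k0 : ∀ {x} → x ≈ 0# → x ≈ k * 0#
      ≈k0 x≈0 = trans x≈0 (sym (zeroʳ k))

  P₀≈cubic0 : P₀ ≈ₚ cubic [ 0# ]
  P₀≈cubic0 = ≋-1* (∀Fin4 (entry 0F refl) (entry 1F refl) (entry 2F refl) (entry 3F refl))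
    where
    entry : ∀ j → _
    entry j = prove [] (𝟏 3F j) (cubicᴾ [ con false ] j)

  P₀·borel : ∀ c {d} (d≉0 : ¬ d ≈ 0#) → P₀ · borel c d≉0 ≈ₚ P₀
  P₀·borel c {d} d≉0 = d ^ 3 , ≉⇒# (x^n≉0 3 d≉0) ,
    ∀Fin4 (entry 0F refl) (entry 1F refl) (entry 2F refl) (entry 3F refl)
    where
    entry : ∀ j → _
    entry j = prove (c ∷ d ∷ []) ((𝟏 3F ⊗ matrix₁ᴾ (var 0F) (var 1F)) j) (var 1F :^ 3 :* 𝟏 3F j)

  -- If P∞ is not fixed, its image is some P_s, with s nonzero because P₀ is already the image of
  -- P₀. The map t ↦ t / (c t + 1) with c = 1/s sends s to ∞, as c s + 1 = 1 + 1 = 0.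
  fixes-P₀⇒borel-fixes-P∞ : ∀ φ → G φ → P₀ · φ ≈ₚ P₀ → ∃ λ c → cubic ∞ · φ · borel c 1≉0 ≈ₚ cubic ∞
  fixes-P₀⇒borel-fixes-P∞ φ Gφ fixes with Equivalence.to (Gφ (cubic ∞)) (∞ , ∼-refl)
  ... | ∞ , P∞φ≈P∞ = 0# , ∼-trans (·-congʳ {cubic ∞ · φ} {cubic ∞} (borel 0# 1≉0) P∞φ≈P∞)
    (≋-1* (∀Fin4 (entry 0F refl) (entry 1F refl) (entry 2F refl) (entry 3F refl)))
    where
    entry : ∀ j → _
    entry j = prove [] ((cubicᴾ ∞ ⊗ matrix₁ᴾ (con false) (con true)) j) (cubicᴾ ∞ j)
  ... | [ s ] , P∞φ≈Pₛ with s ≈? 0#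
  ...   | yes s≈0 = contradiction (cubic-injective {[ 0# ]} {∞} (∼-trans (∼-sym P₀≈cubic0)
    (·-injective φ {P₀} {cubic ∞} (∼-trans fixes (∼-trans P₀≈cubic0
      (∼-trans (cubic-cong [ sym s≈0 ]) (∼-sym P∞φ≈Pₛ))))))) λ ()
  ...   | no  s≉0 = s≉0 ⁻¹ , ∼-trans (·-congʳ {cubic ∞ · φ} {cubic [ s ]} (borel (s≉0 ⁻¹) 1≉0) P∞φ≈Pₛ)
    (s ^ 3 , ≉⇒# (x^n≉0 3 s≉0) , ≋-trans (cubic-* s (s≉0 ⁻¹) 1#) (∀Fin4
      (sym (*-identityʳ _))
      (trans (*-congˡ y≈0) (solve 1 (λ s → s :^ 2 :* con false := s :^ 3 :* con false) refl s))
      (trans (*-congˡ (^-congˡ 2 y≈0)) (solve 1 (λ s → s :* con false :^ 2 := s :^ 3 :* con false) refl s))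
      (trans (^-congˡ 3 y≈0) (solve 1 (λ s → con false :^ 3 := s :^ 3 :* con false) refl s))))
    where
    y≈0 : s≉0 ⁻¹ * s + 1# ≈ 0#
    y≈0 = x≈y⇒x+y≈0 (⁻¹-inverseˡ s≉0)

  ⊙-cancel : ∀ φ ψ {N} → matrix (φ ⊙ ψ) ∼ᴹ N → matrix φ ∼ᴹ N *ᴹ matrix⁻¹ ψ
  ⊙-cancel φ ψ {N} φψ∼N = ∼ᴹ-trans {O = N *ᴹ matrix⁻¹ ψ}
    (≋⇒∼ᴹ λ i → ≋-sym (*ᵥ-cancel (matrix φ i) (matrix ψ) (matrix⁻¹ ψ) (inverseʳ ψ)))
    (*ᴹ-∼ᴹ {matrix (φ ⊙ ψ)} {N} (matrix⁻¹ ψ) φψ∼N)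

  fixes-P₀-P∞⇒diagonal : ∀ φ → G φ → P₀ · φ ≈ₚ P₀ → cubic ∞ · φ ≈ₚ cubic ∞ →
    ∃ λ d → ¬ d ≈ 0# × matrix φ ∼ᴹ matrix₁ 0# d
  fixes-P₀-P∞⇒diagonal φ Gφ fixes₀ fixes∞ = result (fixes-P∞⇒row φ fixes∞) (fixes-P₀⇒row φ fixes₀)
    where
    result : (∃ λ k → ¬ k ≈ 0# × matrix φ 0F ≋ (k ∷′ 0# ∷′ 0# ∷′ 0# ∷′ []′)) →
             (∃ λ l → ¬ l ≈ 0# × matrix φ 3F ≋ (0# ∷′ 0# ∷′ 0# ∷′ l ∷′ []′)) →
             ∃ λ d → ¬ d ≈ 0# × matrix φ ∼ᴹ matrix₁ 0# d
    result (k , k≉0 , row₀) (l , l≉0 , row₃) = d , d≉0 , diagonal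
      where open Diagonal φ Gφ k≉0 row₀ row₃ l≉0

  fixes-P₀⇒matrix₁ : ∀ φ → G φ → P₀ · φ ≈ₚ P₀ → ∃₂ λ c d → ¬ d ≈ 0# × matrix φ ∼ᴹ matrix₁ c d
  fixes-P₀⇒matrix₁ φ Gφ fixes = result (fixes-P₀⇒borel-fixes-P∞ φ Gφ fixes)
    where
    -- Inverses come from a search, so `1≉0 ⁻¹` is not 1 by computation and is carried along.
    e : Carrier
    e = 1≉0 ⁻¹

    e≉0 : ¬ e ≈ 0#
    e≉0 e≈0 = 1≉0 (trans (sym (⁻¹-inverseˡ 1≉0)) (trans (*-congʳ e≈0) (zeroˡ _)))

    result : (∃ λ c → cubic ∞ · φ · borel c 1≉0 ≈ₚ cubic ∞) → ∃₂ λ c d → ¬ d ≈ 0# × matrix φ ∼ᴹ matrix₁ c d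
    result (c , fixes∞) = result′ (fixes-P₀-P∞⇒diagonal (φ ⊙ ψ) (G-⊙ {φ} {ψ} Gφ (G-borel c 1≉0))
      (∼-trans (·-⊙ P₀ φ ψ) (∼-trans (·-congʳ {P₀ · φ} {P₀} ψ fixes) (P₀·borel c 1≉0)))
      (∼-trans (·-⊙ (cubic ∞) φ ψ) fixes∞))
      where
      ψ : Projectivity
      ψ = borel c 1≉0
      result′ : (∃ λ d → ¬ d ≈ 0# × matrix (φ ⊙ ψ) ∼ᴹ matrix₁ 0# d) → ∃₂ λ c d → ¬ d ≈ 0# × matrix φ ∼ᴹ matrix₁ c d
      result′ (d , d≉0 , φψ∼) = c * e + 0# * e , d * e , x*y≉0 d≉0 e≉0 ,
        ∼ᴹ-trans {matrix φ} {matrix₁ 0# d *ᴹ matrix₁ (c * e) e} {matrix₁ (c * e + 0# * e) (d * e)}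
          (⊙-cancel φ ψ {matrix₁ 0# d} φψ∼)
          (≋⇒∼ᴹ (matrix₁-* 0# d (c * e) e))

  P₀·move : ∀ t → coords (P₀ · move t) ≋ coords (cubic t)
  P₀·move [ t ] = ∀Fin4 (entry 0F refl) (entry 1F refl) (entry 2F refl) (entry 3F refl)
    where
    entry : ∀ j → _
    entry j = prove (t ∷ []) ((𝟏 3F ⊗ moveᴾ [ var 0F ]) j) (cubicᴾ [ var 0F ] j)
  P₀·move ∞ = ∀Fin4 (entry 0F refl) (entry 1F refl) (entry 2F refl) (entry 3F refl)
    where
    entry : ∀ j → _
    entry j = prove [] ((𝟏 3F ⊗ moveᴾ ∞) j) (cubicᴾ ∞ j)

  cubic·move : ∀ t → cubic t · move t ≈ₚ P₀
  cubic·move t = ∼-trans (·-congʳ {cubic t} {P₀ · move t} (move t) (≋-1* (≋-sym (P₀·move t)))) (·-inverseʳ P₀ (move t))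

  -- The move belonging to the image P_t of P₀ takes P_t back to P₀, so φ followed by it fixes P₀.
  -- Being an involution, the same move reappears when it is cancelled.
  G-decomposition : ∀ φ → G φ → ∃ λ t → ∃₂ λ c d → ¬ d ≈ 0# ×
    matrix φ ∼ᴹ matrix₁ c d *ᴹ moveᴹ t
  G-decomposition φ Gφ = result (Equivalence.to (Gφ P₀) ([ 0# ] , P₀≈cubic0))
    where
    result : OnCubic (P₀ · φ) → _
    result (t , P₀φ≈Pₜ) = result′ (fixes-P₀⇒matrix₁ (φ ⊙ move t) (G-⊙ {φ} {move t} Gφ (G-move t))
        (∼-trans (·-⊙ P₀ φ (move t)) (∼-trans (·-congʳ {P₀ · φ} {cubic t} (move t) P₀φ≈Pₜ) (cubic·move t))))
      where
      result′ : (∃₂ λ c d → ¬ d ≈ 0# × matrix (φ ⊙ move t) ∼ᴹ matrix₁ c d) → _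
      result′ (c , d , d≉0 , φ∼) = t , c , d , d≉0 , ⊙-cancel φ (move t) {matrix₁ c d} φ∼

  -- Proportional points and equality of lines.

  notAllZero : ∀ P → coords P 0F ≈ 0# → coords P 1F ≈ 0# → coords P 2F ≈ 0# → ¬ coords P 3F ≈ 0#
  notAllZero P x₀≈0 x₁≈0 x₂≈0 x₃≈0 = #⇒≉ (proj₂ (nonzero P))
    (∀Fin4 {P = λ i → coords P i ≈ 0#} x₀≈0 x₁≈0 x₂≈0 x₃≈0 _)

  -- Each point has a nonzero coordinate, so if one scalar vanished, the other would as well.
  proportional : ∀ P Q α β → ¬ (α ≈ 0# × β ≈ 0#) → (∀ i → α * coords P i ≈ β * coords Q i) → P ≈ₚ Q
  proportional P Q α β αβ≉0 e with α ≈? 0# | β ≈? 0#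
  ... | yes α≈0 | yes β≈0 = contradiction (α≈0 , β≈0) αβ≉0
  ... | yes α≈0 | no  β≉0 with i , Qᵢ#0 ← nonzero Q = contradiction
    (integral β≉0 (trans (sym (e i)) (trans (*-congʳ α≈0) (zeroˡ _)))) (#⇒≉ Qᵢ#0)
  proportional P Q α β αβ≉0 e | no α≉0 | yes β≈0 with i , Pᵢ#0 ← nonzero P = contradiction
    (integral α≉0 (trans (e i) (trans (*-congʳ β≈0) (zeroˡ _)))) (#⇒≉ Pᵢ#0)
  proportional P Q α β αβ≉0 e | no α≉0 | no β≉0 =
    α≉0 ⁻¹ * β , ≉⇒# (x*y≉0 α⁻¹≉0 β≉0) , λ i → begin
      coords P i                      ≈⟨ *-identityˡ _ ⟨
      1# * coords P i                 ≈⟨ *-congʳ (⁻¹-inverseˡ α≉0) ⟨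
      α≉0 ⁻¹ * α * coords P i         ≈⟨ *-assoc _ _ _ ⟩
      α≉0 ⁻¹ * (α * coords P i)       ≈⟨ *-congˡ (e i) ⟩
      α≉0 ⁻¹ * (β * coords Q i)       ≈⟨ *-assoc _ _ _ ⟨
      α≉0 ⁻¹ * β * coords Q i         ∎
    where
    open ≈-Reasoning setoid
    α⁻¹≉0 : ¬ α≉0 ⁻¹ ≈ 0#
    α⁻¹≉0 e≈0 = 1≉0 (trans (sym (⁻¹-inverseˡ α≉0)) (trans (*-congʳ e≈0) (zeroˡ _)))

  -- Cramer's rule. The coefficients of the spanning points of `L` with respect to those of `L′`
  -- form a 2 by 2 matrix of determinant `D`, invertible because the spanning points of `L` are
  -- distinct.
  ∈ₗ⇒≈ₗ : ∀ L L′ → fst L ∈ₗ L′ → snd L ∈ₗ L′ → L ≈ₗ L′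
  ∈ₗ⇒≈ₗ L L′ fst∈@(a , b , f) snd∈@(c , d , g) P = mk⇔
    (λ (x , y , e) → ∈ₗ-combination {fst L} {snd L} {P} L′ x y fst∈ snd∈ e)
    (λ (x , y , e) → ∈ₗ-combination {fst L′} {snd L′} {P} L x y fst′∈ snd′∈ e)
    where
    x₁ x₂ y₁ y₂ : V₄
    x₁ = coords (fst L)
    x₂ = coords (snd L)
    y₁ = coords (fst L′)
    y₂ = coords (snd L′)

    D : Carrier
    D = a * d + b * c

    Dp′ : ∀ i → d * x₁ i + b * x₂ i ≈ D * y₁ i
    Dp′ i = trans (+-cong (*-congˡ (f i)) (*-congˡ (g i)))
      (solve 6 (λ a b c d x y → d :* (a :* x :+ b :* y) :+ b :* (c :* x :+ d :* y) := (a :* d :+ b :* c) :* x)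
        refl a b c d (y₁ i) (y₂ i))

    Dq′ : ∀ i → c * x₁ i + a * x₂ i ≈ D * y₂ i
    Dq′ i = trans (+-cong (*-congˡ (f i)) (*-congˡ (g i)))
      (solve 6 (λ a b c d x y → c :* (a :* x :+ b :* y) :+ a :* (c :* x :+ d :* y) := (a :* d :+ b :* c) :* y)
        refl a b c d (y₁ i) (y₂ i))

    D≉0 : ¬ D ≈ 0#
    -- For D = 0 the rows of the adjugate are linear relations between the spanning points of `L`;
    -- the second is taken when the first is trivial.
    D≉0 D≈0 with d ≈? 0# | b ≈? 0#
    ... | no d≉0  | _       = distinct L (proportional (fst L) (snd L) d b (d≉0 ∘ proj₁)
      λ i → x+y≈0⇒x≈y (trans (Dp′ i) (trans (*-congʳ D≈0) (zeroˡ _))))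
    ... | yes _   | no b≉0  = distinct L (proportional (fst L) (snd L) d b (b≉0 ∘ proj₂)
      λ i → x+y≈0⇒x≈y (trans (Dp′ i) (trans (*-congʳ D≈0) (zeroˡ _))))
    ... | yes d≈0 | yes b≈0 = distinct L (proportional (fst L) (snd L) c a ca≉0
      λ i → x+y≈0⇒x≈y (trans (Dq′ i) (trans (*-congʳ D≈0) (zeroˡ _))))
      where
      ca≉0 : ¬ (c ≈ 0# × a ≈ 0#)
      ca≉0 (c≈0 , a≈0) with i , xᵢ#0 ← nonzero (fst L) = #⇒≉ xᵢ#0 (trans (f i)
        (trans (+-cong (trans (*-congʳ a≈0) (zeroˡ _)) (trans (*-congʳ b≈0) (zeroˡ _))) (+-identityʳ 0#)))

    divide : ∀ {x y z u v} → x * u + y * v ≈ D * z → z ≈ D≉0 ⁻¹ * x * u + D≉0 ⁻¹ * y * v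
    divide {x} {y} {z} {u} {v} e = begin
      z                                          ≈⟨ *-identityˡ z ⟨
      1# * z                                     ≈⟨ *-congʳ (⁻¹-inverseˡ D≉0) ⟨
      D≉0 ⁻¹ * D * z                             ≈⟨ *-assoc _ _ _ ⟩
      D≉0 ⁻¹ * (D * z)                           ≈⟨ *-congˡ e ⟨
      D≉0 ⁻¹ * (x * u + y * v)                   ≈⟨ solve 5 (λ i x y u v →
        i :* (x :* u :+ y :* v) := i :* x :* u :+ i :* y :* v) refl (D≉0 ⁻¹) x y u v ⟩
      D≉0 ⁻¹ * x * u + D≉0 ⁻¹ * y * v            ∎
      where open ≈-Reasoning setoid

    fst′∈ : fst L′ ∈ₗ L
    fst′∈ = D≉0 ⁻¹ * d , D≉0 ⁻¹ * b , λ i → divide (Dp′ i)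

    snd′∈ : snd L′ ∈ₗ L
    snd′∈ = D≉0 ⁻¹ * c , D≉0 ⁻¹ * a , λ i → divide (Dq′ i)

  -- The lines `U t v` and their coordinates.

  base : Carrier → Line
  base v = line P₀ ⟨ 0# ∷′ 1# ∷′ v ∷′ 0# ∷′ []′ ∣ 1F , 1#0 ⟩
    λ (k , _ , e) → 1≉0 (trans (e 3F) (zeroʳ k))

  baseᴾ : ∀ {n} → Polynomial n → PolynomialVector n
  baseᴾ v = con false ∷′ con true ∷′ v ∷′ con false ∷′ []′

  U : F⁺ → Carrier → Line
  U t v = base v ·ₗ move t

  base-cong : ∀ {v v′} → v ≈ v′ → base v ≈ₗ base v′
  base-cong {v} {v′} v≈v′ = ≋⇒≈ₗ {base v} {base v′} ≋-refl (∀Fin4 refl refl v≈v′ refl)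

  U-congʳ : ∀ t {v v′} → v ≈ v′ → U t v ≈ₗ U t v′
  U-congʳ t {v} {v′} v≈v′ = ·ₗ-cong {base v} {base v′} (move t) (base-cong v≈v′)

  moveᴹ-cong : ∀ {s t} → s ≈∙ t → ∀ i → moveᴹ s i ≋ moveᴹ t i
  moveᴹ-cong [ s≈t ] = ∀Fin4 ≋-refl
    (∀Fin4 s≈t refl refl refl)
    (∀Fin4 (^-congˡ 2 s≈t) refl refl refl)
    (∀Fin4 (^-congˡ 3 s≈t) (^-congˡ 2 s≈t) s≈t refl)
  moveᴹ-cong ∙≈∙ _ = ≋-refl

  U-cong : ∀ {s t v w} → s ≈∙ t → v ≈ w → U s v ≈ₗ U t w
  U-cong {s} {t} {v} {w} s≈t v≈w = ≈ₗ-trans {U s v} {U t v} {U t w}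
    (·ₗ-∼ᴹ (base v) {move s} {move t} (≋⇒∼ᴹ (moveᴹ-cong s≈t))) (U-congʳ t v≈w)

  -- The second spanning point goes to d (0, 1, v d, 0) plus a multiple of P₀. That multiple absorbs
  -- `c`, and only the scaling by `d` remains visible.
  base-borel : ∀ v c {d} (d≉0 : ¬ d ≈ 0#) → base v ·ₗ borel c d≉0 ≈ₗ base (v * d)
  base-borel v c {d} d≉0 = ∈ₗ⇒≈ₗ (base v ·ₗ borel c d≉0) (base (v * d))
    (d ^ 3 , 0# , ∀Fin4 (first 0F refl) (first 1F refl) (first 2F refl) (first 3F refl))
    (c ^ 2 * d + v * (c * d ^ 2) , d , ∀Fin4 (second 0F refl) (second 1F refl) (second 2F refl) (second 3F refl))
    where
    first : ∀ j → _
    first j = prove (v ∷ c ∷ d ∷ []) ((𝟏 3F ⊗ matrix₁ᴾ (var 1F) (var 2F)) j)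
      (var 2F :^ 3 :* 𝟏 3F j :+ con false :* baseᴾ (var 0F :* var 2F) j)
    second : ∀ j → _
    second j = prove (v ∷ c ∷ d ∷ []) ((baseᴾ (var 0F) ⊗ matrix₁ᴾ (var 1F) (var 2F)) j)
      ((var 1F :^ 2 :* var 2F :+ var 0F :* (var 1F :* var 2F :^ 2)) :* 𝟏 3F j :+ var 2F :* baseᴾ (var 0F :* var 2F) j)

  base-injective : ∀ {v w} → base v ≈ₗ base w → v ≈ w
  base-injective {v} {w} v≈w = result (≈ₗ⇒⊆ {base v} {base w} {snd (base v)} v≈w (snd∈ₗ (base v)))
    where
    result : snd (base v) ∈ₗ base w → v ≈ w
    result (a , b , e) = begin
      v                 ≈⟨ e 2F ⟩
      a * 0# + b * w    ≈⟨ +-cong (zeroʳ a) (*-congʳ b≈1) ⟩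
      0# + 1# * w       ≈⟨ +-identityˡ _ ⟩
      1# * w            ≈⟨ *-identityˡ w ⟩
      w                 ∎
      where
      open ≈-Reasoning setoid
      b≈1 : b ≈ 1#
      b≈1 = sym (trans (e 1F) (solve 2 (λ a b → a :* con false :+ b :* con true := b) refl a b))

  onPlane : F⁺ → V₄ → Carrier
  onPlane t x = let π = coords (osculatingPlane t) in
    π 0F * x 0F + (π 1F * x 1F + (π 2F * x 2F + (π 3F * x 3F + 0#)))

  -- In characteristic 2 the osculating plane at P_t has coefficients 1, t, t², t³, which is the
  -- first column of `moveᴹ t`; at ∞ both are 0, 0, 0, 1. Hence `move t` carries this plane to x₀ =
  -- 0.
  osculating-move : ∀ t x → (x *ᵥ moveᴹ t) 0F ≈ onPlane t x
  osculating-move [ t ] x = solve 5 (λ t x₀ x₁ x₂ x₃ →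
    x₀ :* con true :+ (x₁ :* t :+ (x₂ :* t :^ 2 :+ (x₃ :* t :^ 3 :+ con false)))
    := con true :* x₀ :+ (:- (3 :× t) :* x₁ :+ (3 :× (t :^ 2) :* x₂ :+ (:- (t :^ 3) :* x₃ :+ con false))))
    refl t (x 0F) (x 1F) (x 2F) (x 3F)
  osculating-move ∞ x = solve 4 (λ x₀ x₁ x₂ x₃ →
    x₀ :* con false :+ (x₁ :* con false :+ (x₂ :* con false :+ (x₃ :* con true :+ con false)))
    := con false :* x₀ :+ (con false :* x₁ :+ (con false :* x₂ :+ (con true :* x₃ :+ con false))))
    refl (x 0F) (x 1F) (x 2F) (x 3F)

  -- For finite parameters the form of the plane at P_s is (s + t)³: the plane meets the cubic with
  -- multiplicity three at P_t and nowhere else.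
  cubic∈osculating : ∀ s t → cubic s ∈ₕ osculatingPlane t → s ≈∙ t
  cubic∈osculating [ s ] [ t ] e = [ x+y≈0⇒x≈y (x^n≈0⇒x≈0 3 (trans (solve 2 (λ s t →
    (s :+ t) :^ 3 := con true :* s :^ 3 :+ (:- (3 :× t) :* s :^ 2 :+ (3 :× (t :^ 2) :* s :+ (:- (t :^ 3) :* con true :+ con false))))
    refl s t) e)) ]
  cubic∈osculating [ s ] ∞ e = contradiction (trans (solve 1 (λ s →
    con true := con false :* s :^ 3 :+ (con false :* s :^ 2 :+ (con false :* s :+ (con true :* con true :+ con false)))) refl s) e) 1≉0
  cubic∈osculating ∞ [ t ] e = contradiction (trans (solve 1 (λ t →
    con true := con true :* con true :+ (:- (3 :× t) :* con false :+ (3 :× (t :^ 2) :* con false :+ (:- (t :^ 3) :* con false :+ con false)))) refl t) e) 1≉0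
  cubic∈osculating ∞ ∞ e = ∙≈∙

  ∈base⇒x₀≈0 : ∀ {P} v → P ∈ₗ base v → coords P 0F ≈ 0#
  ∈base⇒x₀≈0 v (a , b , e) = trans (e 0F) (solve 2 (λ a b → a :* con false :+ b :* con false := con false) refl a b)

  U⊆osculating : ∀ t v P → P ∈ₗ U t v → P ∈ₕ osculatingPlane t
  U⊆osculating t v P P∈U = trans (sym (osculating-move t (coords P)))
    (∈base⇒x₀≈0 {P · inverse (move t)} v (∈ₗ-·⁻¹ {P} (base v) (move t) P∈U))

  cubic∈U : ∀ t v → cubic t ∈ₗ U t v
  cubic∈U t v = ∈ₗ-resp-≈ₚ {P₀ · move t} {cubic t} (U t v) (≋-1* (P₀·move t)) (fst∈ₗ (U t v))

  cubic∈U⇒≈ : ∀ s t v → cubic s ∈ₗ U t v → s ≈∙ t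
  cubic∈U⇒≈ s t v s∈U = cubic∈osculating s t (U⊆osculating t v (cubic s) s∈U)

  -- P_s lies on both lines, hence in the osculating plane at P_t, which forces s = t. Applying
  -- `move t` then leaves two lines through P₀ to compare.
  U-injective : ∀ {s t v w} → U s v ≈ₗ U t w → s ≈∙ t × v ≈ w
  U-injective {s} {t} {v} {w} U≈U = s≈t , base-injective
    (≈ₗ-trans {base v} {U t v ·ₗ move t} {base w}
      (≈ₗ-sym {U t v ·ₗ move t} {base v} (·ₗ-inverseʳ (base v) (move t)))
      (≈ₗ-trans {U t v ·ₗ move t} {U t w ·ₗ move t} {base w}
        (·ₗ-cong {U t v} {U t w} (move t)
          (≈ₗ-trans {U t v} {U s v} {U t w} (≈ₗ-sym {U s v} {U t v} (U-cong {s} {t} s≈t refl)) U≈U))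
        (·ₗ-inverseʳ (base w) (move t))))
    where
    s≈t : s ≈∙ t
    s≈t = cubic∈U⇒≈ s t w (≈ₗ⇒⊆ {U s v} {U t w} {cubic s} U≈U (cubic∈U s v))

  -- Tangents, and the UΓ-lines as the lines `U t v`.

  TangentEquations : F⁺ → V₄ → Set _
  TangentEquations [ t ] x = x 1F ≈ t ^ 2 * x 3F × x 0F ≈ t ^ 2 * x 2F
  TangentEquations ∞     x = x 3F ≈ 0# × x 2F ≈ 0#

  tangent⇒equations : ∀ t P → P ∈ₗ tangent t → TangentEquations t (coords P)
  tangent⇒equations [ t ] P (a , b , e) =
    trans (e 1F) (trans (solve 3 (λ t a b → a :* t :^ 2 :+ b :* (2 :× t) := t :^ 2 :* (a :* con true :+ b :* con false)) refl t a b)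
      (*-congˡ (sym (e 3F)))) ,
    trans (e 0F) (trans (solve 3 (λ t a b → a :* t :^ 3 :+ b :* (3 :× (t :^ 2)) := t :^ 2 :* (a :* t :+ b :* con true)) refl t a b)
      (*-congˡ (sym (e 2F))))
  tangent⇒equations ∞ P (a , b , e) =
    trans (e 3F) (solve 2 (λ a b → a :* con false :+ b :* con false := con false) refl a b) ,
    trans (e 2F) (solve 2 (λ a b → a :* con false :+ b :* con false := con false) refl a b)

  U-not-tangent : ∀ t v → ¬ Tangent (U t v)
  U-not-tangent t v (s , U≈s) = not s t
    (tangent⇒equations s (cubic t) (≈ₗ⇒⊆ {U t v} {tangent s} {cubic t} U≈s (cubic∈U t v)))
    (tangent⇒equations s (snd (U t v)) (≈ₗ⇒⊆ {U t v} {tangent s} {snd (U t v)} U≈s (snd∈ₗ (U t v))))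
    where
    -- For finite s and t the second spanning point of `U t v` has x₁ = 1 and x₃ = 0, against x₁ =
    -- s² x₃. If exactly one parameter is ∞, P_t itself violates the equations; if both are, the
    -- second spanning point has x₂ = 1.
    not : ∀ s t → TangentEquations s (coords (cubic t)) → ¬ TangentEquations s (coords (snd (base v)) *ᵥ moveᴹ t)
    not [ s ] [ t ] _ (e , _) = 1≉0 (trans (solve 2 (λ v t →
      con true := con false :* con false :+ (con true :* con true :+ (v :* con false :+ (con false :* t :^ 2 :+ con false)))) refl v t)
      (trans e (solve 2 (λ s v →
        s :^ 2 :* (con false :* con false :+ (con true :* con false :+ (v :* con false :+ (con false :* con true :+ con false)))) := con false) refl s v)))
    not [ s ] ∞ (_ , e) _ = 1≉0 (trans e (zeroʳ _))
    not ∞ [ t ] (e , _) _ = 1≉0 e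
    not ∞ ∞ _ (_ , e) = 1≉0 (trans (solve 1 (λ v →
      con true := con false :* con false :+ (con true :* con true :+ (v :* con false :+ (con false :* con false :+ con false)))) refl v) e)

  -- A point R of the line other than P₀ is normalized. If its x₁ is nonzero, it scales to x₁ = 1
  -- and a multiple of P₀ clears x₃; if x₁ = 0, the line is the tangent. `search` finds R among the
  -- spanning points, which cannot both be P₀.
  pencil : ∀ L → P₀ ∈ₗ L → coords (fst L) 0F ≈ 0# → coords (snd L) 0F ≈ 0# →
           L ≈ₗ tangent [ 0# ] ⊎ ∃ λ v → L ≈ₗ base v
  pencil L P₀∈L x₀≈0 y₀≈0 = search (coords (fst L) 1F ≈? 0#) (coords (fst L) 2F ≈? 0#)
                                   (coords (snd L) 1F ≈? 0#) (coords (snd L) 2F ≈? 0#)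
    where
    Result : Set _
    Result = L ≈ₗ tangent [ 0# ] ⊎ ∃ λ v → L ≈ₗ base v

    throughAffine : ∀ R → R ∈ₗ L → coords R 0F ≈ 0# → ¬ coords R 1F ≈ 0# → Result
    throughAffine R R∈L r₀≈0 r₁≉0 = inj₂ (u * r 2F , ≈ₗ-sym {base (u * r 2F)} {L}
      (∈ₗ⇒≈ₗ (base (u * r 2F)) L P₀∈L (∈ₗ-combination {R} {P₀} {snd (base (u * r 2F))} L u (u * r 3F) R∈L P₀∈L (∀Fin4
        (sym (trans (+-congʳ (*-congˡ r₀≈0)) (solve 2 (λ u x → u :* con false :+ u :* x :* con false := con false) refl u (r 3F))))
        (sym (trans (+-congʳ (⁻¹-inverseˡ r₁≉0)) (solve 2 (λ u x → con true :+ u :* x :* con false := con true) refl u (r 3F))))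
        (solve 3 (λ u x y → u :* x := u :* x :+ u :* y :* con false) refl u (r 2F) (r 3F))
        (solve 2 (λ u x → con false := u :* x :+ u :* x :* con true) refl u (r 3F))))))
      where
      r : V₄
      r = coords R
      u : Carrier
      u = r₁≉0 ⁻¹

    throughTangent : ∀ R → R ∈ₗ L → coords R 0F ≈ 0# → coords R 1F ≈ 0# → ¬ coords R 2F ≈ 0# → Result
    throughTangent R R∈L r₀≈0 r₁≈0 r₂≉0 = inj₁ (≈ₗ-sym {tangent [ 0# ]} {L} (∈ₗ⇒≈ₗ (tangent [ 0# ]) L
      (∈ₗ-resp-≈ₚ {P₀} {cubic [ 0# ]} L P₀≈cubic0 P₀∈L)
      (∈ₗ-combination {R} {P₀} {snd (tangent [ 0# ])} L u (u * r 3F) R∈L P₀∈L (∀Fin4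
        (sym (trans (+-congʳ (*-congˡ r₀≈0)) (solve 2 (λ u x → u :* con false :+ u :* x :* con false := 3 :× (con false :^ 2)) refl u (r 3F))))
        (sym (trans (+-congʳ (*-congˡ r₁≈0)) (solve 2 (λ u x → u :* con false :+ u :* x :* con false := 2 :× (con false)) refl u (r 3F))))
        (sym (trans (+-congʳ (⁻¹-inverseˡ r₂≉0)) (solve 2 (λ u x → con true :+ u :* x :* con false := con true) refl u (r 3F))))
        (solve 2 (λ u x → con false := u :* x :+ u :* x :* con true) refl u (r 3F))))))
      where
      r : V₄
      r = coords R
      u : Carrier
      u = r₂≉0 ⁻¹

    search : Dec (coords (fst L) 1F ≈ 0#) → Dec (coords (fst L) 2F ≈ 0#) →
             Dec (coords (snd L) 1F ≈ 0#) → Dec (coords (snd L) 2F ≈ 0#) → Result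
    search (no x₁≉0) _ _ _ = throughAffine (fst L) (fst∈ₗ L) x₀≈0 x₁≉0
    search (yes x₁≈0) (no x₂≉0) _ _ = throughTangent (fst L) (fst∈ₗ L) x₀≈0 x₁≈0 x₂≉0
    search (yes _) (yes _) (no y₁≉0) _ = throughAffine (snd L) (snd∈ₗ L) y₀≈0 y₁≉0
    search (yes _) (yes _) (yes y₁≈0) (no y₂≉0) = throughTangent (snd L) (snd∈ₗ L) y₀≈0 y₁≈0 y₂≉0
    search (yes x₁≈0) (yes x₂≈0) (yes y₁≈0) (yes y₂≈0) = contradiction
      (proportional (fst L) (snd L) (coords (snd L) 3F) (coords (fst L) 3F) x₃y₃≉0
        (∀Fin4 (both x₀≈0 y₀≈0) (both x₁≈0 y₁≈0) (both x₂≈0 y₂≈0) (*-comm _ _)))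
      (distinct L)
      where
      both : ∀ {x y z w} → x ≈ 0# → y ≈ 0# → z * x ≈ w * y
      both {z = z} {w} x≈0 y≈0 = trans (trans (*-congˡ x≈0) (zeroʳ z)) (sym (trans (*-congˡ y≈0) (zeroʳ w)))
      x₃y₃≉0 : ¬ (coords (snd L) 3F ≈ 0# × coords (fst L) 3F ≈ 0#)
      x₃y₃≉0 (_ , x₃≈0) = notAllZero (fst L) x₀≈0 x₁≈0 x₂≈0 x₃≈0

  tangent-move : ∀ t → tangent [ 0# ] ·ₗ move t ≈ₗ tangent t
  tangent-move [ t ] = ≋⇒≈ₗ {tangent [ 0# ] ·ₗ move [ t ]} {tangent [ t ]}
    (∀Fin4 (first 0F refl) (first 1F refl) (first 2F refl) (first 3F refl))
    (∀Fin4 (second 0F refl) (second 1F refl) (second 2F refl) (second 3F refl))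
    where
    tangentᴾ : ∀ {n} → Polynomial n → PolynomialVector n
    tangentᴾ t = 3 :× (t :^ 2) ∷′ 2 :× t ∷′ con true ∷′ con false ∷′ []′
    first second : ∀ j → _
    first j = prove (t ∷ []) ((cubicᴾ [ con false ] ⊗ moveᴾ [ var 0F ]) j) (cubicᴾ [ var 0F ] j)
    second j = prove (t ∷ []) ((tangentᴾ (con false) ⊗ moveᴾ [ var 0F ]) j) (tangentᴾ (var 0F) j)
  tangent-move ∞ = ≋⇒≈ₗ {tangent [ 0# ] ·ₗ move ∞} {tangent ∞}
    (∀Fin4 (first 0F refl) (first 1F refl) (first 2F refl) (first 3F refl))
    (∀Fin4 (second 0F refl) (second 1F refl) (second 2F refl) (second 3F refl))
    where
    tangentᴾ : PolynomialVector 0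
    tangentᴾ = 3 :× (con false :^ 2) ∷′ 2 :× con false ∷′ con true ∷′ con false ∷′ []′
    first second : ∀ j → _
    first j = prove [] ((cubicᴾ [ con false ] ⊗ moveᴾ ∞) j) (cubicᴾ ∞ j)
    second j = prove [] ((tangentᴾ ⊗ moveᴾ ∞) j) (𝟏 1F j)

  -- The point of the cubic on `L` lies in the osculating plane at P_t, so it is P_t. Then `move t`
  -- places `L` in the pencil at P₀, where the tangent is excluded because `L` is not one.
  UΓ⇒U : ∀ L → UΓ-line L → ∃₂ λ t v → L ≈ₗ U t v
  UΓ⇒U L ((P , ((s , P≈Pₛ) , P∈L) , _) , ¬tangent , t , L⊆osc) =
    result (pencil (L ·ₗ move t) P₀∈Lt (x₀≈0 (fst L) (fst∈ₗ L)) (x₀≈0 (snd L) (snd∈ₗ L)))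
    where
    s∈L : cubic s ∈ₗ L
    s∈L = ∈ₗ-resp-≈ₚ {P} {cubic s} L P≈Pₛ P∈L

    t∈L : cubic t ∈ₗ L
    t∈L = ∈ₗ-resp-≈ₚ {cubic s} {cubic t} L (cubic-cong (cubic∈osculating s t (L⊆osc (cubic s) s∈L))) s∈L

    P₀∈Lt : P₀ ∈ₗ L ·ₗ move t
    P₀∈Lt = ∈ₗ-resp-≈ₚ {cubic t · move t} {P₀} (L ·ₗ move t) (cubic·move t) (∈ₗ-· {cubic t} L (move t) t∈L)

    x₀≈0 : ∀ Q → Q ∈ₗ L → coords (Q · move t) 0F ≈ 0#
    x₀≈0 Q Q∈L = trans (osculating-move t (coords Q)) (L⊆osc Q Q∈L)

    back : ∀ L′ → L ·ₗ move t ≈ₗ L′ → L ≈ₗ L′ ·ₗ move t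
    back L′ e = ≈ₗ-trans {L} {L ·ₗ move t ·ₗ move t} {L′ ·ₗ move t}
      (≈ₗ-sym {L ·ₗ move t ·ₗ move t} {L} (·ₗ-inverseʳ L (move t))) (·ₗ-cong {L ·ₗ move t} {L′} (move t) e)

    result : L ·ₗ move t ≈ₗ tangent [ 0# ] ⊎ (∃ λ v → L ·ₗ move t ≈ₗ base v) → ∃₂ λ t v → L ≈ₗ U t v
    result (inj₁ e) = contradiction (t , ≈ₗ-trans {L} {tangent [ 0# ] ·ₗ move t} {tangent t}
      (back (tangent [ 0# ]) e) (tangent-move t)) ¬tangent
    result (inj₂ (v , e)) = t , v , back (base v) e

  U⇒UΓ : ∀ L t v → L ≈ₗ U t v → UΓ-line L
  U⇒UΓ L t v L≈U =
    ( cubic t , ((t , ∼-refl) , ≈ₗ⇒⊆ {U t v} {L} {cubic t} (≈ₗ-sym {L} {U t v} L≈U) (cubic∈U t v))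
    , λ { Q (s , Q≈Pₛ) Q∈L → ∼-trans Q≈Pₛ (cubic-cong (cubic∈U⇒≈ s t v
          (≈ₗ⇒⊆ {L} {U t v} {cubic s} L≈U (∈ₗ-resp-≈ₚ {Q} {cubic s} L Q≈Pₛ Q∈L)))) } )
    , (λ { (s , L≈s) → U-not-tangent t v (s , ≈ₗ-trans {U t v} {L} {tangent s} (≈ₗ-sym {L} {U t v} L≈U) L≈s) })
    , t , λ P P∈L → U⊆osculating t v P (≈ₗ⇒⊆ {L} {U t v} {P} L≈U P∈L)

  -- The two orbits.

  base-G : ∀ v φ → G φ → ∃ λ t → ∃ λ d → ¬ d ≈ 0# × base v ·ₗ φ ≈ₗ U t (v * d)
  base-G v φ Gφ = result (G-decomposition φ Gφ)
    where
    result : (∃ λ t → ∃₂ λ c d → ¬ d ≈ 0# × matrix φ ∼ᴹ matrix₁ c d *ᴹ moveᴹ t) →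
             ∃ λ t → ∃ λ d → ¬ d ≈ 0# × base v ·ₗ φ ≈ₗ U t (v * d)
    result (t , c , d , d≉0 , φ∼) = t , d , d≉0 ,
      ≈ₗ-trans {base v ·ₗ φ} {base v ·ₗ (borel c d≉0 ⊙ move t)} {U t (v * d)}
        (·ₗ-∼ᴹ (base v) {φ} {borel c d≉0 ⊙ move t} φ∼)
      (≈ₗ-trans {base v ·ₗ (borel c d≉0 ⊙ move t)} {base v ·ₗ borel c d≉0 ·ₗ move t} {U t (v * d)}
        (·ₗ-⊙ (base v) (borel c d≉0) (move t))
        (·ₗ-cong {base v ·ₗ borel c d≉0} {base (v * d)} (move t) (base-borel v c d≉0)))

  -- `line₁` and `base 0#` have the same spanning points, and equality of lines sees only points, so
  -- one may stand for the other. The value v = 0 survives the scaling by `d`.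
  Orbit₁⇔U : ∀ L → Orbit line₁ L ⇔ ∃ λ t → L ≈ₗ U t 0#
  Orbit₁⇔U L = mk⇔ to from
    where
    to : Orbit line₁ L → ∃ λ t → L ≈ₗ U t 0#
    to (φ , Gφ , ℓφ≈L) = result (base-G 0# φ Gφ)
      where
      result : _ → ∃ λ t → L ≈ₗ U t 0#
      result (t , d , _ , e) = t , ≈ₗ-trans {L} {base 0# ·ₗ φ} {U t 0#} (≈ₗ-sym {base 0# ·ₗ φ} {L} ℓφ≈L)
        (≈ₗ-trans {base 0# ·ₗ φ} {U t (0# * d)} {U t 0#} e (U-congʳ t (zeroˡ d)))
    from : (∃ λ t → L ≈ₗ U t 0#) → Orbit line₁ L
    from (t , e) = move t , G-move t , ≈ₗ-sym {L} {U t 0#} e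

  -- Starting from v = 1, the scaling factor `d` is itself the new parameter, and `borel 0# v≉0`
  -- reaches any nonzero v.
  Orbit₂⇔U : ∀ L → Orbit line₂ L ⇔ ∃₂ λ t v → ¬ v ≈ 0# × L ≈ₗ U t v
  Orbit₂⇔U L = mk⇔ to from
    where
    to : Orbit line₂ L → ∃₂ λ t v → ¬ v ≈ 0# × L ≈ₗ U t v
    to (φ , Gφ , ℓφ≈L) = result (base-G 1# φ Gφ)
      where
      result : (∃ λ t → ∃ λ d → ¬ d ≈ 0# × base 1# ·ₗ φ ≈ₗ U t (1# * d)) → ∃₂ λ t v → ¬ v ≈ 0# × L ≈ₗ U t v
      result (t , d , d≉0 , e) = t , d , d≉0 , ≈ₗ-trans {L} {base 1# ·ₗ φ} {U t d} (≈ₗ-sym {base 1# ·ₗ φ} {L} ℓφ≈L)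
        (≈ₗ-trans {base 1# ·ₗ φ} {U t (1# * d)} {U t d} e (U-congʳ t (*-identityˡ d)))
    from : (∃₂ λ t v → ¬ v ≈ 0# × L ≈ₗ U t v) → Orbit line₂ L
    from (t , v , v≉0 , e) = borel 0# v≉0 ⊙ move t , G-⊙ {borel 0# v≉0} {move t} (G-borel 0# v≉0) (G-move t) ,
      ≈ₗ-trans {base 1# ·ₗ (borel 0# v≉0 ⊙ move t)} {base 1# ·ₗ borel 0# v≉0 ·ₗ move t} {L}
        (·ₗ-⊙ (base 1#) (borel 0# v≉0) (move t))
      (≈ₗ-trans {base 1# ·ₗ borel 0# v≉0 ·ₗ move t} {U t v} {L}
        (·ₗ-cong {base 1# ·ₗ borel 0# v≉0} {base v} (move t)
          (≈ₗ-trans {base 1# ·ₗ borel 0# v≉0} {base (1# * v)} {base v} (base-borel 1# 0# v≉0) (base-cong (*-identityˡ v))))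
        (≈ₗ-sym {L} {U t v} e))

  UΓ⇔Orbits : ∀ L → UΓ-line L ⇔ (Orbit line₁ L ⊎ Orbit line₂ L)
  UΓ⇔Orbits L = mk⇔ (λ UΓ → to (UΓ⇒U L UΓ)) from
    where
    to : (∃₂ λ t v → L ≈ₗ U t v) → Orbit line₁ L ⊎ Orbit line₂ L
    to (t , v , e) = cases (v ≈? 0#)
      where
      cases : Dec (v ≈ 0#) → Orbit line₁ L ⊎ Orbit line₂ L
      cases (yes v≈0) = inj₁ (Equivalence.from (Orbit₁⇔U L) (t , ≈ₗ-trans {L} {U t v} {U t 0#} e (U-congʳ t v≈0)))
      cases (no  v≉0) = inj₂ (Equivalence.from (Orbit₂⇔U L) (t , v , v≉0 , e))
    from : Orbit line₁ L ⊎ Orbit line₂ L → UΓ-line L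
    from (inj₁ o) = from₁ (Equivalence.to (Orbit₁⇔U L) o)
      where
      from₁ : (∃ λ t → L ≈ₗ U t 0#) → UΓ-line L
      from₁ (t , e) = U⇒UΓ L t 0# e
    from (inj₂ o) = from₂ (Equivalence.to (Orbit₂⇔U L) o)
      where
      from₂ : (∃₂ λ t v → ¬ v ≈ 0# × L ≈ₗ U t v) → UΓ-line L
      from₂ (t , v , _ , e) = U⇒UΓ L t v e

  Orbits-disjoint : ∀ L → ¬ (Orbit line₁ L × Orbit line₂ L)
  Orbits-disjoint L (o₁ , o₂) = absurd (Equivalence.to (Orbit₁⇔U L) o₁) (Equivalence.to (Orbit₂⇔U L) o₂)
    where
    absurd : (∃ λ t → L ≈ₗ U t 0#) → ¬ (∃₂ λ t v → ¬ v ≈ 0# × L ≈ₗ U t v)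
    absurd (t , e) (s , v , v≉0 , f) = v≉0 (sym (proj₂ (U-injective {t} {s} {0#} {v}
      (≈ₗ-trans {U t 0#} {L} {U s v} (≈ₗ-sym {L} {U t 0#} e) f))))

  -- The hyperbolic quadric and its two rulings.

  equations⇒tangent : ∀ t P → TangentEquations t (coords P) → P ∈ₗ tangent t
  -- In characteristic 2 the second spanning point is (t², 0, 1, 0), so x₃ gives the coefficient of
  -- P_t and x₂ then gives the other.
  equations⇒tangent [ t ] P (x₁≈ , x₀≈) = x 3F , x 2F + t * x 3F , ∀Fin4
    (trans x₀≈ (solve 3 (λ t x y → t :^ 2 :* x := y :* t :^ 3 :+ (x :+ t :* y) :* (3 :× (t :^ 2))) refl t (x 2F) (x 3F)))
    (trans x₁≈ (solve 3 (λ t x y → t :^ 2 :* y := y :* t :^ 2 :+ (x :+ t :* y) :* (2 :× t)) refl t (x 2F) (x 3F)))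
    (solve 3 (λ t x y → x := y :* t :+ (x :+ t :* y) :* con true) refl t (x 2F) (x 3F))
    (solve 3 (λ t x y → y := y :* con true :+ (x :+ t :* y) :* con false) refl t (x 2F) (x 3F))
    where
    x : V₄
    x = coords P
  equations⇒tangent ∞ P (x₃≈0 , x₂≈0) = x 0F , x 1F , ∀Fin4
    (solve 2 (λ x y → x := x :* con true :+ y :* con false) refl (x 0F) (x 1F))
    (solve 2 (λ x y → y := x :* con false :+ y :* con true) refl (x 0F) (x 1F))
    (trans x₂≈0 (solve 2 (λ x y → con false := x :* con false :+ y :* con false) refl (x 0F) (x 1F)))
    (trans x₃≈0 (solve 2 (λ x y → con false := x :* con false :+ y :* con false) refl (x 0F) (x 1F)))
    where
    x : V₄
    x = coords P

  RegulusEquations : F⁺ → V₄ → Set _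
  RegulusEquations [ t ] x = x 0F ≈ t * x 1F × x 2F ≈ t * x 3F
  RegulusEquations ∞     x = x 1F ≈ 0# × x 3F ≈ 0#

  direction : F⁺ → V₄
  direction [ t ] = t  ∷′ 1# ∷′ 0# ∷′ 0# ∷′ []′
  direction ∞     = 0# ∷′ 0# ∷′ 1# ∷′ 0# ∷′ []′

  snd-U : ∀ t → coords (snd (U t 0#)) ≋ direction t
  snd-U [ t ] = ∀Fin4 (entry 0F refl) (entry 1F refl) (entry 2F refl) (entry 3F refl)
    where
    entry : ∀ j → _
    entry j = prove (t ∷ []) ((baseᴾ (con false) ⊗ moveᴾ [ var 0F ]) j)
      ((var 0F ∷′ con true ∷′ con false ∷′ con false ∷′ []′) j)
  snd-U ∞ = ∀Fin4 (entry 0F refl) (entry 1F refl) (entry 2F refl) (entry 3F refl)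
    where
    entry : ∀ j → _
    entry j = prove [] ((baseᴾ (con false) ⊗ moveᴾ ∞) j) (𝟏 2F j)

  U-span : ∀ t a b → (λ i → a * coords (fst (U t 0#)) i + b * coords (snd (U t 0#)) i)
                   ≋ (λ i → a * coords (cubic t) i + b * direction t i)
  U-span t a b i = +-cong (*-congˡ (P₀·move t i)) (*-congˡ (snd-U t i))

  U⇒equations : ∀ t P → P ∈ₗ U t 0# → RegulusEquations t (coords P)
  U⇒equations t P (a , b , e) = equations t (≋-trans e (U-span t a b))
    where
    equations : ∀ t → coords P ≋ (λ i → a * coords (cubic t) i + b * direction t i) → RegulusEquations t (coords P)
    equations [ t ] e =
      trans (e 0F) (trans (solve 3 (λ t a b → a :* t :^ 3 :+ b :* t := t :* (a :* t :^ 2 :+ b :* con true)) refl t a b)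
        (*-congˡ (sym (e 1F)))) ,
      trans (e 2F) (trans (solve 3 (λ t a b → a :* t :+ b :* con false := t :* (a :* con true :+ b :* con false)) refl t a b)
        (*-congˡ (sym (e 3F))))
    equations ∞ e =
      trans (e 1F) (solve 2 (λ a b → a :* con false :+ b :* con false := con false) refl a b) ,
      trans (e 3F) (solve 2 (λ a b → a :* con false :+ b :* con false := con false) refl a b)

  equations⇒U : ∀ t P → RegulusEquations t (coords P) → P ∈ₗ U t 0#
  equations⇒U t P eqs = result (combine t eqs)
    where
    x : V₄
    x = coords P
    result : (∃₂ λ a b → x ≋ (λ i → a * coords (cubic t) i + b * direction t i)) → P ∈ₗ U t 0#
    result (a , b , e) = a , b , ≋-trans e (≋-sym (U-span t a b))
    combine : ∀ t → RegulusEquations t x → ∃₂ λ a b → x ≋ (λ i → a * coords (cubic t) i + b * direction t i)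
    combine [ t ] (x₀≈ , x₂≈) = x 3F , x 1F + t ^ 2 * x 3F , ∀Fin4
      (trans x₀≈ (solve 3 (λ t x y → t :* x := y :* t :^ 3 :+ (x :+ t :^ 2 :* y) :* t) refl t (x 1F) (x 3F)))
      (solve 3 (λ t x y → x := y :* t :^ 2 :+ (x :+ t :^ 2 :* y) :* con true) refl t (x 1F) (x 3F))
      (trans x₂≈ (solve 3 (λ t x y → t :* y := y :* t :+ (x :+ t :^ 2 :* y) :* con false) refl t (x 1F) (x 3F)))
      (solve 3 (λ t x y → y := y :* con true :+ (x :+ t :^ 2 :* y) :* con false) refl t (x 1F) (x 3F))
    combine ∞ (x₁≈0 , x₃≈0) = x 0F , x 2F , ∀Fin4
      (solve 2 (λ x y → x := x :* con true :+ y :* con false) refl (x 0F) (x 2F))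
      (trans x₁≈0 (solve 2 (λ x y → con false := x :* con false :+ y :* con false) refl (x 0F) (x 2F)))
      (solve 2 (λ x y → y := x :* con false :+ y :* con true) refl (x 0F) (x 2F))
      (trans x₃≈0 (solve 2 (λ x y → con false := x :* con false :+ y :* con false) refl (x 0F) (x 2F)))

  -- x ↦ (x₀, x₃, x₁, x₂), which turns x₀x₃ + x₁x₂ into the canonical form.
  quadric : Projectivity
  quadric = record
    { matrix   = λ i j → if does (to i Fin.≟ j) then 1# else 0#
    ; matrix⁻¹ = λ i j → if does (from i Fin.≟ j) then 1# else 0#
    ; inverseʳ = ∀Fin4
        (∀Fin4 (entry to from 0F 0F refl) (entry to from 0F 1F refl) (entry to from 0F 2F refl) (entry to from 0F 3F refl))
        (∀Fin4 (entry to from 1F 0F refl) (entry to from 1F 1F refl) (entry to from 1F 2F refl) (entry to from 1F 3F refl))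
        (∀Fin4 (entry to from 2F 0F refl) (entry to from 2F 1F refl) (entry to from 2F 2F refl) (entry to from 2F 3F refl))
        (∀Fin4 (entry to from 3F 0F refl) (entry to from 3F 1F refl) (entry to from 3F 2F refl) (entry to from 3F 3F refl))
    ; inverseˡ = ∀Fin4
        (∀Fin4 (entry from to 0F 0F refl) (entry from to 0F 1F refl) (entry from to 0F 2F refl) (entry from to 0F 3F refl))
        (∀Fin4 (entry from to 1F 0F refl) (entry from to 1F 1F refl) (entry from to 1F 2F refl) (entry from to 1F 3F refl))
        (∀Fin4 (entry from to 2F 0F refl) (entry from to 2F 1F refl) (entry from to 2F 2F refl) (entry from to 2F 3F refl))
        (∀Fin4 (entry from to 3F 0F refl) (entry from to 3F 1F refl) (entry from to 3F 2F refl) (entry from to 3F 3F refl))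
    }
    where
    to from : Fin 4 → Fin 4
    to   = 0F ∷′ 2F ∷′ 3F ∷′ 1F ∷′ []′
    from = 0F ∷′ 3F ∷′ 1F ∷′ 2F ∷′ []′
    entry : ∀ (f g : Fin 4 → Fin 4) i j → _
    entry f g i j = prove [] ((𝟏 (f i) ⊗ (λ i → 𝟏 (g i))) j) (𝟏 i j)

  form : V₄ → Carrier
  form x = x 0F * x 3F + x 1F * x 2F

  canonical≈form : ∀ P → let y = coords (P · quadric) in y 0F * y 1F + y 2F * y 3F ≈ form (coords P)
  canonical≈form P = solve 4 (λ x₀ x₁ x₂ x₃ →
    (x₀ :* con true :+ (x₁ :* con false :+ (x₂ :* con false :+ (x₃ :* con false :+ con false)))) :*
    (x₀ :* con false :+ (x₁ :* con false :+ (x₂ :* con false :+ (x₃ :* con true :+ con false)))) :+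
    (x₀ :* con false :+ (x₁ :* con true :+ (x₂ :* con false :+ (x₃ :* con false :+ con false)))) :*
    (x₀ :* con false :+ (x₁ :* con false :+ (x₂ :* con true :+ (x₃ :* con false :+ con false))))
    := x₀ :* x₃ :+ x₁ :* x₂) refl (coords P 0F) (coords P 1F) (coords P 2F) (coords P 3F)

  tangentEquations⇒form≈0 : ∀ t x → TangentEquations t x → form x ≈ 0#
  tangentEquations⇒form≈0 [ t ] x (x₁≈ , x₀≈) = trans (+-cong (*-congʳ x₀≈) (*-congʳ x₁≈))
    (solve 3 (λ t x y → t :^ 2 :* x :* y :+ t :^ 2 :* y :* x := con false) refl t (x 2F) (x 3F))
  tangentEquations⇒form≈0 ∞ x (x₃≈0 , x₂≈0) = trans (+-cong (*-congˡ x₃≈0) (*-congˡ x₂≈0))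
    (solve 2 (λ x y → x :* con false :+ y :* con false := con false) refl (x 0F) (x 1F))

  regulusEquations⇒form≈0 : ∀ t x → RegulusEquations t x → form x ≈ 0#
  regulusEquations⇒form≈0 [ t ] x (x₀≈ , x₂≈) = trans (+-cong (*-congʳ x₀≈) (*-congˡ x₂≈))
    (solve 3 (λ t x y → t :* x :* y :+ x :* (t :* y) := con false) refl t (x 1F) (x 3F))
  regulusEquations⇒form≈0 ∞ x (x₁≈0 , x₃≈0) = trans (+-cong (*-congˡ x₃≈0) (*-congʳ x₁≈0))
    (solve 2 (λ x y → x :* con false :+ con false :* y := con false) refl (x 0F) (x 2F))

  -- The Segre map of two projective lines onto the quadric. Tangents have constant ratio u₀ : u₁ =
  -- t² : 1, the lines `U t 0#` constant ratio v₀ : v₁ = t : 1.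
  segre : Carrier → Carrier → Carrier → Carrier → V₄
  segre u₀ u₁ v₀ v₁ = u₀ * v₀ ∷′ u₀ * v₁ ∷′ u₁ * v₀ ∷′ u₁ * v₁ ∷′ []′

  Segre : V₄ → Set _
  Segre x = ∃₂ λ u₀ u₁ → ∃₂ λ v₀ v₁ → x ≋ segre u₀ u₁ v₀ v₁

  -- The coordinates form a singular 2 by 2 matrix, so it has rank one. A nonzero entry is the
  -- pivot: its column serves as u, its row divided by the pivot as v.
  form≈0⇒Segre : ∀ P → form (coords P) ≈ 0# → Segre (coords P)
  form≈0⇒Segre P form≈0 = decompose (proj₁ (nonzero P)) (#⇒≉ (proj₂ (nonzero P)))
    where
    x : V₄
    x = coords P

    x₀x₃≈x₁x₂ : x 0F * x 3F ≈ x 1F * x 2F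
    x₀x₃≈x₁x₂ = x+y≈0⇒x≈y form≈0

    divide : ∀ {y z w v} (y≉0 : ¬ y ≈ 0#) → y * v ≈ z * w → v ≈ w * (y≉0 ⁻¹ * z)
    divide {y} {z} {w} {v} y≉0 e = begin
      v                       ≈⟨ *-identityˡ v ⟨
      1# * v                  ≈⟨ *-congʳ (⁻¹-inverseˡ y≉0) ⟨
      y≉0 ⁻¹ * y * v          ≈⟨ *-assoc _ _ _ ⟩
      y≉0 ⁻¹ * (y * v)        ≈⟨ *-congˡ e ⟩
      y≉0 ⁻¹ * (z * w)        ≈⟨ solve 3 (λ u z w → u :* (z :* w) := w :* (u :* z)) refl (y≉0 ⁻¹) z w ⟩
      w * (y≉0 ⁻¹ * z)        ∎
      where open ≈-Reasoning setoid

    decompose : ∀ i → ¬ x i ≈ 0# → Segre x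
    decompose 0F x₀≉0 = x 0F , x 2F , 1# , x₀≉0 ⁻¹ * x 1F , ∀Fin4
      (sym (*-identityʳ _)) (divide x₀≉0 (*-comm _ _)) (sym (*-identityʳ _)) (divide x₀≉0 x₀x₃≈x₁x₂)
    decompose 1F x₁≉0 = x 1F , x 3F , x₁≉0 ⁻¹ * x 0F , 1# , ∀Fin4
      (divide x₁≉0 (*-comm _ _)) (sym (*-identityʳ _)) (divide x₁≉0 (sym x₀x₃≈x₁x₂)) (sym (*-identityʳ _))
    decompose 2F x₂≉0 = x 0F , x 2F , 1# , x₂≉0 ⁻¹ * x 3F , ∀Fin4
      (sym (*-identityʳ _)) (divide x₂≉0 (trans (*-comm _ _) (trans (sym x₀x₃≈x₁x₂) (*-comm _ _))))
      (sym (*-identityʳ _)) (divide x₂≉0 (*-comm _ _))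
    decompose 3F x₃≉0 = x 1F , x 3F , x₃≉0 ⁻¹ * x 2F , 1# , ∀Fin4
      (divide x₃≉0 (trans (*-comm _ _) (trans x₀x₃≈x₁x₂ (*-comm _ _)))) (sym (*-identityʳ _))
      (divide x₃≉0 (*-comm _ _)) (sym (*-identityʳ _))

  ^2-injective : ∀ {x y} → x ^ 2 ≈ y ^ 2 → x ≈ y
  ^2-injective {x} {y} x²≈y² = x+y≈0⇒x≈y (x^n≈0⇒x≈0 2
    (trans (solve 2 (λ x y → (x :+ y) :^ 2 := x :^ 2 :+ y :^ 2) refl x y) (x≈y⇒x+y≈0 x²≈y²)))

  -- Squaring is additive in characteristic 2 and has trivial kernel; being injective on a finite
  -- field, it is onto.
  sqrt : ∀ x → ∃ λ y → y ^ 2 ≈ x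
  sqrt = selfInjective⇒surjective (^-congˡ 2) ^2-injective

  -- The second alternative is the ratio ∞.
  ratio : ∀ {u₀ u₁ w₀ w₁} → ¬ (u₀ ≈ 0# × u₁ ≈ 0#) → u₀ * w₁ + u₁ * w₀ ≈ 0# →
          (∃ λ r → u₀ ≈ r * u₁ × w₀ ≈ r * w₁) ⊎ (u₁ ≈ 0# × w₁ ≈ 0#)
  ratio {u₀} {u₁} {w₀} {w₁} u≉0 det≈0 = cases (u₁ ≈? 0#)
    where
    cases : Dec (u₁ ≈ 0#) → _
    cases (yes u₁≈0) = inj₂ (u₁≈0 , integral (λ u₀≈0 → u≉0 (u₀≈0 , u₁≈0))
      (trans (sym (trans (+-congˡ (trans (*-congʳ u₁≈0) (zeroˡ _))) (+-identityʳ _))) det≈0))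
    cases (no u₁≉0) = inj₁ (u₁≉0 ⁻¹ * u₀ ,
      trans (sym (trans (*-congʳ (⁻¹-inverseˡ u₁≉0)) (*-identityˡ u₀)))
        (solve 3 (λ u x y → u :* y :* x := u :* x :* y) refl (u₁≉0 ⁻¹) u₀ u₁) ,
      trans (sym (trans (*-congʳ (⁻¹-inverseˡ u₁≉0)) (*-identityˡ w₀)))
        (trans (*-assoc _ _ _) (trans (*-congˡ (sym (x+y≈0⇒x≈y det≈0))) (sym (*-assoc _ _ _)))))

  -- For points on the quadric the form at their sum is the polar form, which in Segre coordinates
  -- is the product of the determinants of the two u-pairs and of the two v-pairs. One factor
  -- vanishes, so the points agree in one ratio and share a line of that ruling.
  isotropic⇒ruling : ∀ P Q → form (coords P) ≈ 0# → form (coords Q) ≈ 0# →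
    form (λ i → coords P i + coords Q i) ≈ 0# →
    (∃ λ t → TangentEquations t (coords P) × TangentEquations t (coords Q)) ⊎
    (∃ λ t → RegulusEquations t (coords P) × RegulusEquations t (coords Q))
  isotropic⇒ruling P Q P≈0 Q≈0 P+Q≈0 = result (form≈0⇒Segre P P≈0) (form≈0⇒Segre Q Q≈0)
    where
    result : Segre (coords P) → Segre (coords Q) → _
    result (u₀ , u₁ , v₀ , v₁ , e) (w₀ , w₁ , z₀ , z₁ , f) = cases (u₀ * w₁ + u₁ * w₀ ≈? 0#)
      where
      dets≈0 : (u₀ * w₁ + u₁ * w₀) * (v₀ * z₁ + v₁ * z₀) ≈ 0#
      dets≈0 = trans (solve 8 (λ u₀ u₁ v₀ v₁ w₀ w₁ z₀ z₁ →
          (u₀ :* w₁ :+ u₁ :* w₀) :* (v₀ :* z₁ :+ v₁ :* z₀) :=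
          (u₀ :* v₀ :+ w₀ :* z₀) :* (u₁ :* v₁ :+ w₁ :* z₁) :+ (u₀ :* v₁ :+ w₀ :* z₁) :* (u₁ :* v₀ :+ w₁ :* z₀))
          refl u₀ u₁ v₀ v₁ w₀ w₁ z₀ z₁)
        (trans (sym (+-cong (*-cong (+-cong (e 0F) (f 0F)) (+-cong (e 3F) (f 3F)))
                            (*-cong (+-cong (e 1F) (f 1F)) (+-cong (e 2F) (f 2F))))) P+Q≈0)

      u≉0 : ¬ (u₀ ≈ 0# × u₁ ≈ 0#)
      u≉0 (u₀≈0 , u₁≈0) = notAllZero P
        (trans (e 0F) (trans (*-congʳ u₀≈0) (zeroˡ _))) (trans (e 1F) (trans (*-congʳ u₀≈0) (zeroˡ _)))
        (trans (e 2F) (trans (*-congʳ u₁≈0) (zeroˡ _))) (trans (e 3F) (trans (*-congʳ u₁≈0) (zeroˡ _)))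

      v≉0 : ¬ (v₀ ≈ 0# × v₁ ≈ 0#)
      v≉0 (v₀≈0 , v₁≈0) = notAllZero P
        (trans (e 0F) (trans (*-congˡ v₀≈0) (zeroʳ _))) (trans (e 1F) (trans (*-congˡ v₁≈0) (zeroʳ _)))
        (trans (e 2F) (trans (*-congˡ v₀≈0) (zeroʳ _))) (trans (e 3F) (trans (*-congˡ v₁≈0) (zeroʳ _)))

      tangentRatio : ∀ {x a₀ a₁ b₀ b₁ r t} → x ≋ segre a₀ a₁ b₀ b₁ → t ^ 2 ≈ r → a₀ ≈ r * a₁ → TangentEquations [ t ] x
      tangentRatio e t²≈r a≈ =
        trans (e 1F) (trans (*-congʳ (trans a≈ (*-congʳ (sym t²≈r)))) (trans (*-assoc _ _ _) (*-congˡ (sym (e 3F))))) ,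
        trans (e 0F) (trans (*-congʳ (trans a≈ (*-congʳ (sym t²≈r)))) (trans (*-assoc _ _ _) (*-congˡ (sym (e 2F)))))

      tangent∞ : ∀ {x a₀ a₁ b₀ b₁} → x ≋ segre a₀ a₁ b₀ b₁ → a₁ ≈ 0# → TangentEquations ∞ x
      tangent∞ e a₁≈0 = trans (e 3F) (trans (*-congʳ a₁≈0) (zeroˡ _)) , trans (e 2F) (trans (*-congʳ a₁≈0) (zeroˡ _))

      regulusRatio : ∀ {x a₀ a₁ b₀ b₁ r} → x ≋ segre a₀ a₁ b₀ b₁ → b₀ ≈ r * b₁ → RegulusEquations [ r ] x
      regulusRatio {a₀ = a₀} {a₁} {b₁ = b₁} {r} e b≈ =
        trans (e 0F) (trans (*-congˡ b≈) (trans (solve 3 (λ a r b → a :* (r :* b) := r :* (a :* b)) refl a₀ r b₁) (*-congˡ (sym (e 1F))))) ,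
        trans (e 2F) (trans (*-congˡ b≈) (trans (solve 3 (λ a r b → a :* (r :* b) := r :* (a :* b)) refl a₁ r b₁) (*-congˡ (sym (e 3F)))))

      regulus∞ : ∀ {x a₀ a₁ b₀ b₁} → x ≋ segre a₀ a₁ b₀ b₁ → b₁ ≈ 0# → RegulusEquations ∞ x
      regulus∞ e b₁≈0 = trans (e 1F) (trans (*-congˡ b₁≈0) (zeroʳ _)) , trans (e 3F) (trans (*-congˡ b₁≈0) (zeroʳ _))

      tangents : (∃ λ r → u₀ ≈ r * u₁ × w₀ ≈ r * w₁) ⊎ (u₁ ≈ 0# × w₁ ≈ 0#) →
        ∃ λ t → TangentEquations t (coords P) × TangentEquations t (coords Q)
      -- The ratio r belongs to the tangent with t² = r.
      tangents (inj₁ (r , u≈ , w≈)) = [ proj₁ (sqrt r) ] ,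
        tangentRatio e (proj₂ (sqrt r)) u≈ , tangentRatio f (proj₂ (sqrt r)) w≈
      tangents (inj₂ (u₁≈0 , w₁≈0)) = ∞ , tangent∞ e u₁≈0 , tangent∞ f w₁≈0

      reguli : (∃ λ r → v₀ ≈ r * v₁ × z₀ ≈ r * z₁) ⊎ (v₁ ≈ 0# × z₁ ≈ 0#) →
        ∃ λ t → RegulusEquations t (coords P) × RegulusEquations t (coords Q)
      reguli (inj₁ (r , v≈ , z≈)) = [ r ] , regulusRatio e v≈ , regulusRatio f z≈
      reguli (inj₂ (v₁≈0 , z₁≈0)) = ∞ , regulus∞ e v₁≈0 , regulus∞ f z₁≈0

      cases : Dec (u₀ * w₁ + u₁ * w₀ ≈ 0#) → _
      cases (yes det≈0) = inj₁ (tangents (ratio u≉0 det≈0))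
      cases (no  det≉0) = inj₂ (reguli (ratio v≉0 (integral det≉0 dets≈0)))

  -- The third point at which a line is tested against the quadric; its vector is nonzero because
  -- equal spanning vectors would give equal points.
  sumPoint : ∀ L → ∃ λ P → P ∈ₗ L × coords P ≋ (λ i → coords (fst L) i + coords (snd L) i)
  sumPoint L = ⟨ x+y ∣ proj₁ nonzeroSum , ≉⇒# (proj₂ nonzeroSum) ⟩ ,
    (1# , 1# , λ i → sym (+-cong (*-identityˡ _) (*-identityˡ _))) , ≋-refl
    where
    x+y : V₄
    x+y i = coords (fst L) i + coords (snd L) i
    nonzeroSum : ∃ λ i → ¬ x+y i ≈ 0#
    nonzeroSum = Fin.¬∀⟶∃¬ 4 _ (λ i → x+y i ≈? 0#) λ x+y≈0 → distinct L (≋-1* λ i → x+y≈0⇒x≈y (x+y≈0 i))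

  ⊆quadric⇒ruling : ∀ L → (∀ P → P ∈ₗ L → HyperbolicQuadric quadric P) → Tangent L ⊎ Orbit line₁ L
  ⊆quadric⇒ruling L L⊆quadric = result (isotropic⇒ruling (fst L) (snd L)
      (onLine (fst L) (fst∈ₗ L)) (onLine (snd L) (snd∈ₗ L)) (atSum (sumPoint L)))
    where
    onLine : ∀ P → P ∈ₗ L → form (coords P) ≈ 0#
    onLine P P∈L = trans (sym (canonical≈form P)) (L⊆quadric P P∈L)

    atSum : (∃ λ P → P ∈ₗ L × coords P ≋ (λ i → coords (fst L) i + coords (snd L) i)) →
            form (λ i → coords (fst L) i + coords (snd L) i) ≈ 0#
    atSum (P , P∈L , e) = trans (sym (+-cong (*-cong (e 0F) (e 3F)) (*-cong (e 1F) (e 2F)))) (onLine P P∈L)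

    result : _ → Tangent L ⊎ Orbit line₁ L
    result (inj₁ (t , x , y)) = inj₁ (t , ∈ₗ⇒≈ₗ L (tangent t)
      (equations⇒tangent t (fst L) x) (equations⇒tangent t (snd L) y))
    result (inj₂ (t , x , y)) = inj₂ (Equivalence.from (Orbit₁⇔U L) (t , ∈ₗ⇒≈ₗ L (U t 0#)
      (equations⇒U t (fst L) x) (equations⇒U t (snd L) y)))

  ruling⇒⊆quadric : ∀ L → Tangent L ⊎ Orbit line₁ L → ∀ P → P ∈ₗ L → HyperbolicQuadric quadric P
  ruling⇒⊆quadric L (inj₁ (t , L≈t)) P P∈L = trans (canonical≈form P) (tangentEquations⇒form≈0 t (coords P)
    (tangent⇒equations t P (≈ₗ⇒⊆ {L} {tangent t} {P} L≈t P∈L)))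
  ruling⇒⊆quadric L (inj₂ o) P P∈L = result (Equivalence.to (Orbit₁⇔U L) o)
    where
    result : (∃ λ t → L ≈ₗ U t 0#) → HyperbolicQuadric quadric P
    result (t , L≈U) = trans (canonical≈form P) (regulusEquations⇒form≈0 t (coords P)
      (U⇒equations t P (≈ₗ⇒⊆ {L} {U t 0#} {P} L≈U P∈L)))

  r*x≈s*x : ∀ {r s x} → r * x ≈ s * x → ¬ r ≈ s → x ≈ 0#
  r*x≈s*x {r} {s} {x} e r≉s = integral (λ r+s≈0 → r≉s (x+y≈0⇒x≈y r+s≈0)) (trans (distribʳ x r s) (x≈y⇒x+y≈0 e))

  r*0≈0 : ∀ {x r y} → x ≈ r * y → y ≈ 0# → x ≈ 0#
  r*0≈0 x≈ry y≈0 = trans x≈ry (trans (*-congˡ y≈0) (zeroʳ _))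

  -- If s and t are finite and differ, so do their squares, and comparing the equations kills x₂ and
  -- x₃, and with them x₀ and x₁.
  tangentEquations-injective : ∀ s t P → TangentEquations s (coords P) → TangentEquations t (coords P) → s ≈∙ t
  tangentEquations-injective [ s ] [ t ] P (e , f) (g , h) = cases (s ≈? t)
    where
    cases : Dec (s ≈ t) → [ s ] ≈∙ [ t ]
    cases (yes s≈t) = [ s≈t ]
    cases (no  s≉t) = contradiction x₃≈0 (notAllZero P (r*0≈0 f x₂≈0) (r*0≈0 e x₃≈0) x₂≈0)
      where
      s²≉t² : ¬ s ^ 2 ≈ t ^ 2
      s²≉t² = s≉t ∘ ^2-injective
      x₃≈0 : coords P 3F ≈ 0#
      x₃≈0 = r*x≈s*x (trans (sym e) g) s²≉t²
      x₂≈0 : coords P 2F ≈ 0#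
      x₂≈0 = r*x≈s*x (trans (sym f) h) s²≉t²
  tangentEquations-injective [ s ] ∞ P (e , f) (x₃≈0 , x₂≈0) =
    contradiction x₃≈0 (notAllZero P (r*0≈0 f x₂≈0) (r*0≈0 e x₃≈0) x₂≈0)
  tangentEquations-injective ∞ [ t ] P (x₃≈0 , x₂≈0) (e , f) =
    contradiction x₃≈0 (notAllZero P (r*0≈0 f x₂≈0) (r*0≈0 e x₃≈0) x₂≈0)
  tangentEquations-injective ∞ ∞ P _ _ = ∙≈∙

  regulusEquations-injective : ∀ s t P → RegulusEquations s (coords P) → RegulusEquations t (coords P) → s ≈∙ t
  regulusEquations-injective [ s ] [ t ] P (e , f) (g , h) = cases (s ≈? t)
    where
    cases : Dec (s ≈ t) → [ s ] ≈∙ [ t ]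
    cases (yes s≈t) = [ s≈t ]
    cases (no  s≉t) = contradiction x₃≈0 (notAllZero P (r*0≈0 e x₁≈0) x₁≈0 (r*0≈0 f x₃≈0))
      where
      x₁≈0 : coords P 1F ≈ 0#
      x₁≈0 = r*x≈s*x (trans (sym e) g) s≉t
      x₃≈0 : coords P 3F ≈ 0#
      x₃≈0 = r*x≈s*x (trans (sym f) h) s≉t
  regulusEquations-injective [ s ] ∞ P (e , f) (x₁≈0 , x₃≈0) =
    contradiction x₃≈0 (notAllZero P (r*0≈0 e x₁≈0) x₁≈0 (r*0≈0 f x₃≈0))
  regulusEquations-injective ∞ [ t ] P (x₁≈0 , x₃≈0) (e , f) =
    contradiction x₃≈0 (notAllZero P (r*0≈0 e x₁≈0) x₁≈0 (r*0≈0 f x₃≈0))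
  regulusEquations-injective ∞ ∞ P _ _ = ∙≈∙

  tangent-cong : ∀ {s t} → s ≈∙ t → tangent s ≈ₗ tangent t
  tangent-cong {s} {t} s≈t P = mk⇔ (half s t s≈t) (half t s (PointedEquality.≈∙-sym _≈_ sym s≈t))
    where
    cong : ∀ {s t} → s ≈∙ t → TangentEquations s (coords P) → TangentEquations t (coords P)
    cong [ s≈t ] (e , f) = trans e (*-congʳ (^-congˡ 2 s≈t)) , trans f (*-congʳ (^-congˡ 2 s≈t))
    cong ∙≈∙     e       = e
    half : ∀ s t → s ≈∙ t → P ∈ₗ tangent s → P ∈ₗ tangent t
    half s t s≈t P∈s = equations⇒tangent t P (cong s≈t (tangent⇒equations s P P∈s))

  tangents-skew : PairwiseSkew Tangent
  tangents-skew {L} {L′} (s , L≈s) (t , L′≈t) L≉L′ (P , P∈L , P∈L′) = L≉L′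
    (≈ₗ-trans {L} {tangent s} {L′} L≈s (≈ₗ-trans {tangent s} {tangent t} {L′}
      (tangent-cong (tangentEquations-injective s t P
        (tangent⇒equations s P (≈ₗ⇒⊆ {L} {tangent s} {P} L≈s P∈L))
        (tangent⇒equations t P (≈ₗ⇒⊆ {L′} {tangent t} {P} L′≈t P∈L′))))
      (≈ₗ-sym {L′} {tangent t} L′≈t)))

  Orbit₁-skew : PairwiseSkew (Orbit line₁)
  Orbit₁-skew {L} {L′} o o′ L≉L′ (P , P∈L , P∈L′) = absurd (Equivalence.to (Orbit₁⇔U L) o) (Equivalence.to (Orbit₁⇔U L′) o′)
    where
    absurd : (∃ λ s → L ≈ₗ U s 0#) → ¬ (∃ λ t → L′ ≈ₗ U t 0#)
    absurd (s , L≈s) (t , L′≈t) = L≉L′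
      (≈ₗ-trans {L} {U s 0#} {L′} L≈s (≈ₗ-trans {U s 0#} {U t 0#} {L′}
        (U-cong (regulusEquations-injective s t P
          (U⇒equations s P (≈ₗ⇒⊆ {L} {U s 0#} {P} L≈s P∈L))
          (U⇒equations t P (≈ₗ⇒⊆ {L′} {U t 0#} {P} L′≈t P∈L′))) refl)
        (≈ₗ-sym {L′} {U t 0#} L′≈t)))

  -- The Segre image of (s², 1) and (t, 1), each replaced by (1, 0) when its parameter is ∞.
  intersection : ∀ s t → ∃ λ P → TangentEquations s (coords P) × RegulusEquations t (coords P)
  intersection [ s ] [ t ] = ⟨ s ^ 2 * t ∷′ s ^ 2 ∷′ t ∷′ 1# ∷′ []′ ∣ 3F , 1#0 ⟩ ,
    (sym (*-identityʳ _) , refl) , (*-comm _ _ , sym (*-identityʳ _))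
  intersection [ s ] ∞ = ⟨ s ^ 2 ∷′ 0# ∷′ 1# ∷′ 0# ∷′ []′ ∣ 2F , 1#0 ⟩ ,
    (sym (zeroʳ _) , sym (*-identityʳ _)) , (refl , refl)
  intersection ∞ [ t ] = ⟨ t ∷′ 1# ∷′ 0# ∷′ 0# ∷′ []′ ∣ 1F , 1#0 ⟩ ,
    (refl , refl) , (sym (*-identityʳ _) , sym (zeroʳ _))
  intersection ∞ ∞ = ⟨ 1# ∷′ 0# ∷′ 0# ∷′ 0# ∷′ []′ ∣ 0F , 1#0 ⟩ , (refl , refl) , (refl , refl)

  tangent-meets-Orbit₁ : ∀ {L L′} → Tangent L → Orbit line₁ L′ → Meet L L′
  tangent-meets-Orbit₁ {L} {L′} (s , L≈s) o = result (Equivalence.to (Orbit₁⇔U L′) o)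
    where
    result : (∃ λ t → L′ ≈ₗ U t 0#) → Meet L L′
    result (t , L′≈t) = meet (intersection s t)
      where
      meet : (∃ λ P → TangentEquations s (coords P) × RegulusEquations t (coords P)) → Meet L L′
      meet (P , x , y) = P ,
        ≈ₗ⇒⊆ {tangent s} {L} {P} (≈ₗ-sym {L} {tangent s} L≈s) (equations⇒tangent s P x) ,
        ≈ₗ⇒⊆ {U t 0#} {L′} {P} (≈ₗ-sym {L′} {U t 0#} L′≈t) (equations⇒U t P y)

  tangents-Orbit₁-complementary : ComplementaryReguli Tangent (Orbit line₁)
  tangents-Orbit₁-complementary = record
    { quadric    = quadric
    ; generators = λ L → mk⇔ (⊆quadric⇒ruling L) (ruling⇒⊆quadric L)
    ; skew       = λ {L} {L′} → tangents-skew {L} {L′}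
    ; skew′      = λ {L} {L′} → Orbit₁-skew {L} {L′}
    ; opposite   = λ {L} {L′} → tangent-meets-Orbit₁ {L} {L′}
    }

  -- Stabilizers of the two representatives.

  -- The image of P₀ lies on the cubic and on `base v`, hence in x₀ = 0; there t³ = 0 leaves only
  -- P₀.
  stabilizer⇒fixes-P₀ : ∀ v φ → G φ → base v ·ₗ φ ≈ₗ base v → P₀ · φ ≈ₚ P₀
  stabilizer⇒fixes-P₀ v φ Gφ vφ≈v = result (Equivalence.to (Gφ P₀) ([ 0# ] , P₀≈cubic0))
    where
    P₀φ∈v : P₀ · φ ∈ₗ base v
    P₀φ∈v = ≈ₗ⇒⊆ {base v ·ₗ φ} {base v} {P₀ · φ} vφ≈v (fst∈ₗ (base v ·ₗ φ))

    result : OnCubic (P₀ · φ) → P₀ · φ ≈ₚ P₀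
    result (t , P₀φ≈Pₜ) = at t P₀φ≈Pₜ
      (∈base⇒x₀≈0 {cubic t} v (∈ₗ-resp-≈ₚ {P₀ · φ} {cubic t} (base v) P₀φ≈Pₜ P₀φ∈v))
      where
      at : ∀ t → P₀ · φ ≈ₚ cubic t → coords (cubic t) 0F ≈ 0# → P₀ · φ ≈ₚ P₀
      at [ t ] P₀φ≈Pₜ t³≈0 = ∼-trans P₀φ≈Pₜ (∼-trans (cubic-cong [ x^n≈0⇒x≈0 3 t³≈0 ]) (∼-sym P₀≈cubic0))
      at ∞     P₀φ≈P∞ 1≈0  = contradiction 1≈0 1≉0

  -- As `base v` goes to `base (v * d)`, stabilizing it means v d = v: no condition for v = 0, and d
  -- = 1 for v = 1.
  stabilizer⇒matrix₁ : ∀ v φ → G φ → base v ·ₗ φ ≈ₗ base v →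
    ∃₂ λ c d → ¬ d ≈ 0# × v * d ≈ v × matrix φ ∼ᴹ matrix₁ c d
  stabilizer⇒matrix₁ v φ Gφ vφ≈v = result (fixes-P₀⇒matrix₁ φ Gφ (stabilizer⇒fixes-P₀ v φ Gφ vφ≈v))
    where
    result : (∃₂ λ c d → ¬ d ≈ 0# × matrix φ ∼ᴹ matrix₁ c d) →
             ∃₂ λ c d → ¬ d ≈ 0# × v * d ≈ v × matrix φ ∼ᴹ matrix₁ c d
    result (c , d , d≉0 , φ∼) = c , d , d≉0 , base-injective
      (≈ₗ-trans {base (v * d)} {base v ·ₗ borel c d≉0} {base v}
        (≈ₗ-sym {base v ·ₗ borel c d≉0} {base (v * d)} (base-borel v c d≉0))
        (≈ₗ-trans {base v ·ₗ borel c d≉0} {base v ·ₗ φ} {base v}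
          (≈ₗ-sym {base v ·ₗ φ} {base v ·ₗ borel c d≉0} (·ₗ-∼ᴹ (base v) {φ} {borel c d≉0} φ∼)) vφ≈v)) , φ∼

  Stabilizer₁-matrix : ∀ φ → Stabilizer line₁ φ → ∃₂ λ c d → d # 0# × matrix φ ∼ᴹ matrix₁ c d
  Stabilizer₁-matrix φ (Gφ , fixes) = result (stabilizer⇒matrix₁ 0# φ Gφ fixes)
    where
    result : (∃₂ λ c d → ¬ d ≈ 0# × 0# * d ≈ 0# × matrix φ ∼ᴹ matrix₁ c d) →
             ∃₂ λ c d → d # 0# × matrix φ ∼ᴹ matrix₁ c d
    result (c , d , d≉0 , _ , φ∼) = c , d , ≉⇒# d≉0 , φ∼

  matrix₁-1≋matrix₂ : ∀ c i → matrix₁ c 1# i ≋ matrix₂ c i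
  matrix₁-1≋matrix₂ c = ∀Fin4 ≋-refl
    (∀Fin4 refl refl refl (*-identityʳ _))
    (∀Fin4 refl refl (solve 0 (con true :^ 2 := con true) refl) (solve 1 (λ c → c :* con true :^ 2 := c) refl c))
    (∀Fin4 refl refl refl (solve 0 (con true :^ 3 := con true) refl))

  Stabilizer₂-matrix₁ : ∀ φ → Stabilizer line₂ φ → ∃ λ c → matrix φ ∼ᴹ matrix₁ c 1#
  Stabilizer₂-matrix₁ φ (Gφ , fixes) = result (stabilizer⇒matrix₁ 1# φ Gφ fixes)
    where
    result : (∃₂ λ c d → ¬ d ≈ 0# × 1# * d ≈ 1# × matrix φ ∼ᴹ matrix₁ c d) → ∃ λ c → matrix φ ∼ᴹ matrix₁ c 1#
    result (c , d , _ , 1d≈1 , φ∼) = c , ∼ᴹ-trans {matrix φ} {matrix₁ c d} {matrix₁ c 1#} φ∼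
      (≋⇒∼ᴹ (matrix₁-cong refl (trans (sym (*-identityˡ d)) 1d≈1)))

  Stabilizer₂-matrix : ∀ φ → Stabilizer line₂ φ → ∃ λ c → matrix φ ∼ᴹ matrix₂ c
  Stabilizer₂-matrix φ s = result (Stabilizer₂-matrix₁ φ s)
    where
    result : (∃ λ c → matrix φ ∼ᴹ matrix₁ c 1#) → ∃ λ c → matrix φ ∼ᴹ matrix₂ c
    result (c , φ∼) = c , ∼ᴹ-trans {matrix φ} {matrix₁ c 1#} {matrix₂ c} φ∼ (≋⇒∼ᴹ (matrix₁-1≋matrix₂ c))

  -- The corner entry 1 on both sides fixes the projective scalar, after which `c` and `d` can be
  -- read off as entries.
  matrix₁-injective : ∀ {c d c′ d′} → matrix₁ c d ∼ᴹ matrix₁ c′ d′ → c ≈ c′ × d ≈ d′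
  matrix₁-injective (k , _ , e) = unscale (e 0F 1F) , unscale (e 1F 1F)
    where
    k≈1 : k ≈ 1#
    k≈1 = sym (trans (e 0F 0F) (*-identityʳ k))
    unscale : ∀ {x y} → x ≈ k * y → x ≈ y
    unscale x≈ky = trans x≈ky (trans (*-congʳ k≈1) (*-identityˡ _))

  -- Sizes of the orbits and stabilizers.

  F⁺ₛ Fˣₛ : Setoid _ _
  F⁺ₛ = pointedSetoid setoid
  Fˣₛ = SubsetSetoid setoid (λ x → ¬ x ≈ 0#)

  Orbit₁-size : HasSize (SubsetSetoid lineSetoid (Orbit line₁)) (q ℕ.+ 1)
  Orbit₁-size = HasSize-transfer F⁺ₛ (SubsetSetoid lineSetoid (Orbit line₁))
    (λ t → U t 0# , Equivalence.from (Orbit₁⇔U (U t 0#)) (t , ≈ₗ-refl {U t 0#}))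
    (λ {s} {t} s≈t → U-cong {s} {t} s≈t refl)
    (λ {s} {t} e → proj₁ (U-injective {s} {t} {0#} {0#} e))
    (λ { (L , o) → surjective L (Equivalence.to (Orbit₁⇔U L) o) })
    (HasSize-pointed setoid size)
    where
    surjective : ∀ L → (∃ λ t → L ≈ₗ U t 0#) → ∃ λ t → U t 0# ≈ₗ L
    surjective L (t , e) = t , ≈ₗ-sym {L} {U t 0#} e

  -- The coordinates are a parameter t, possibly ∞, and a nonzero v, so there are (q + 1)(q - 1)
  -- lines.
  Orbit₂-size : HasSize (SubsetSetoid lineSetoid (Orbit line₂)) (q ℕ.^ 2 ∸ 1)
  Orbit₂-size = ≡.subst (HasSize (SubsetSetoid lineSetoid (Orbit line₂))) ([n+1]*[n∸1]≡n²∸1 q)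
    (HasSize-transfer (F⁺ₛ ×ₛ Fˣₛ) (SubsetSetoid lineSetoid (Orbit line₂))
      (λ { (t , v , v≉0) → U t v , Equivalence.from (Orbit₂⇔U (U t v)) (t , v , v≉0 , ≈ₗ-refl {U t v}) })
      (λ { {s , v , _} {t , w , _} (s≈t , v≈w) → U-cong {s} {t} {v} {w} s≈t v≈w })
      (λ { {s , v , _} {t , w , _} e → U-injective {s} {t} {v} {w} e })
      (λ { (L , o) → surjective L (Equivalence.to (Orbit₂⇔U L) o) })
      (HasSize-× F⁺ₛ Fˣₛ (HasSize-pointed setoid size) (HasSize-remove setoid 0# size)))
    where
    surjective : ∀ L → (∃₂ λ t v → ¬ v ≈ 0# × L ≈ₗ U t v) →
      ∃ λ (x : Setoid.Carrier (F⁺ₛ ×ₛ Fˣₛ)) → U (proj₁ x) (proj₁ (proj₂ x)) ≈ₗ L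
    surjective L (t , v , v≉0 , e) = (t , v , v≉0) , ≈ₗ-sym {L} {U t v} e

  borel-stabilizes : ∀ v c {d} (d≉0 : ¬ d ≈ 0#) → v * d ≈ v → base v ·ₗ borel c d≉0 ≈ₗ base v
  borel-stabilizes v c {d} d≉0 vd≈v = ≈ₗ-trans {base v ·ₗ borel c d≉0} {base (v * d)} {base v}
    (base-borel v c d≉0) (base-cong vd≈v)

  Stabilizer₁-size : HasSize (SubsetSetoid projectivitySetoid (Stabilizer line₁)) (q ℕ.* (q ∸ 1))
  Stabilizer₁-size = HasSize-transfer (setoid ×ₛ Fˣₛ) (SubsetSetoid projectivitySetoid (Stabilizer line₁))
    (λ { (c , d , d≉0) → borel c d≉0 , G-borel c d≉0 , borel-stabilizes 0# c d≉0 (zeroˡ d) })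
    (λ (c≈c′ , d≈d′) → ≋⇒∼ᴹ (matrix₁-cong c≈c′ d≈d′))
    matrix₁-injective
    (λ { (φ , s) → surjective φ (Stabilizer₁-matrix φ s) })
    (HasSize-× setoid Fˣₛ size (HasSize-remove setoid 0# size))
    where
    surjective : ∀ φ → (∃₂ λ c d → d # 0# × matrix φ ∼ᴹ matrix₁ c d) →
      ∃ λ (x : Setoid.Carrier (setoid ×ₛ Fˣₛ)) → matrix₁ (proj₁ x) (proj₁ (proj₂ x)) ∼ᴹ matrix φ
    surjective φ (c , d , d#0 , φ∼) = (c , d , #⇒≉ d#0) , ∼ᴹ-sym {matrix φ} {matrix₁ c d} φ∼

  Stabilizer₂-size : HasSize (SubsetSetoid projectivitySetoid (Stabilizer line₂)) q
  Stabilizer₂-size = HasSize-transfer setoid (SubsetSetoid projectivitySetoid (Stabilizer line₂))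
    (λ c → borel c 1≉0 , G-borel c 1≉0 , borel-stabilizes 1# c 1≉0 (*-identityʳ 1#))
    (λ c≈c′ → ≋⇒∼ᴹ (matrix₁-cong c≈c′ refl))
    (λ e → proj₁ (matrix₁-injective e))
    (λ { (φ , s) → surjective φ (Stabilizer₂-matrix₁ φ s) })
    size
    where
    surjective : ∀ φ → (∃ λ c → matrix φ ∼ᴹ matrix₁ c 1#) → ∃ λ c → matrix₁ c 1# ∼ᴹ matrix φ
    surjective φ (c , φ∼) = c , ∼ᴹ-sym {matrix φ} {matrix₁ c 1#} φ∼

open import Data.Nat.Base using (_+_; _*_; _^_; _≤_)

theorem6p3 : ∀ {c ℓ₁ ℓ₂} (F : HeytingField c ℓ₁ ℓ₂) (q : ℕ) →
    HasSize (HeytingField.setoid F) q → 2 ∣ q → 8 ≤ q →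
    let open ProjectiveSpace F in
    (∀ L → UΓ-line L ⇔ (Orbit line₁ L ⊎ Orbit line₂ L))
    × (∀ L → ¬ (Orbit line₁ L × Orbit line₂ L))
    × HasSize (SubsetSetoid lineSetoid (Orbit line₁)) (q + 1)
    × HasSize (SubsetSetoid lineSetoid (Orbit line₂)) (q ^ 2 ∸ 1)
    × ComplementaryReguli Tangent (Orbit line₁)
    × HasSize (SubsetSetoid projectivitySetoid (Stabilizer line₁)) (q * (q ∸ 1))
    × (∀ φ → Stabilizer line₁ φ → ∃ λ c → ∃ λ d → d # 0# × matrix φ ∼ᴹ matrix₁ c d)
    × HasSize (SubsetSetoid projectivitySetoid (Stabilizer line₂)) q
    × (∀ φ → Stabilizer line₂ φ → ∃ λ c → matrix φ ∼ᴹ matrix₂ c)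
theorem6p3 F q size 2∣q 8≤q =
    UΓ⇔Orbits
  , Orbits-disjoint
  , Orbit₁-size
  , Orbit₂-size
  , tangents-Orbit₁-complementary
  , Stabilizer₁-size
  , Stabilizer₁-matrix
  , Stabilizer₂-size
  , Stabilizer₂-matrix
  where
  open FiniteField F size using (characteristic-2)
  open EvenOrder F size (characteristic-2 2∣q) (ℕ.≤-trans (ℕ.m≤n+m 6 2) 8≤q)
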